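{- Let $k\geq 1$ be an integer and let $c\geq 1$ be a real number. There exists a constant $C>0$ depending only on $k$ and $c$ such that the following holds. For any integer $m\geq 1$, any proper generalized arithmetic progression $B\subset A=\mathbb{Z}/m\mathbb{Z}$ of dimension $k$ such that $|B|\geq\sqrt{m}$, and any function $\varphi:A\to\mathbb{C}$ satisfying Condition $\mathcal{H}(c)$, we have $$\Bigl|\sum_{x\in B}\varphi(x)\Bigr|\leq C\,|B|^{1-1/(k+2)}m^{1/(2(k+2))}=C\,|B|\Bigl(\frac{\sqrt{m}}{|B|}\Bigr)^{1/(k+2)}.$$
   Context: Condition $\mathcal{H}(c)$: for a finite abelian group $A$, $\varphi:A\to\mathbb{C}$ and a real number $c\geq1$, $\varphi$ satisfies $\mathcal{H}(c)$ if (i) $\|\varphi\|_\infty=\max_{x\in A}|\varphi(x)|\leq c$; and (ii) there exists a subset $D\subset A$ with $|D|\leq c$ such that $|\mathcal{C}(\varphi,a)|\leq c\sqrt{|A|}$ for all $a\in A\setminus D$, where $\mathcal{C}(\varphi,a)=\sum_{x\in A}\varphi(x)\overline{\varphi(x+a)}$. A proper generalized arithmetic progression of dimension $k$ in a finite abelian group $A$ is a set $B$ of all elements of the form $b=a_0+n_1a_1+\cdots+n_ka_k$, where $(a_0,\ldots,a_k)\in A^{k+1}$ is fixed and each $n_i$ ranges over an interval $I_i$ of (consecutive) integers of length $|I_i|\geq 2$ (number of elements), such that the representation of any $b\in B$ in this form is unique. -}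

module Defs where

open import Algebra.Bundles using (AbelianGroup; RawMonoid; RawSemiring)
open import Algebra.Structures using (IsAbelianGroup)
import Algebra.Definitions.RawMonoid as RawMonoidDefs
import Algebra.Definitions.RawSemiring as RawSemiringDefs
open import Data.Bool.Base using (if_then_else_)
open import Data.Fin.Base using (Fin; toℕ)
open import Data.Fin.Properties using (toℕ<n; toℕ-fromℕ<; toℕ-injective)
open import Data.Fin.Subset using (Subset; _∈_; _∉_; ∣_∣)
open import Data.Fin.Subset.Properties using (x∈⁅y⁆⇒x≡y; p⊆q⇒∣p∣≤∣q∣; ∣⁅x⁆∣≡1)
open import Data.Integer.Base as ℤ using (ℤ; +_; -[1+_]; +≤+; +<+)
import Data.Integer.Properties as ℤ
open import Data.Nat.Base as ℕ using (ℕ; zero; suc; NonZero)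
open import Data.Nat.DivMod using (_%_; _mod_; m%n<n; %-distribˡ-+; m%n%n≡m%n; m<n⇒m%n≡m; n%n≡0)
import Data.Nat.Properties as ℕ
open import Data.Product.Base using (∃; _×_; _,_)
open import Data.Rational.Base as ℚ using (ℚ; 0ℚ; 1ℚ; ½; mkℚ)
import Data.Rational.Properties as ℚ
open import Data.Rational.Solver using (module +-*-Solver)
open import Data.Rational.Unnormalised.Base as ℚᵘ using (mkℚᵘ; *≤*; *<*; *≡*)
import Data.Rational.Unnormalised.Properties as ℚᵘ
open import Data.Sum.Base using (inj₁; inj₂)
open import Data.Vec.Base using (lookup)
import Data.Vec.Functional as Vector
open import Function.Bundles using (_⇔_; Equivalence)
open import Level using (0ℓ)
open import Relation.Binary.PropositionalEquality
open import Relation.Nullary.Decidable using (Dec; yes; no; does)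
open import Relation.Nullary.Negation using (¬_; contradiction)

------------------------------------------------------------------------
-- Auxiliary facts about ℚ

open RawSemiringDefs ℚ.+-*-rawSemiring using () renaming (_^_ to _^ℚ_)

infix 4 _≤ℚ_ _<ℚ_
_≤ℚ_ _<ℚ_ : ℚ → ℚ → Set
_≤ℚ_ = ℚ._≤_
_<ℚ_ = ℚ._<_

p≤∣p∣ : ∀ p → p ≤ℚ ℚ.∣ p ∣
p≤∣p∣ p with ℚ.≤-total 0ℚ p
... | inj₁ 0≤p = ℚ.≤-reflexive (sym (ℚ.0≤p⇒∣p∣≡p 0≤p))
... | inj₂ p≤0 = ℚ.≤-trans p≤0 (ℚ.0≤∣p∣ p)

∣p-q∣≤ε⇒p≤q+ε : ∀ p q {ε} → ℚ.∣ p ℚ.- q ∣ ≤ℚ ε → p ≤ℚ q ℚ.+ ε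
∣p-q∣≤ε⇒p≤q+ε p q {ε} h = begin
  p                    ≡⟨ solve 2 (λ p q → p := q :+ (p :- q)) refl p q ⟩
  q ℚ.+ (p ℚ.- q)      ≤⟨ ℚ.+-monoʳ-≤ q (ℚ.≤-trans (p≤∣p∣ (p ℚ.- q)) h) ⟩
  q ℚ.+ ε              ∎
  where open ℚ.≤-Reasoning; open +-*-Solver

p≤q+ε⇒∣p-q∣≤ε : ∀ p q {ε} → p ≤ℚ q ℚ.+ ε → q ≤ℚ p ℚ.+ ε → ℚ.∣ p ℚ.- q ∣ ≤ℚ ε
p≤q+ε⇒∣p-q∣≤ε p q {ε} h₁ h₂ with ℚ.∣p∣≡p∨∣p∣≡-p (p ℚ.- q)
... | inj₁ eq = begin
  ℚ.∣ p ℚ.- q ∣        ≡⟨ eq ⟩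
  p ℚ.- q              ≤⟨ ℚ.+-monoˡ-≤ (ℚ.- q) h₁ ⟩
  (q ℚ.+ ε) ℚ.- q      ≡⟨ solve 2 (λ q e → (q :+ e) :- q := e) refl q ε ⟩
  ε                    ∎
  where open ℚ.≤-Reasoning; open +-*-Solver
... | inj₂ eq = begin
  ℚ.∣ p ℚ.- q ∣        ≡⟨ eq ⟩
  ℚ.- (p ℚ.- q)        ≡⟨ solve 2 (λ p q → :- (p :- q) := q :- p) refl p q ⟩
  q ℚ.- p              ≤⟨ ℚ.+-monoˡ-≤ (ℚ.- p) h₂ ⟩
  (p ℚ.+ ε) ℚ.- p      ≡⟨ solve 2 (λ q e → (q :+ e) :- q := e) refl p ε ⟩
  ε                    ∎
  where open ℚ.≤-Reasoning; open +-*-Solver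

0<p*q : ∀ {p q} → 0ℚ <ℚ p → 0ℚ <ℚ q → 0ℚ <ℚ p ℚ.* q
0<p*q {p} {q} 0<p 0<q =
  ℚ.positive⁻¹ (p ℚ.* q) {{ℚ.pos*pos⇒pos p {{ℚ.positive 0<p}} q {{ℚ.positive 0<q}}}}

0≤p*q : ∀ {p q} → 0ℚ ≤ℚ p → 0ℚ ≤ℚ q → 0ℚ ≤ℚ p ℚ.* q
0≤p*q {p} {q} 0≤p 0≤q = ℚ.nonNegative⁻¹ (p ℚ.* q)
  {{ℚ.nonNeg*nonNeg⇒nonNeg p {{ℚ.nonNegative 0≤p}} q {{ℚ.nonNegative 0≤q}}}}

*-mono-≤-nonNeg : ∀ {p q r s} → 0ℚ ≤ℚ r → 0ℚ ≤ℚ q → p ≤ℚ q → r ≤ℚ s → p ℚ.* r ≤ℚ q ℚ.* s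
*-mono-≤-nonNeg {p} {q} {r} {s} 0≤r 0≤q p≤q r≤s = ℚ.≤-trans
  (ℚ.*-monoʳ-≤-nonNeg r {{ℚ.nonNegative 0≤r}} p≤q)
  (ℚ.*-monoˡ-≤-nonNeg q {{ℚ.nonNegative 0≤q}} r≤s)

0<½*ε : ∀ {ε} → 0ℚ <ℚ ε → 0ℚ <ℚ ½ ℚ.* ε
0<½*ε = 0<p*q (ℚ.positive⁻¹ ½)

½*ε+½*ε≡ε : ∀ ε → ½ ℚ.* ε ℚ.+ ½ ℚ.* ε ≡ ε
½*ε+½*ε≡ε ε = trans (sym (ℚ.*-distribʳ-+ ε ½ ½)) (ℚ.*-identityˡ ε)

------------------------------------------------------------------------
-- Real numbers: Cauchy sequences of rationals, each carrying a modulus of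
-- convergence.  Equality is the relation _≃ℝ_, not _≡_.

IsCauchy : (ℕ → ℚ) → Set
IsCauchy x = ∀ ε → 0ℚ <ℚ ε →
  ∃ λ N → ∀ i j → N ℕ.≤ i → N ℕ.≤ j → ℚ.∣ x i ℚ.- x j ∣ ≤ℚ ε

record ℝ : Set where
  constructor mkℝ
  field
    seq    : ℕ → ℚ
    cauchy : IsCauchy seq

open ℝ public

infix 4 _≃ℝ_ _≤ℝ_ _<ℝ_

-- Records rather than functions, so that x and y can be inferred.

record _≃ℝ_ (x y : ℝ) : Set where
  constructor mk≃
  field
    eventually : ∀ ε → 0ℚ <ℚ ε →
      ∃ λ N → ∀ n → N ℕ.≤ n → ℚ.∣ seq x n ℚ.- seq y n ∣ ≤ℚ ε

record _≤ℝ_ (x y : ℝ) : Set where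
  constructor mk≤
  field
    eventually : ∀ ε → 0ℚ <ℚ ε → ∃ λ N → ∀ n → N ℕ.≤ n → seq x n ≤ℚ seq y n ℚ.+ ε

record _<ℝ_ (x y : ℝ) : Set where
  constructor mk<
  field
    gap        : ℚ
    0<gap      : 0ℚ <ℚ gap
    eventually : ∃ λ N → ∀ n → N ℕ.≤ n → seq x n ℚ.+ gap ≤ℚ seq y n

one-sided⇒cauchy : ∀ x →
  (∀ ε → 0ℚ <ℚ ε → ∃ λ N → ∀ i j → N ℕ.≤ i → N ℕ.≤ j → x i ≤ℚ x j ℚ.+ ε) → IsCauchy x
one-sided⇒cauchy x h ε 0<ε with h ε 0<ε
... | N , b = N , λ i j N≤i N≤j → p≤q+ε⇒∣p-q∣≤ε (x i) (x j) (b i j N≤i N≤j) (b j i N≤j N≤i)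

cauchy⇒one-sided : ∀ x → IsCauchy x →
  ∀ ε → 0ℚ <ℚ ε → ∃ λ N → ∀ i j → N ℕ.≤ i → N ℕ.≤ j → x i ≤ℚ x j ℚ.+ ε
cauchy⇒one-sided x h ε 0<ε with h ε 0<ε
... | N , b = N , λ i j N≤i N≤j → ∣p-q∣≤ε⇒p≤q+ε (x i) (x j) (b i j N≤i N≤j)

opaque
  const-cauchy : ∀ q → IsCauchy (λ _ → q)
  const-cauchy q ε 0<ε = 0 , λ _ _ _ _ →
    ℚ.≤-trans (ℚ.≤-reflexive (cong ℚ.∣_∣ (ℚ.+-inverseʳ q))) (ℚ.<⇒≤ 0<ε)

fromℚ : ℚ → ℝ
fromℚ q = mkℝ (λ _ → q) (const-cauchy q)

fromℕ : ℕ → ℝ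
fromℕ n = fromℚ (+ n ℚ./ 1)

0ℝ 1ℝ : ℝ
0ℝ = fromℚ 0ℚ
1ℝ = fromℚ 1ℚ

infixl 6 _+ℝ_ _-ℝ_ _⊔ℝ_
infixl 7 _*ℝ_ _/ℝ_
infix  8 -ℝ_

opaque
  +-cauchy : ∀ x y → IsCauchy x → IsCauchy y → IsCauchy (λ n → x n ℚ.+ y n)
  +-cauchy x y cx cy = one-sided⇒cauchy _ λ ε 0<ε →
    let (M , bx) = cauchy⇒one-sided x cx (½ ℚ.* ε) (0<½*ε 0<ε)
        (N , by) = cauchy⇒one-sided y cy (½ ℚ.* ε) (0<½*ε 0<ε)
    in M ℕ.⊔ N , λ i j l l′ → begin
      x i ℚ.+ y i
        ≤⟨ ℚ.+-mono-≤ (bx i j (ℕ.m⊔n≤o⇒m≤o M N l) (ℕ.m⊔n≤o⇒m≤o M N l′))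
                      (by i j (ℕ.m⊔n≤o⇒n≤o M N l) (ℕ.m⊔n≤o⇒n≤o M N l′)) ⟩
      (x j ℚ.+ ½ ℚ.* ε) ℚ.+ (y j ℚ.+ ½ ℚ.* ε)
        ≡⟨ solve 3 (λ x y e → (x :+ e) :+ (y :+ e) := (x :+ y) :+ (e :+ e)) refl
             (x j) (y j) (½ ℚ.* ε) ⟩
      (x j ℚ.+ y j) ℚ.+ (½ ℚ.* ε ℚ.+ ½ ℚ.* ε)
        ≡⟨ cong ((x j ℚ.+ y j) ℚ.+_) (½*ε+½*ε≡ε ε) ⟩
      (x j ℚ.+ y j) ℚ.+ ε ∎
    where open ℚ.≤-Reasoning; open +-*-Solver

_+ℝ_ : ℝ → ℝ → ℝ
x +ℝ y = mkℝ (λ n → seq x n ℚ.+ seq y n) (+-cauchy (seq x) (seq y) (cauchy x) (cauchy y))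

opaque
  neg-cauchy : ∀ x → IsCauchy x → IsCauchy (λ n → ℚ.- x n)
  neg-cauchy x cx ε 0<ε =
    let (N , b) = cx ε 0<ε
    in N , λ i j N≤i N≤j → begin
      ℚ.∣ ℚ.- x i ℚ.- ℚ.- x j ∣
        ≡⟨ cong ℚ.∣_∣ (solve 2 (λ x y → :- x :- :- y := y :- x) refl (x i) (x j)) ⟩
      ℚ.∣ x j ℚ.- x i ∣
        ≤⟨ b j i N≤j N≤i ⟩
      ε ∎
    where open ℚ.≤-Reasoning; open +-*-Solver

-ℝ_ : ℝ → ℝ
-ℝ x = mkℝ (λ n → ℚ.- seq x n) (neg-cauchy (seq x) (cauchy x))

_-ℝ_ : ℝ → ℝ → ℝ
x -ℝ y = x +ℝ (-ℝ y)

cauchy⇒bounded : ∀ x → IsCauchy x →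
  ∃ λ K → 0ℚ <ℚ K × ∃ λ N → ∀ n → N ℕ.≤ n → ℚ.∣ x n ∣ ≤ℚ K
cauchy⇒bounded x h =
  let (N , b) = h 1ℚ (ℚ.positive⁻¹ 1ℚ)
  in ℚ.∣ x N ∣ ℚ.+ 1ℚ
   , ℚ.+-mono-≤-< (ℚ.0≤∣p∣ (x N)) (ℚ.positive⁻¹ 1ℚ)
   , N , λ n N≤n → begin
    ℚ.∣ x n ∣
      ≡⟨ cong ℚ.∣_∣ (solve 2 (λ p q → p := q :+ (p :- q)) refl (x n) (x N)) ⟩
    ℚ.∣ x N ℚ.+ (x n ℚ.- x N) ∣
      ≤⟨ ℚ.∣p+q∣≤∣p∣+∣q∣ (x N) (x n ℚ.- x N) ⟩
    ℚ.∣ x N ∣ ℚ.+ ℚ.∣ x n ℚ.- x N ∣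
      ≤⟨ ℚ.+-monoʳ-≤ ℚ.∣ x N ∣ (b n N N≤n ℕ.≤-refl) ⟩
    ℚ.∣ x N ∣ ℚ.+ 1ℚ ∎
  where open ℚ.≤-Reasoning; open +-*-Solver

opaque
  *-cauchy : ∀ x y → IsCauchy x → IsCauchy y → IsCauchy (λ n → x n ℚ.* y n)
  *-cauchy x y cx cy ε 0<ε =
    let (K , 0<K , N₁ , bx) = cauchy⇒bounded x cx
        (L , 0<L , N₂ , by) = cauchy⇒bounded y cy
        0<S = ℚ.+-mono-< 0<K 0<L
        S = K ℚ.+ L
        instance
          S⁺ : ℚ.Positive S
          S⁺ = ℚ.positive 0<S
          S≢0 : ℚ.NonZero S
          S≢0 = ℚ.pos⇒nonZero S
        δ = (ℚ.1/ S) ℚ.* ε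
        0<δ = 0<p*q (ℚ.positive⁻¹ (ℚ.1/ S) {{ℚ.1/pos⇒pos S}}) 0<ε
        (N₃ , dx) = cx δ 0<δ
        (N₄ , dy) = cy δ 0<δ
        Sδ≡ε = trans (sym (ℚ.*-assoc S (ℚ.1/ S) ε))
                 (trans (cong (ℚ._* ε) (ℚ.*-inverseʳ S)) (ℚ.*-identityˡ ε))
        N = (N₁ ℕ.⊔ N₂) ℕ.⊔ (N₃ ℕ.⊔ N₄)
        l₁ = λ {i} (l : N ℕ.≤ i) → ℕ.m⊔n≤o⇒m≤o N₁ N₂ (ℕ.m⊔n≤o⇒m≤o (N₁ ℕ.⊔ N₂) _ l)
        l₂ = λ {i} (l : N ℕ.≤ i) → ℕ.m⊔n≤o⇒n≤o N₁ N₂ (ℕ.m⊔n≤o⇒m≤o (N₁ ℕ.⊔ N₂) _ l)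
        l₃ = λ {i} (l : N ℕ.≤ i) → ℕ.m⊔n≤o⇒m≤o N₃ N₄ (ℕ.m⊔n≤o⇒n≤o (N₁ ℕ.⊔ N₂) _ l)
        l₄ = λ {i} (l : N ℕ.≤ i) → ℕ.m⊔n≤o⇒n≤o N₃ N₄ (ℕ.m⊔n≤o⇒n≤o (N₁ ℕ.⊔ N₂) _ l)
    in N , λ i j N≤i N≤j → begin
      ℚ.∣ x i ℚ.* y i ℚ.- x j ℚ.* y j ∣
        ≡⟨ cong ℚ.∣_∣ (solve 4
             (λ a b c d → a :* b :- c :* d := a :* (b :- d) :+ (a :- c) :* d)
             refl (x i) (y i) (x j) (y j)) ⟩
      ℚ.∣ x i ℚ.* (y i ℚ.- y j) ℚ.+ (x i ℚ.- x j) ℚ.* y j ∣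
        ≤⟨ ℚ.∣p+q∣≤∣p∣+∣q∣ (x i ℚ.* (y i ℚ.- y j)) ((x i ℚ.- x j) ℚ.* y j) ⟩
      ℚ.∣ x i ℚ.* (y i ℚ.- y j) ∣ ℚ.+ ℚ.∣ (x i ℚ.- x j) ℚ.* y j ∣
        ≡⟨ cong₂ ℚ._+_ (ℚ.∣p*q∣≡∣p∣*∣q∣ (x i) (y i ℚ.- y j))
                       (ℚ.∣p*q∣≡∣p∣*∣q∣ (x i ℚ.- x j) (y j)) ⟩
      ℚ.∣ x i ∣ ℚ.* ℚ.∣ y i ℚ.- y j ∣ ℚ.+ ℚ.∣ x i ℚ.- x j ∣ ℚ.* ℚ.∣ y j ∣
        ≤⟨ ℚ.+-mono-≤
             (*-mono-≤-nonNeg (ℚ.0≤∣p∣ (y i ℚ.- y j)) (ℚ.<⇒≤ 0<K)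
               (bx i (l₁ N≤i)) (dy i j (l₄ N≤i) (l₄ N≤j)))
             (*-mono-≤-nonNeg (ℚ.0≤∣p∣ (y j)) (ℚ.<⇒≤ 0<δ)
               (dx i j (l₃ N≤i) (l₃ N≤j)) (by j (l₂ N≤j))) ⟩
      K ℚ.* δ ℚ.+ δ ℚ.* L
        ≡⟨ solve 3 (λ k l d → k :* d :+ d :* l := (k :+ l) :* d) refl K L δ ⟩
      S ℚ.* δ
        ≡⟨ Sδ≡ε ⟩
      ε ∎
    where open ℚ.≤-Reasoning; open +-*-Solver

_*ℝ_ : ℝ → ℝ → ℝ
x *ℝ y = mkℝ (λ n → seq x n ℚ.* seq y n) (*-cauchy (seq x) (seq y) (cauchy x) (cauchy y))

_/ℝ_ : ℝ → (n : ℕ) .{{_ : NonZero n}} → ℝ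
x /ℝ n = x *ℝ fromℚ (+ 1 ℚ./ n)

⊔-lipschitz : ∀ p q r s {ε} → p ≤ℚ r ℚ.+ ε → q ≤ℚ s ℚ.+ ε → p ℚ.⊔ q ≤ℚ (r ℚ.⊔ s) ℚ.+ ε
⊔-lipschitz p q r s {ε} h₁ h₂ = ℚ.⊔-lub
  (ℚ.≤-trans h₁ (ℚ.+-monoˡ-≤ ε (ℚ.p≤p⊔q r s)))
  (ℚ.≤-trans h₂ (ℚ.+-monoˡ-≤ ε (ℚ.p≤q⊔p r s)))

opaque
  ⊔-cauchy : ∀ x y → IsCauchy x → IsCauchy y → IsCauchy (λ n → x n ℚ.⊔ y n)
  ⊔-cauchy x y cx cy = one-sided⇒cauchy _ λ ε 0<ε →
    let (M , bx) = cauchy⇒one-sided x cx ε 0<ε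
        (N , by) = cauchy⇒one-sided y cy ε 0<ε
    in M ℕ.⊔ N , λ i j l l′ → ⊔-lipschitz (x i) (y i) (x j) (y j)
         (bx i j (ℕ.m⊔n≤o⇒m≤o M N l) (ℕ.m⊔n≤o⇒m≤o M N l′))
         (by i j (ℕ.m⊔n≤o⇒n≤o M N l) (ℕ.m⊔n≤o⇒n≤o M N l′))

_⊔ℝ_ : ℝ → ℝ → ℝ
x ⊔ℝ y = mkℝ (λ n → seq x n ℚ.⊔ seq y n) (⊔-cauchy (seq x) (seq y) (cauchy x) (cauchy y))

ℝ-rawSemiring : RawSemiring 0ℓ 0ℓ
ℝ-rawSemiring = record
  { Carrier = ℝ ; _≈_ = _≃ℝ_ ; _+_ = _+ℝ_ ; _*_ = _*ℝ_ ; 0# = 0ℝ ; 1# = 1ℝ }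

open RawSemiringDefs ℝ-rawSemiring public using () renaming (_^_ to _^ℝ_)

------------------------------------------------------------------------
-- n-th roots

-- The largest t ≤ bound with (t / (j + 1))ⁿ ≤ q, or 0 if there is none.
largest : (n j : ℕ) (q : ℚ) (bound : ℕ) → ℕ
largest n j q zero    = zero
largest n j q (suc t) =
  if does ((+ suc t ℚ./ suc j) ^ℚ n ℚ.≤? q) then suc t else largest n j q t

-- An upper bound on (j + 1) q^(1/n), for q ≥ 0 and n ≥ 1.
rootBound : (j : ℕ) → ℚ → ℕ
rootBound j q = suc ℤ.∣ ℚ.↥ q ∣ ℕ.* suc j

-- With q⁺ = max(q, 0) and n ≥ 1, the t such that
-- (t / (j + 1))ⁿ ≤ q⁺ < ((t + 1) / (j + 1))ⁿ.
numRoot : (n j : ℕ) → ℚ → ℕ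
numRoot n j q = largest n j (q ℚ.⊔ 0ℚ) (rootBound j (q ℚ.⊔ 0ℚ))

-- Opaque so that the search is not unfolded inside types.
opaque
  approxRoot : (n j : ℕ) → ℚ → ℚ
  approxRoot n j q = + numRoot n j q ℚ./ suc j

0≤n/d : ∀ n d .{{_ : NonZero d}} → 0ℚ ≤ℚ + n ℚ./ d
0≤n/d n d = ℚ.nonNegative⁻¹ (+ n ℚ./ d) {{ℚ.normalize-nonNeg n d}}

0≤p^n : ∀ {p} n → 0ℚ ≤ℚ p → 0ℚ ≤ℚ p ^ℚ n
0≤p^n zero    0≤p = ℚ.nonNegative⁻¹ 1ℚ
0≤p^n (suc n) 0≤p = 0≤p*q 0≤p (0≤p^n n 0≤p)

0<p^n : ∀ {p} n → 0ℚ <ℚ p → 0ℚ <ℚ p ^ℚ n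
0<p^n zero    0<p = ℚ.positive⁻¹ 1ℚ
0<p^n (suc n) 0<p = 0<p*q 0<p (0<p^n n 0<p)

^-mono-≤ : ∀ {p q} n → 0ℚ ≤ℚ p → p ≤ℚ q → p ^ℚ n ≤ℚ q ^ℚ n
^-mono-≤ zero    0≤p p≤q = ℚ.≤-refl
^-mono-≤ (suc n) 0≤p p≤q =
  *-mono-≤-nonNeg (0≤p^n n 0≤p) (ℚ.≤-trans 0≤p p≤q) p≤q (^-mono-≤ n 0≤p p≤q)

p≤p^n : ∀ {p} n .{{_ : NonZero n}} → 1ℚ ≤ℚ p → p ≤ℚ p ^ℚ n
p≤p^n {p} (suc n) 1≤p = begin
  p              ≡⟨ ℚ.*-identityʳ p ⟨
  p ℚ.* 1ℚ       ≤⟨ ℚ.*-monoˡ-≤-nonNeg p {{ℚ.nonNegative 0≤p}} (1≤p^n n) ⟩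
  p ℚ.* p ^ℚ n   ∎
  where
  open ℚ.≤-Reasoning
  0≤p = ℚ.≤-trans (ℚ.nonNegative⁻¹ 1ℚ) 1≤p
  1≤p^n : ∀ n → 1ℚ ≤ℚ p ^ℚ n
  1≤p^n zero    = ℚ.≤-refl
  1≤p^n (suc n) = *-mono-≤-nonNeg {1ℚ} {p} {1ℚ} (ℚ.nonNegative⁻¹ 1ℚ) 0≤p 1≤p (1≤p^n n)

^-superadditive : ∀ {p q} n .{{_ : NonZero n}} → 0ℚ ≤ℚ p → 0ℚ ≤ℚ q →
  p ^ℚ n ℚ.+ q ^ℚ n ≤ℚ (p ℚ.+ q) ^ℚ n
^-superadditive {p} {q} 1 0≤p 0≤q = ℚ.≤-reflexive (sym (ℚ.*-distribʳ-+ 1ℚ p q))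
^-superadditive {p} {q} (suc n@(suc _)) 0≤p 0≤q = begin
  p ℚ.* P ℚ.+ q ℚ.* Q
    ≡⟨ solve 2 (λ a b → a :+ b := (a :+ b) :+ (con 0ℚ :+ con 0ℚ)) refl (p ℚ.* P) (q ℚ.* Q) ⟩
  (p ℚ.* P ℚ.+ q ℚ.* Q) ℚ.+ (0ℚ ℚ.+ 0ℚ)
    ≤⟨ ℚ.+-monoʳ-≤ (p ℚ.* P ℚ.+ q ℚ.* Q)
         (ℚ.+-mono-≤ (0≤p*q 0≤p (0≤p^n n 0≤q)) (0≤p*q 0≤q (0≤p^n n 0≤p))) ⟩
  (p ℚ.* P ℚ.+ q ℚ.* Q) ℚ.+ (p ℚ.* Q ℚ.+ q ℚ.* P)
    ≡⟨ solve 4 (λ p q P Q →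
         (p :* P :+ q :* Q) :+ (p :* Q :+ q :* P) := (p :+ q) :* (P :+ Q)) refl p q P Q ⟩
  (p ℚ.+ q) ℚ.* (P ℚ.+ Q)
    ≤⟨ ℚ.*-monoˡ-≤-nonNeg (p ℚ.+ q) {{ℚ.nonNegative (ℚ.+-mono-≤ 0≤p 0≤q)}}
         (^-superadditive n 0≤p 0≤q) ⟩
  (p ℚ.+ q) ℚ.* (p ℚ.+ q) ^ℚ n ∎
  where
  open ℚ.≤-Reasoning; open +-*-Solver
  P = p ^ℚ n
  Q = q ^ℚ n

toℚᵘ-/ : ∀ i d → ℚ.toℚᵘ (i ℚ./ suc d) ℚᵘ.≃ mkℚᵘ i d
toℚᵘ-/ i d = ℚ.toℚᵘ-fromℚᵘ (mkℚᵘ i d)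

suc/≡ : ∀ t j → + suc t ℚ./ suc j ≡ + t ℚ./ suc j ℚ.+ + 1 ℚ./ suc j
suc/≡ t j = ℚ.toℚᵘ-injective (begin
  ℚ.toℚᵘ (+ suc t ℚ./ suc j)
    ≈⟨ toℚᵘ-/ (+ suc t) j ⟩
  mkℚᵘ (+ suc t) j
    ≈⟨ *≡* (lemma (+ t) (+ suc j)) ⟩
  mkℚᵘ (+ t) j ℚᵘ.+ mkℚᵘ (+ 1) j
    ≈⟨ ℚᵘ.+-cong (toℚᵘ-/ (+ t) j) (toℚᵘ-/ (+ 1) j) ⟨
  ℚ.toℚᵘ (+ t ℚ./ suc j) ℚᵘ.+ ℚ.toℚᵘ (+ 1 ℚ./ suc j)
    ≈⟨ ℚ.toℚᵘ-homo-+ (+ t ℚ./ suc j) (+ 1 ℚ./ suc j) ⟨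
  ℚ.toℚᵘ (+ t ℚ./ suc j ℚ.+ + 1 ℚ./ suc j) ∎)
  where
  open ℚᵘ.≃-Reasoning
  lemma : ∀ t d → (+ 1 ℤ.+ t) ℤ.* (d ℤ.* d) ≡ (t ℤ.* d ℤ.+ + 1 ℤ.* d) ℤ.* d
  lemma t d = trans (cong (ℤ._* (d ℤ.* d)) (ℤ.+-comm (+ 1) t))
    (trans (sym (ℤ.*-assoc (t ℤ.+ + 1) d d)) (cong (ℤ._* d) (ℤ.*-distribʳ-+ d t (+ 1))))

if-elim : ∀ {P A : Set} (Q : A → Set) (d : Dec P) {a b : A} →
  (P → Q a) → (¬ P → Q b) → Q (if does d then a else b)
if-elim Q (yes p) f g = f p
if-elim Q (no ¬p) f g = g ¬p

0^n≡0 : ∀ n .{{_ : NonZero n}} → 0ℚ ^ℚ n ≡ 0ℚ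
0^n≡0 (suc n) = ℚ.*-zeroˡ (0ℚ ^ℚ n)

largest-lower : ∀ n j q b .{{_ : NonZero n}} → 0ℚ ≤ℚ q →
  (+ largest n j q b ℚ./ suc j) ^ℚ n ≤ℚ q
largest-lower n j q zero 0≤q = ℚ.≤-trans
  (ℚ.≤-reflexive (trans (cong (_^ℚ n) (ℚ.0/n≡0 (suc j))) (0^n≡0 n))) 0≤q
largest-lower n j q (suc t) 0≤q = if-elim
  (λ r → (+ r ℚ./ suc j) ^ℚ n ≤ℚ q) ((+ suc t ℚ./ suc j) ^ℚ n ℚ.≤? q)
  (λ h → h) (λ _ → largest-lower n j q t 0≤q)

largest-upper : ∀ n j q b → q <ℚ (+ suc b ℚ./ suc j) ^ℚ n →
  q <ℚ (+ suc (largest n j q b) ℚ./ suc j) ^ℚ n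
largest-upper n j q zero    h = h
largest-upper n j q (suc t) h = if-elim
  (λ r → q <ℚ (+ suc r ℚ./ suc j) ^ℚ n) ((+ suc t ℚ./ suc j) ^ℚ n ℚ.≤? q)
  (λ _ → h) (λ ¬h → largest-upper n j q t (ℚ.≰⇒> ¬h))

i≤∣i∣ : ∀ i → i ℤ.≤ + ℤ.∣ i ∣
i≤∣i∣ (+ n)      = ℤ.≤-refl
i≤∣i∣ (-[1+ n ]) = ℤ.-≤+

rootBound-upper : ∀ n j q .{{_ : NonZero n}} → q <ℚ (+ suc (rootBound j q) ℚ./ suc j) ^ℚ n
rootBound-upper n j q@(mkℚ i d-1 _) = ℚ.<-≤-trans q<r (p≤p^n n 1≤r)
  where
  A = ℤ.∣ i ∣
  B = rootBound j q
  1≤r : 1ℚ ≤ℚ + suc B ℚ./ suc j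
  1≤r = ℚ.toℚᵘ-cancel-≤ (ℚᵘ.≤-respʳ-≃ (ℚᵘ.≃-sym (toℚᵘ-/ (+ suc B) j))
    (*≤* (subst₂ ℤ._≤_ (sym (ℤ.*-identityˡ (+ suc j))) (sym (ℤ.*-identityʳ (+ suc B)))
      (+≤+ (ℕ.≤-trans (ℕ.m≤n*m (suc j) (suc A)) (ℕ.n≤1+n B))))))
  q<r : q <ℚ + suc B ℚ./ suc j
  q<r = ℚ.toℚᵘ-cancel-< (ℚᵘ.<-respʳ-≃ (ℚᵘ.≃-sym (toℚᵘ-/ (+ suc B) j))
    (*<* (ℤ.≤-<-trans (ℤ.*-monoʳ-≤-nonNeg (+ suc j) (i≤∣i∣ i))
      (subst₂ ℤ._<_ (ℤ.pos-* A (suc j)) (ℤ.pos-* (suc B) (suc d-1))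
        (+<+ (ℕ.<-≤-trans (ℕ.s≤s (ℕ.*-monoˡ-≤ (suc j) (ℕ.n≤1+n A)))
                          (ℕ.m≤m*n (suc B) (suc d-1))))))))

opaque
  unfolding approxRoot

  0≤approxRoot : ∀ n j q → 0ℚ ≤ℚ approxRoot n j q
  0≤approxRoot n j q = 0≤n/d (numRoot n j q) (suc j)

  approxRoot-lower : ∀ n j q .{{_ : NonZero n}} → approxRoot n j q ^ℚ n ≤ℚ q ℚ.⊔ 0ℚ
  approxRoot-lower n j q =
    largest-lower n j (q ℚ.⊔ 0ℚ) (rootBound j (q ℚ.⊔ 0ℚ)) (ℚ.p≤q⊔p q 0ℚ)

  approxRoot-upper : ∀ n j q .{{_ : NonZero n}} →
    q ℚ.⊔ 0ℚ <ℚ (approxRoot n j q ℚ.+ + 1 ℚ./ suc j) ^ℚ n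
  approxRoot-upper n j q = subst (λ z → (q ℚ.⊔ 0ℚ) <ℚ z ^ℚ n) (suc/≡ (numRoot n j q) j)
    (largest-upper n j (q ℚ.⊔ 0ℚ) (rootBound j (q ℚ.⊔ 0ℚ)) (rootBound-upper n j (q ℚ.⊔ 0ℚ)))

approxRoot-uniform : ∀ n i j p q δ .{{_ : NonZero n}} → 0ℚ <ℚ δ → p ≤ℚ q ℚ.+ δ ^ℚ n →
  approxRoot n i p ≤ℚ (approxRoot n j q ℚ.+ + 1 ℚ./ suc j) ℚ.+ δ
approxRoot-uniform n i j p q δ 0<δ p≤q+δⁿ = ℚ.≮⇒≥ λ s+δ<r → ℚ.<-irrefl refl (begin-strict
  p ℚ.⊔ 0ℚ
    ≤⟨ ⊔-lipschitz p 0ℚ q 0ℚ p≤q+δⁿ (ℚ.+-mono-≤ ℚ.≤-refl (0≤p^n n 0≤δ)) ⟩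
  (q ℚ.⊔ 0ℚ) ℚ.+ δ ^ℚ n
    <⟨ ℚ.+-monoˡ-< (δ ^ℚ n) (approxRoot-upper n j q) ⟩
  s ^ℚ n ℚ.+ δ ^ℚ n
    ≤⟨ ^-superadditive n 0≤s 0≤δ ⟩
  (s ℚ.+ δ) ^ℚ n
    ≤⟨ ^-mono-≤ n (ℚ.+-mono-≤ 0≤s 0≤δ) (ℚ.<⇒≤ s+δ<r) ⟩
  approxRoot n i p ^ℚ n
    ≤⟨ approxRoot-lower n i p ⟩
  p ℚ.⊔ 0ℚ ∎)
  where
  open ℚ.≤-Reasoning
  s = approxRoot n j q ℚ.+ + 1 ℚ./ suc j
  0≤δ = ℚ.<⇒≤ 0<δ
  0≤s : 0ℚ ≤ℚ s
  0≤s = ℚ.+-mono-≤ (0≤approxRoot n j q) (0≤n/d 1 (suc j))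

archimedean : ∀ ε → 0ℚ <ℚ ε → ∀ j → ℚ.↧ₙ ε ℕ.≤ j → + 1 ℚ./ suc j ≤ℚ ε
archimedean (mkℚ (+ zero) _ _) 0<ε = contradiction (ℚ.drop-*<* 0<ε) λ { (+<+ ()) }
archimedean (mkℚ -[1+ _ ] _ _) 0<ε = contradiction (ℚ.drop-*<* 0<ε) λ ()
archimedean (mkℚ (+ suc a) d-1 _) _ j d≤j =
  ℚ.toℚᵘ-cancel-≤ (ℚᵘ.≤-respˡ-≃ (ℚᵘ.≃-sym (toℚᵘ-/ (+ 1) j))
    (*≤* (subst₂ ℤ._≤_ (sym (ℤ.*-identityˡ (+ suc d-1))) (ℤ.pos-* (suc a) (suc j))
      (+≤+ (ℕ.≤-trans d≤j (ℕ.≤-trans (ℕ.n≤1+n j) (ℕ.m≤n*m (suc j) (suc a))))))))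

opaque
  root-cauchy : ∀ n x .{{_ : NonZero n}} → IsCauchy x → IsCauchy (λ j → approxRoot n j (x j))
  root-cauchy n x cx = one-sided⇒cauchy _ λ ε 0<ε →
    let δ = ½ ℚ.* ε
        0<δ = 0<½*ε 0<ε
        (M , b) = cauchy⇒one-sided x cx (δ ^ℚ n) (0<p^n n 0<δ)
        N = ℚ.↧ₙ δ
    in M ℕ.⊔ N , λ i j l l′ → begin
      approxRoot n i (x i)
        ≤⟨ approxRoot-uniform n i j (x i) (x j) δ 0<δ
             (b i j (ℕ.m⊔n≤o⇒m≤o M N l) (ℕ.m⊔n≤o⇒m≤o M N l′)) ⟩
      (approxRoot n j (x j) ℚ.+ + 1 ℚ./ suc j) ℚ.+ δ
        ≤⟨ ℚ.+-monoˡ-≤ δ (ℚ.+-monoʳ-≤ (approxRoot n j (x j))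
             (archimedean δ 0<δ j (ℕ.m⊔n≤o⇒n≤o M N l′))) ⟩
      (approxRoot n j (x j) ℚ.+ δ) ℚ.+ δ
        ≡⟨ ℚ.+-assoc (approxRoot n j (x j)) δ δ ⟩
      approxRoot n j (x j) ℚ.+ (δ ℚ.+ δ)
        ≡⟨ cong (approxRoot n j (x j) ℚ.+_) (½*ε+½*ε≡ε ε) ⟩
      approxRoot n j (x j) ℚ.+ ε ∎
    where open ℚ.≤-Reasoning

-- The n-th root of max(x, 0).
root : (n : ℕ) .{{_ : NonZero n}} → ℝ → ℝ
root n x = mkℝ (λ j → approxRoot n j (seq x j)) (root-cauchy n (seq x) (cauchy x))

√_ : ℝ → ℝ
√ x = root 2 x

-- x^(a/b) for x ≥ 0.  In particular the exponent 1 - 1/(k+2) is written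
-- [ 1 + k / 2 + k ].
infix 8 _^[_/_]
_^[_/_] : ℝ → (a b : ℕ) .{{_ : NonZero b}} → ℝ
x ^[ a / b ] = root b x ^ℝ a

------------------------------------------------------------------------
-- Complex numbers

record ℂ : Set where
  constructor _+i_
  field
    re im : ℝ

open ℂ public

0ℂ : ℂ
0ℂ = 0ℝ +i 0ℝ

infixl 6 _+ℂ_
infixl 7 _*ℂ_

_+ℂ_ : ℂ → ℂ → ℂ
z +ℂ w = (re z +ℝ re w) +i (im z +ℝ im w)

_*ℂ_ : ℂ → ℂ → ℂ
z *ℂ w = (re z *ℝ re w -ℝ im z *ℝ im w) +i (re z *ℝ im w +ℝ im z *ℝ re w)

conj : ℂ → ℂ
conj z = re z +i (-ℝ im z)

∣_∣ℂ : ℂ → ℝ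
∣ z ∣ℂ = √ (re z *ℝ re z +ℝ im z *ℝ im z)

ℂ-+-rawMonoid : RawMonoid 0ℓ 0ℓ
ℂ-+-rawMonoid = record
  { Carrier = ℂ
  ; _≈_     = λ z w → re z ≃ℝ re w × im z ≃ℝ im w
  ; _∙_     = _+ℂ_
  ; ε       = 0ℂ
  }

open RawMonoidDefs ℂ-+-rawMonoid public using () renaming (sum to sumℂ)

∑[_]_ : ∀ {n} → Subset n → (Fin n → ℂ) → ℂ
∑[ B ] f = sumℂ λ x → if lookup B x then f x else 0ℂ

------------------------------------------------------------------------
-- Finite abelian groups, with underlying set Fin order; every finite
-- abelian group is isomorphic to one of this form.

record FiniteAbelianGroup : Set where
  field
    order          : ℕ
    _+_            : Fin order → Fin order → Fin order
    0#             : Fin order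
    -_             : Fin order → Fin order
    isAbelianGroup : IsAbelianGroup _≡_ _+_ 0# -_

  Carrier : Set
  Carrier = Fin order

  abelianGroup : AbelianGroup 0ℓ 0ℓ
  abelianGroup = record { isAbelianGroup = isAbelianGroup }

  open RawMonoidDefs (AbelianGroup.rawMonoid abelianGroup) public
    using (sum) renaming (_×_ to _ℕ·_)

  infixr 8 _·_
  _·_ : ℤ → Carrier → Carrier
  (+ n)    · x = n ℕ· x
  -[1+ n ] · x = - (suc n ℕ· x)

ℤ/_ℤ : (m : ℕ) .{{_ : NonZero m}} → FiniteAbelianGroup
ℤ/ m ℤ = record
  { order = m
  ; _+_   = _⊕_
  ; 0#    = 0 mod m
  ; -_    = ⊖_
  ; isAbelianGroup = record
    { isGroup = record
      { isMonoid = record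
        { isSemigroup = record
          { isMagma = record { isEquivalence = isEquivalence ; ∙-cong = cong₂ _⊕_ }
          ; assoc = assoc
          }
        ; identity = identityˡ , λ x → trans (comm x (0 mod m)) (identityˡ x)
        }
      ; inverse = inverseˡ , λ x → trans (comm x (⊖ x)) (inverseˡ x)
      ; ⁻¹-cong = cong ⊖_
      }
    ; comm = comm
    }
  }
  where
  _⊕_ : Fin m → Fin m → Fin m
  x ⊕ y = (toℕ x ℕ.+ toℕ y) mod m
  ⊖_ : Fin m → Fin m
  ⊖ x = (m ℕ.∸ toℕ x) mod m
  toℕ-mod : ∀ a → toℕ (a mod m) ≡ a % m
  toℕ-mod a = toℕ-fromℕ< (m%n<n a m)
  mod-cong : ∀ {a b} → a % m ≡ b % m → a mod m ≡ b mod m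
  mod-cong {a} {b} eq = toℕ-injective (trans (toℕ-mod a) (trans eq (sym (toℕ-mod b))))
  toℕ% : ∀ (x : Fin m) → toℕ x % m ≡ toℕ x
  toℕ% x = m<n⇒m%n≡m (toℕ<n x)
  mod-toℕ : ∀ x → toℕ x mod m ≡ x
  mod-toℕ x = toℕ-injective (trans (toℕ-mod (toℕ x)) (toℕ% x))
  mod%ˡ : ∀ a b → (a % m ℕ.+ b) % m ≡ (a ℕ.+ b) % m
  mod%ˡ a b = trans (%-distribˡ-+ (a % m) b m)
    (trans (cong (λ z → (z ℕ.+ b % m) % m) (m%n%n≡m%n a m)) (sym (%-distribˡ-+ a b m)))
  comm : ∀ x y → x ⊕ y ≡ y ⊕ x
  comm x y = cong (_mod m) (ℕ.+-comm (toℕ x) (toℕ y))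
  assocˡ : ∀ x y z → (x ⊕ y) ⊕ z ≡ (toℕ x ℕ.+ toℕ y ℕ.+ toℕ z) mod m
  assocˡ x y z = mod-cong (trans
    (cong (λ a → (a ℕ.+ toℕ z) % m) (toℕ-mod (toℕ x ℕ.+ toℕ y)))
    (mod%ˡ (toℕ x ℕ.+ toℕ y) (toℕ z)))
  assoc : ∀ x y z → (x ⊕ y) ⊕ z ≡ x ⊕ (y ⊕ z)
  assoc x y z = trans (assocˡ x y z) (trans
    (cong (_mod m) (trans (ℕ.+-assoc (toℕ x) (toℕ y) (toℕ z)) (ℕ.+-comm (toℕ x) _)))
    (trans (sym (assocˡ y z x)) (comm (y ⊕ z) x)))
  identityˡ : ∀ x → (0 mod m) ⊕ x ≡ x
  identityˡ x = trans (mod-cong (trans (cong (λ a → (a ℕ.+ toℕ x) % m) (toℕ-mod 0))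
    (mod%ˡ 0 (toℕ x)))) (mod-toℕ x)
  inverseˡ : ∀ x → (⊖ x) ⊕ x ≡ 0 mod m
  inverseˡ x = mod-cong (trans (cong (λ a → (a ℕ.+ toℕ x) % m) (toℕ-mod (m ℕ.∸ toℕ x)))
    (trans (mod%ˡ (m ℕ.∸ toℕ x) (toℕ x))
    (trans (cong (_% m) (ℕ.m∸n+n≡m (ℕ.<⇒≤ (toℕ<n x))))
    (trans (n%n≡0 m) (sym (m<n⇒m%n≡m (ℕ.>-nonZero⁻¹ m)))))))

------------------------------------------------------------------------
-- Condition H(c) and proper generalized arithmetic progressions

module _ (A : FiniteAbelianGroup) where

  open FiniteAbelianGroup A

  -- Maximum of the values |φ(x)|; starting at 0 is harmless since these are ≥ 0.
  ‖_‖∞ : (Carrier → ℂ) → ℝ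
  ‖ φ ‖∞ = Vector.foldr _⊔ℝ_ 0ℝ λ x → ∣ φ x ∣ℂ

  𝒞 : (Carrier → ℂ) → Carrier → ℂ
  𝒞 φ a = sumℂ λ x → φ x *ℂ conj (φ (x + a))

  record ConditionH (c : ℝ) (φ : Carrier → ℂ) : Set where
    field
      bounded     : ‖ φ ‖∞ ≤ℝ c
      D           : Subset order
      ∣D∣≤c       : fromℕ ∣ D ∣ ≤ℝ c
      correlation : ∀ a → a ∉ D → ∣ 𝒞 φ a ∣ℂ ≤ℝ c *ℝ √ fromℕ order

  record ProperGAP (k : ℕ) (B : Subset order) : Set where
    field
      a₀  : Carrier
      a   : Fin k → Carrier
      -- I i = { lo i , lo i + 1 , … , lo i + len i - 1 }
      lo  : Fin k → ℤ
      len : Fin k → ℕ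
      2≤len : ∀ i → 2 ℕ.≤ len i

    InBox : (Fin k → ℤ) → Set
    InBox n = ∀ i → lo i ℤ.≤ n i × n i ℤ.< lo i ℤ.+ + len i

    point : (Fin k → ℤ) → Carrier
    point n = a₀ + sum λ i → n i · a i

    field
      elements : ∀ b → b ∈ B ⇔ ∃ λ n → InBox n × b ≡ point n
      proper   : ∀ n n′ → InBox n → InBox n′ → point n ≡ point n′ → ∀ i → n i ≡ n′ i

    ∣B∣≢0 : NonZero ∣ B ∣
    ∣B∣≢0 = ℕ.>-nonZero (ℕ.≤-trans (ℕ.≤-reflexive (sym (∣⁅x⁆∣≡1 b₀)))
      (p⊆q⇒∣p∣≤∣q∣ λ x∈ → subst (_∈ B) (sym (x∈⁅y⁆⇒x≡y b₀ x∈)) b₀∈B))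
      where
      b₀ : Carrier
      b₀ = point lo
      lo∈ : InBox lo
      lo∈ i = ℤ.≤-refl , subst (ℤ._< lo i ℤ.+ + len i) (ℤ.+-identityʳ (lo i))
        (ℤ.+-monoʳ-< (lo i) (+<+ (ℕ.≤-trans (ℕ.s≤s ℕ.z≤n) (2≤len i))))
      b₀∈B : b₀ ∈ B
      b₀∈B = Equivalence.from (elements b₀) (lo , lo∈ , refl)

-- Shifting method.  Let B have side lengths lᵢ and put N ≈ (|B| / √m)^(1/(k+2)).  Translating B by a
-- combination of the aᵢ with coefficients below ⌈lᵢ/N⌉ changes the sum over B by at most O(|B| / N),
-- so the sum may be averaged over the at least |B| / N^k such translations.  Cauchy–Schwarz and
-- extension of the sum over B to all of A bound the average by the correlations of φ at differences
-- h′ - h of translations: a fixed h gives at most |D| bad differences, since by properness the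
-- translations are distinct, and all others contribute O(√m).  The total is O(|B| / N).
--
-- All constants may be taken integral, and the estimate is proved for the rational approximations
-- of φ at every large index; real numbers enter only through the n-th roots in the bounds.

module Submission where

-- The choice of N serves good and bad differences alike. Put E = N^(k+2) with E√m ≤ |B|, and let l
-- be the number of translations. Good pairs contribute O(l²√m), which is O(l²|B|/E). Bad pairs
-- contribute O(lm), and m ≤ |B|²/E² together with |B| ≤ l N^k ≤ lE turns this into O(l²|B|/E) as
-- well. After Cauchy-Schwarz the average is O(|B|/√E), hence O(|B|/N) because E ≥ N². The order of
-- the reals is undecidable, so N cannot be found by comparison with |B|/√m. It is instead a natural
-- number that passes the test N^(2(k+2)) m ≤ |B|² while N + 1 fails it, and the hypothesis √m ≤ |B|
-- is first turned into m ≤ |B|². The finite part then never mentions √m: a correlation enters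
-- multiplied by E, with the bound 2K|B| for an integer K ≥ c + 1. Other quotients are avoided in
-- the same way, by multiplying with N or l. Real parts of correlations suffice, because their sum
-- over all ordered pairs of translations is a sum of squared moduli.

-- Natural numbers inside ℚ, squares and absolute values.

module Rationals where

  open import Defs using (0≤p*q; *-mono-≤-nonNeg; toℚᵘ-/; 0≤n/d)
  open import Data.Integer.Base as ℤ using (ℤ; +_)
  import Data.Integer.Properties as ℤ
  open import Data.Nat.Base as ℕ using (ℕ; suc)
  import Data.Nat.Properties as ℕ
  open import Data.Rational.Base
  open import Data.Rational.Properties
  open import Data.Rational.Solver using (module +-*-Solver)
  open import Data.Rational.Unnormalised.Base as ℚᵘ using (mkℚᵘ; *≤*; *≡*)
  import Data.Rational.Unnormalised.Properties as ℚᵘ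
  open import Data.Sum.Base using (inj₁; inj₂)
  open import Relation.Binary.PropositionalEquality

  -- Opaque so that the normalisation of + n / 1 is not unfolded inside types.
  opaque
    ι : ℕ → ℚ
    ι n = + n / 1

  opaque
    unfolding ι

    ι-/ : ∀ n → ι n ≡ + n / 1
    ι-/ n = refl

    ι-0 : ι 0 ≡ 0ℚ
    ι-0 = refl

    ι-1 : ι 1 ≡ 1ℚ
    ι-1 = refl

    ι-+ : ∀ m n → ι (m ℕ.+ n) ≡ ι m + ι n
    ι-+ m n = toℚᵘ-injective (begin
      toℚᵘ (ι (m ℕ.+ n))               ≈⟨ toℚᵘ-/ (+ (m ℕ.+ n)) 0 ⟩
      mkℚᵘ (+ (m ℕ.+ n)) 0             ≈⟨ *≡* (cong (ℤ._* + 1) (cong₂ ℤ._+_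
                                            (sym (ℤ.*-identityʳ (+ m))) (sym (ℤ.*-identityʳ (+ n))))) ⟩
      mkℚᵘ (+ m) 0 ℚᵘ.+ mkℚᵘ (+ n) 0   ≈⟨ ℚᵘ.+-cong (toℚᵘ-/ (+ m) 0) (toℚᵘ-/ (+ n) 0) ⟨
      toℚᵘ (ι m) ℚᵘ.+ toℚᵘ (ι n)       ≈⟨ toℚᵘ-homo-+ (ι m) (ι n) ⟨
      toℚᵘ (ι m + ι n)                 ∎)
      where open ℚᵘ.≃-Reasoning

    ι-* : ∀ m n → ι (m ℕ.* n) ≡ ι m * ι n
    ι-* m n = toℚᵘ-injective (begin
      toℚᵘ (ι (m ℕ.* n))               ≈⟨ toℚᵘ-/ (+ (m ℕ.* n)) 0 ⟩
      mkℚᵘ (+ (m ℕ.* n)) 0             ≈⟨ *≡* (cong (ℤ._* + 1) (ℤ.pos-* m n)) ⟩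
      mkℚᵘ (+ m) 0 ℚᵘ.* mkℚᵘ (+ n) 0   ≈⟨ ℚᵘ.*-cong (toℚᵘ-/ (+ m) 0) (toℚᵘ-/ (+ n) 0) ⟨
      toℚᵘ (ι m) ℚᵘ.* toℚᵘ (ι n)       ≈⟨ toℚᵘ-homo-* (ι m) (ι n) ⟨
      toℚᵘ (ι m * ι n)                 ∎)
      where open ℚᵘ.≃-Reasoning

    ι-mono : ∀ {m n} → m ℕ.≤ n → ι m ≤ ι n
    ι-mono {m} {n} m≤n = toℚᵘ-cancel-≤ (ℚᵘ.≤-respʳ-≃ (ℚᵘ.≃-sym (toℚᵘ-/ (+ n) 0))
      (ℚᵘ.≤-respˡ-≃ (ℚᵘ.≃-sym (toℚᵘ-/ (+ m) 0)) (*≤* (ℤ.*-monoʳ-≤-nonNeg (+ 1) (ℤ.+≤+ m≤n)))))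

    ι-cancel-≤ : ∀ {m n} → ι m ≤ ι n → m ℕ.≤ n
    ι-cancel-≤ {m} {n} h = ℤ.drop‿+≤+ (ℤ.*-cancelʳ-≤-pos (+ m) (+ n) (+ 1) (ℚᵘ.drop-*≤*
      (ℚᵘ.≤-respʳ-≃ (toℚᵘ-/ (+ n) 0) (ℚᵘ.≤-respˡ-≃ (toℚᵘ-/ (+ m) 0) (toℚᵘ-mono-≤ h)))))

    0≤ι : ∀ n → 0ℚ ≤ ι n
    0≤ι n = 0≤n/d n 1

  ι-suc : ∀ n → ι (suc n) ≡ 1ℚ + ι n
  ι-suc n = trans (ι-+ 1 n) (cong (_+ ι n) ι-1)

  p≤p+q : ∀ p {q} → 0ℚ ≤ q → p ≤ p + q
  p≤p+q p {q} 0≤q = subst (_≤ p + q) (+-identityʳ p) (+-monoʳ-≤ p 0≤q)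

  -- The bridge from the ring solver to inequalities: d is exhibited as a sum of squares or of
  -- products of non-negative factors, and the identity is left to the solver.
  p≡q+d⇒q≤p : ∀ {p q} d → 0ℚ ≤ d → p ≡ q + d → q ≤ p
  p≡q+d⇒q≤p {q = q} d 0≤d refl = p≤p+q q 0≤d

  *-monoˡ : ∀ {p q} r → 0ℚ ≤ r → p ≤ q → r * p ≤ r * q
  *-monoˡ r 0≤r = *-monoˡ-≤-nonNeg r {{nonNegative 0≤r}}

  *-monoʳ : ∀ {p q} r → 0ℚ ≤ r → p ≤ q → p * r ≤ q * r
  *-monoʳ r 0≤r = *-monoʳ-≤-nonNeg r {{nonNegative 0≤r}}

  *-cancelˡ : ∀ {p q} r → 0ℚ < r → r * p ≤ r * q → p ≤ q
  *-cancelˡ r 0<r = *-cancelˡ-≤-pos r {{positive 0<r}}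

  ∣p∣*∣p∣≡p*p : ∀ p → ∣ p ∣ * ∣ p ∣ ≡ p * p
  ∣p∣*∣p∣≡p*p p with ∣p∣≡p∨∣p∣≡-p p
  ... | inj₁ eq = cong₂ _*_ eq eq
  ... | inj₂ eq = trans (cong₂ _*_ eq eq) (solve 1 (λ p → (:- p) :* (:- p) := p :* p) refl p)
    where open +-*-Solver

  0≤p*p : ∀ p → 0ℚ ≤ p * p
  0≤p*p p = subst (0ℚ ≤_) (∣p∣*∣p∣≡p*p p) (0≤p*q (0≤∣p∣ p) (0≤∣p∣ p))

  p*p≤q*q⇒p≤q : ∀ {p q} → 0ℚ ≤ q → p * p ≤ q * q → p ≤ q
  p*p≤q*q⇒p≤q {p} {q} 0≤q h = ≮⇒≥ λ q<p → <-irrefl refl (begin-strict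
    p * p   ≤⟨ h ⟩
    q * q   ≤⟨ *-monoˡ q 0≤q (<⇒≤ q<p) ⟩
    q * p   <⟨ *-monoˡ-<-pos p {{positive (≤-<-trans 0≤q q<p)}} q<p ⟩
    p * p   ∎)
    where open ≤-Reasoning

  p*p≤q*q⇒∣p∣≤q : ∀ {p q} → 0ℚ ≤ q → p * p ≤ q * q → ∣ p ∣ ≤ q
  p*p≤q*q⇒∣p∣≤q {p} 0≤q h = p*p≤q*q⇒p≤q 0≤q (subst (_≤ _) (sym (∣p∣*∣p∣≡p*p p)) h)

  ∣p∣≤q⇒p*p≤q*q : ∀ {p q} → ∣ p ∣ ≤ q → p * p ≤ q * q
  ∣p∣≤q⇒p*p≤q*q {p} {q} h = subst (_≤ q * q) (∣p∣*∣p∣≡p*p p)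
    (*-mono-≤-nonNeg (0≤∣p∣ p) (≤-trans (0≤∣p∣ p) h) h h)

  ∣p-q∣≤∣p-r∣+∣r-q∣ : ∀ p q r → ∣ p - q ∣ ≤ ∣ p - r ∣ + ∣ r - q ∣
  ∣p-q∣≤∣p-r∣+∣r-q∣ p q r = subst (λ z → ∣ z ∣ ≤ ∣ p - r ∣ + ∣ r - q ∣)
    (solve 3 (λ p q r → (p :- r) :+ (r :- q) := p :- q) refl p q r)
    (∣p+q∣≤∣p∣+∣q∣ (p - r) (r - q))
    where open +-*-Solver

-- Finite rational sums and the Cauchy-Schwarz inequality.

module Sums where

  open Rationals
  open import Data.List.Base using (List; []; _∷_; _++_; map; length; cartesianProductWith)
  open import Data.List.Membership.Propositional using (_∈_)
  open import Data.List.Relation.Binary.Permutation.Propositional using (_↭_; refl; prep; swap; trans)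
  open import Data.List.Relation.Unary.Any using (here; there)
  open import Data.Nat.Base using (suc)
  open import Data.Rational.Base
  open import Data.Rational.Properties
  open import Data.Rational.Solver using (module +-*-Solver)
  open import Relation.Binary.PropositionalEquality hiding (trans)
  import Relation.Binary.PropositionalEquality as ≡

  open +-*-Solver using (solve; _:+_; _:*_; _:-_; :-_; _:=_; con)

  private variable A B C : Set

  -- Lists as index sets let boxes of vectors, translations and the whole group share one calculus
  -- of sums.
  Σℚ : List A → (A → ℚ) → ℚ
  Σℚ []       f = 0ℚ
  Σℚ (x ∷ xs) f = f x + Σℚ xs f

  Σ-cong-∈ : ∀ (xs : List A) {f g} → (∀ {x} → x ∈ xs → f x ≡ g x) → Σℚ xs f ≡ Σℚ xs g
  Σ-cong-∈ []       h = refl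
  Σ-cong-∈ (x ∷ xs) h = cong₂ _+_ (h (here refl)) (Σ-cong-∈ xs λ x∈ → h (there x∈))

  Σ-cong : ∀ (xs : List A) {f g} → (∀ x → f x ≡ g x) → Σℚ xs f ≡ Σℚ xs g
  Σ-cong xs h = Σ-cong-∈ xs λ {x} _ → h x

  Σ-mono-∈ : ∀ (xs : List A) {f g} → (∀ {x} → x ∈ xs → f x ≤ g x) → Σℚ xs f ≤ Σℚ xs g
  Σ-mono-∈ []       h = ≤-refl
  Σ-mono-∈ (x ∷ xs) h = +-mono-≤ (h (here refl)) (Σ-mono-∈ xs λ x∈ → h (there x∈))

  Σ-mono : ∀ (xs : List A) {f g} → (∀ x → f x ≤ g x) → Σℚ xs f ≤ Σℚ xs g
  Σ-mono xs h = Σ-mono-∈ xs λ {x} _ → h x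

  Σ-const : ∀ (xs : List A) c → Σℚ xs (λ _ → c) ≡ ι (length xs) * c
  Σ-const []       c = sym (≡.trans (cong (_* c) ι-0) (*-zeroˡ c))
  Σ-const (x ∷ xs) c = begin
    c + Σℚ xs (λ _ → c)        ≡⟨ cong (c +_) (Σ-const xs c) ⟩
    c + ι (length xs) * c      ≡⟨ solve 2 (λ c l → c :+ l :* c := (con 1ℚ :+ l) :* c) refl c (ι (length xs)) ⟩
    (1ℚ + ι (length xs)) * c   ≡⟨ cong (_* c) (ι-suc (length xs)) ⟨
    ι (suc (length xs)) * c    ∎
    where open ≡-Reasoning

  Σ-zero : ∀ (xs : List A) → Σℚ xs (λ _ → 0ℚ) ≡ 0ℚ
  Σ-zero xs = ≡.trans (Σ-const xs 0ℚ) (*-zeroʳ (ι (length xs)))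

  0≤Σ : ∀ (xs : List A) {f} → (∀ x → 0ℚ ≤ f x) → 0ℚ ≤ Σℚ xs f
  0≤Σ xs h = subst (_≤ Σℚ xs _) (Σ-zero xs) (Σ-mono xs h)

  Σ-+ : ∀ (xs : List A) f g → Σℚ xs (λ x → f x + g x) ≡ Σℚ xs f + Σℚ xs g
  Σ-+ []       f g = refl
  Σ-+ (x ∷ xs) f g = ≡.trans (cong (f x + g x +_) (Σ-+ xs f g))
    (solve 4 (λ a b c d → (a :+ b) :+ (c :+ d) := (a :+ c) :+ (b :+ d)) refl
      (f x) (g x) (Σℚ xs f) (Σℚ xs g))

  Σ-*ˡ : ∀ (xs : List A) c f → Σℚ xs (λ x → c * f x) ≡ c * Σℚ xs f
  Σ-*ˡ []       c f = sym (*-zeroʳ c)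
  Σ-*ˡ (x ∷ xs) c f = ≡.trans (cong (c * f x +_) (Σ-*ˡ xs c f)) (sym (*-distribˡ-+ c (f x) (Σℚ xs f)))

  Σ-*ʳ : ∀ (xs : List A) c f → Σℚ xs (λ x → f x * c) ≡ Σℚ xs f * c
  Σ-*ʳ xs c f = ≡.trans (Σ-cong xs λ x → *-comm (f x) c) (≡.trans (Σ-*ˡ xs c f) (*-comm c (Σℚ xs f)))

  Σ-neg : ∀ (xs : List A) f → Σℚ xs (λ x → - f x) ≡ - Σℚ xs f
  Σ-neg []       f = refl
  Σ-neg (x ∷ xs) f = ≡.trans (cong (- f x +_) (Σ-neg xs f)) (sym (neg-distrib-+ (f x) (Σℚ xs f)))

  Σ-minus : ∀ (xs : List A) f g → Σℚ xs (λ x → f x - g x) ≡ Σℚ xs f - Σℚ xs g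
  Σ-minus xs f g = ≡.trans (Σ-+ xs f (λ x → - g x)) (cong (Σℚ xs f +_) (Σ-neg xs g))

  Σ-++ : ∀ (xs ys : List A) f → Σℚ (xs ++ ys) f ≡ Σℚ xs f + Σℚ ys f
  Σ-++ []       ys f = sym (+-identityˡ (Σℚ ys f))
  Σ-++ (x ∷ xs) ys f = ≡.trans (cong (f x +_) (Σ-++ xs ys f)) (sym (+-assoc (f x) (Σℚ xs f) (Σℚ ys f)))

  Σ-map : ∀ (g : A → B) xs f → Σℚ (map g xs) f ≡ Σℚ xs (λ x → f (g x))
  Σ-map g []       f = refl
  Σ-map g (x ∷ xs) f = cong (f (g x) +_) (Σ-map g xs f)

  Σ-cartesianProductWith : ∀ (g : A → B → C) xs ys f →
    Σℚ (cartesianProductWith g xs ys) f ≡ Σℚ xs λ x → Σℚ ys λ y → f (g x y)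
  Σ-cartesianProductWith g []       ys f = refl
  Σ-cartesianProductWith g (x ∷ xs) ys f = ≡.trans (Σ-++ (map (g x) ys) _ f)
    (cong₂ _+_ (Σ-map (g x) ys f) (Σ-cartesianProductWith g xs ys f))

  Σ-swap : ∀ (xs : List A) (ys : List B) (f : A → B → ℚ) →
    Σℚ xs (λ x → Σℚ ys (f x)) ≡ Σℚ ys (λ y → Σℚ xs (λ x → f x y))
  Σ-swap []       ys f = sym (Σ-zero ys)
  Σ-swap (x ∷ xs) ys f = ≡.trans (cong (Σℚ ys (f x) +_) (Σ-swap xs ys f)) (sym (Σ-+ ys (f x) _))

  Σ-*-Σ : ∀ (xs : List A) (ys : List B) f g →
    Σℚ xs f * Σℚ ys g ≡ Σℚ xs (λ x → Σℚ ys (λ y → f x * g y))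
  Σ-*-Σ xs ys f g = ≡.trans (sym (Σ-*ʳ xs (Σℚ ys g) f)) (Σ-cong xs λ x → sym (Σ-*ˡ ys (f x) g))

  ∣Σ∣≤Σ∣∣ : ∀ (xs : List A) f → ∣ Σℚ xs f ∣ ≤ Σℚ xs (λ x → ∣ f x ∣)
  ∣Σ∣≤Σ∣∣ []       f = ≤-refl
  ∣Σ∣≤Σ∣∣ (x ∷ xs) f = ≤-trans (∣p+q∣≤∣p∣+∣q∣ (f x) (Σℚ xs f)) (+-monoʳ-≤ ∣ f x ∣ (∣Σ∣≤Σ∣∣ xs f))

  Σ-↭ : ∀ {xs ys : List A} f → xs ↭ ys → Σℚ xs f ≡ Σℚ ys f
  Σ-↭ f refl = refl
  Σ-↭ f (prep x p) = cong (f x +_) (Σ-↭ f p)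
  Σ-↭ f (swap {xs = xs} {ys} x y p) = ≡.trans (cong (λ s → f x + (f y + s)) (Σ-↭ f p))
    (solve 3 (λ a b c → a :+ (b :+ c) := b :+ (a :+ c)) refl (f x) (f y) (Σℚ ys f))
  Σ-↭ f (trans p q) = ≡.trans (Σ-↭ f p) (Σ-↭ f q)

  -- The difference of the two sides is the sum of the squares (t - f x)². With t the value at the
  -- head of a list, this bounds the cross term in the inductive step of Cauchy-Schwarz.
  2tΣ≤nt²+Σ² : ∀ (xs : List A) f t →
    (t + t) * Σℚ xs f ≤ ι (length xs) * (t * t) + Σℚ xs (λ x → f x * f x)
  2tΣ≤nt²+Σ² xs f t = p≡q+d⇒q≤p (Σℚ xs (λ x → (t - f x) * (t - f x)))
    (0≤Σ xs λ x → 0≤p*p (t - f x)) (begin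
      ι (length xs) * (t * t) + Σℚ xs (λ x → f x * f x)
        ≡⟨ cong (_+ Σℚ xs (λ x → f x * f x)) (Σ-const xs (t * t)) ⟨
      Σℚ xs (λ _ → t * t) + Σℚ xs (λ x → f x * f x)
        ≡⟨ Σ-+ xs _ _ ⟨
      Σℚ xs (λ x → t * t + f x * f x)
        ≡⟨ Σ-cong xs (λ x → solve 2 (λ t y → t :* t :+ y :* y := (t :+ t) :* y :+ (t :- y) :* (t :- y)) refl t (f x)) ⟩
      Σℚ xs (λ x → (t + t) * f x + (t - f x) * (t - f x))
        ≡⟨ Σ-+ xs _ _ ⟩
      Σℚ xs (λ x → (t + t) * f x) + Σℚ xs (λ x → (t - f x) * (t - f x))
        ≡⟨ cong (_+ Σℚ xs (λ x → (t - f x) * (t - f x))) (Σ-*ˡ xs (t + t) f) ⟩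
      (t + t) * Σℚ xs f + Σℚ xs (λ x → (t - f x) * (t - f x)) ∎)
    where open ≡-Reasoning

  cauchy-schwarz : ∀ (xs : List A) f →
    Σℚ xs f * Σℚ xs f ≤ ι (length xs) * Σℚ xs (λ x → f x * f x)
  cauchy-schwarz []       f = ≤-reflexive (sym (*-zeroʳ (ι 0)))
  cauchy-schwarz (x ∷ xs) f = begin
    (t + S) * (t + S)
      ≡⟨ solve 2 (λ t s → (t :+ s) :* (t :+ s) := (t :* t :+ s :* s) :+ (t :+ t) :* s) refl t S ⟩
    (t * t + S * S) + (t + t) * S
      ≤⟨ +-mono-≤ (+-monoʳ-≤ (t * t) (cauchy-schwarz xs f)) (2tΣ≤nt²+Σ² xs f t) ⟩
    (t * t + n * Q) + (n * (t * t) + Q)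
      ≡⟨ solve 3 (λ t n q → (t :* t :+ n :* q) :+ (n :* (t :* t) :+ q) := (con 1ℚ :+ n) :* (t :* t :+ q)) refl t n Q ⟩
    (1ℚ + n) * (t * t + Q)
      ≡⟨ cong (_* (t * t + Q)) (ι-suc (length xs)) ⟨
    ι (suc (length xs)) * (t * t + Q) ∎
    where
    open ≤-Reasoning
    t = f x
    S = Σℚ xs f
    n = ι (length xs)
    Q = Σℚ xs (λ x → f x * f x)

-- Sums over subsets of a finite set and their enumerations.

module FinSums where

  open Rationals
  open Sums
  open import Data.Bool.Base using (true; false; if_then_else_)
  open import Data.Fin.Base using (Fin; zero; suc)
  open import Data.Fin.Properties using () renaming (_≟_ to _≟ᶠ_)
  open import Data.Fin.Subset using (Subset; ∣_∣)
  open import Data.List.Base using (List; []; _∷_; length; filter; allFin)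
  open import Data.List.Membership.Propositional using (_∈_)
  open import Data.List.Membership.Propositional.Properties using (∈-filter⁺; ∈-filter⁻; ∈-allFin)
  open import Data.List.Membership.Propositional.Properties.WithK using (unique∧set⇒bag)
  open import Data.List.Properties using (map-tabulate)
  open import Data.List.Relation.Binary.BagAndSetEquality using (∼bag⇒↭)
  open import Data.List.Relation.Unary.Unique.Propositional using (Unique)
  open import Data.List.Relation.Unary.Unique.Propositional.Properties using (filter⁺; allFin⁺)
  open import Data.Nat.Base using (ℕ; suc)
  open import Data.Product.Base using (proj₂)
  open import Data.Rational.Base using (ℚ; _≤_; _+_; 0ℚ; 1ℚ)
  open import Data.Rational.Properties using (+-identityˡ; *-identityʳ; ≤-refl; ≤-trans; ≤-reflexive)
  open import Data.Vec.Base using ([]; _∷_; lookup)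
  open import Function.Base using (_∘_)
  open import Function.Bundles using (_⇔_; mk⇔; Equivalence)
  open import Relation.Binary.PropositionalEquality
  open import Relation.Nullary.Decidable using (does; yes; no)
  open import Relation.Unary using (Pred; Decidable)
  open import Level using (0ℓ)

  Σ-filter : ∀ {A : Set} {P : Pred A 0ℓ} (P? : Decidable P) xs f →
    Σℚ (filter P? xs) f ≡ Σℚ xs (λ x → if does (P? x) then f x else 0ℚ)
  Σ-filter P? []       f = refl
  Σ-filter P? (x ∷ xs) f with does (P? x)
  ... | true  = cong (f x +_) (Σ-filter P? xs f)
  ... | false = trans (Σ-filter P? xs f) (sym (+-identityˡ _))

  Σ-allFin-suc : ∀ n f → Σℚ (allFin (suc n)) f ≡ f zero + Σℚ (allFin n) (f ∘ suc)
  Σ-allFin-suc n f = cong (f zero +_)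
    (trans (cong (λ xs → Σℚ xs f) (sym (map-tabulate (λ i → i) suc))) (Σ-map suc (allFin n) f))

  indicator : ∀ {n} → Subset n → Fin n → ℚ
  indicator B x = if lookup B x then 1ℚ else 0ℚ

  Σ-indicator : ∀ {n} (B : Subset n) → Σℚ (allFin n) (indicator B) ≡ ι ∣ B ∣
  Σ-indicator []                = sym ι-0
  Σ-indicator {suc n} (true  ∷ B) = trans (Σ-allFin-suc n (indicator (true ∷ B)))
    (trans (cong (1ℚ +_) (Σ-indicator B)) (sym (ι-suc ∣ B ∣)))
  Σ-indicator {suc n} (false ∷ B) = trans (Σ-allFin-suc n (indicator (false ∷ B)))
    (trans (cong (0ℚ +_) (Σ-indicator B)) (+-identityˡ _))

  module _ {n : ℕ} {ys : List (Fin n)} (unique : Unique ys) where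

    -- Two duplicate-free lists with the same members are equal as bags, hence permutations of each
    -- other, and a sum does not see the order.
    Σ-enumerate : {P : Pred (Fin n) 0ℓ} (P? : Decidable P) → (∀ x → P x ⇔ x ∈ ys) → ∀ f →
      Σℚ (allFin n) (λ x → if does (P? x) then f x else 0ℚ) ≡ Σℚ ys f
    Σ-enumerate P? P⇔∈ f = trans (sym (Σ-filter P? (allFin n) f))
      (Σ-↭ f (∼bag⇒↭ (unique∧set⇒bag (filter⁺ P? (allFin⁺ n)) unique λ {x} → mk⇔
        (λ x∈ → Equivalence.to (P⇔∈ x) (proj₂ (∈-filter⁻ P? {xs = allFin n} x∈)))
        (λ x∈ → ∈-filter⁺ P? (∈-allFin x) (Equivalence.from (P⇔∈ x) x∈)))))

    private
      open import Data.List.Membership.DecPropositional (_≟ᶠ_ {n}) using (_∈?_)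

      Σ-∈? : ∀ f → Σℚ (allFin n) (λ x → if does (x ∈? ys) then f x else 0ℚ) ≡ Σℚ ys f
      Σ-∈? = Σ-enumerate (_∈? ys) λ x → mk⇔ (λ z → z) (λ z → z)

    -- Without duplicates each x is counted at most once, and the omitted terms are non-negative.
    -- This extends the sum of squares from B to the whole group, and it also counts the bad
    -- differences by |D|.
    Σ-unique-≤ : ∀ f → (∀ x → 0ℚ ≤ f x) → Σℚ ys f ≤ Σℚ (allFin n) f
    Σ-unique-≤ f 0≤f = ≤-trans (≤-reflexive (sym (Σ-∈? f))) (Σ-mono (allFin n) bound)
      where
      bound : ∀ x → (if does (x ∈? ys) then f x else 0ℚ) ≤ f x
      bound x with does (x ∈? ys)
      ... | true  = ≤-refl
      ... | false = 0≤f x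

    Σ-complete : (∀ x → x ∈ ys) → ∀ f → Σℚ ys f ≡ Σℚ (allFin n) f
    Σ-complete all∈ f = trans (sym (Σ-∈? f)) (Σ-cong (allFin n) eq)
      where
      eq : ∀ x → (if does (x ∈? ys) then f x else 0ℚ) ≡ f x
      eq x with x ∈? ys
      ... | yes _ = refl
      ... | no x∉ with () ← x∉ (all∈ x)

    module _ (B : Subset n) (B⇔∈ : ∀ x → lookup B x ≡ true ⇔ x ∈ ys) where

      open import Data.Bool.Properties using (_≟_)

      Σ-subset : ∀ f → Σℚ (allFin n) (λ x → if lookup B x then f x else 0ℚ) ≡ Σℚ ys f
      Σ-subset f = trans (Σ-cong (allFin n) eq)
        (Σ-enumerate (λ x → lookup B x ≟ true) B⇔∈ f)
        where
        eq : ∀ x → (if lookup B x then f x else 0ℚ) ≡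
                   (if does (lookup B x ≟ true) then f x else 0ℚ)
        eq x with lookup B x
        ... | true  = refl
        ... | false = refl

      ∣subset∣≡length : ι ∣ B ∣ ≡ ι (length ys)
      ∣subset∣≡length = trans (sym (Σ-indicator B)) (trans (Σ-subset (λ _ → 1ℚ))
        (trans (Σ-const ys 1ℚ) (*-identityʳ (ι (length ys)))))

-- Boxes of index vectors and the effect of shifting them.

module Boxes where

  open Rationals
  open Sums
  open import Defs using (0≤p*q)
  open import Data.Fin.Base using (Fin; zero; suc)
  open import Data.List.Base using (List; []; _∷_; length; map; cartesianProductWith; downFrom)
  open import Data.List.Membership.Propositional using (_∈_)
  open import Data.List.Membership.Propositional.Properties
    using (∈-cartesianProductWith⁺; ∈-cartesianProductWith⁻; ∈-downFrom⁺; ∈-downFrom⁻)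
  open import Data.List.Properties using (length-++; length-map; length-downFrom)
  open import Data.List.Relation.Unary.All using ([])
  open import Data.List.Relation.Unary.AllPairs using ([]; _∷_)
  open import Data.List.Relation.Unary.Any using (here)
  open import Data.List.Relation.Unary.Unique.Propositional using (Unique)
  import Data.List.Relation.Unary.Unique.Propositional.Properties as Unique
  open import Data.Nat.Base as ℕ using (ℕ; zero; suc; NonZero; pred; z≤n)
  open import Data.Nat.DivMod using (m/n*n≤m; m/n≤m; m%n<n; m≡m%n+[m/n]*n)
  import Data.Nat.Properties as ℕ
  open import Data.Product.Base using (_,_)
  open import Data.Rational.Base hiding (NonZero; _/_)
  open import Data.Rational.Properties
  open import Data.Rational.Solver using (module +-*-Solver)
  open import Data.Vec.Base using (Vec; []; _∷_; lookup; zipWith)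
  open import Data.Vec.Properties using (∷-injective)
  open import Function.Base using (_∘_)
  open import Relation.Binary.PropositionalEquality

  open +-*-Solver using (solve; _:+_; _:*_; _:-_; :-_; _:=_; con)

  -- Coordinates are offsets from the lower ends of the intervals, so natural numbers suffice and a
  -- shift is the addition of a vector.
  box : ∀ {k} → (Fin k → ℕ) → List (Vec ℕ k)
  box {zero}  len = [] ∷ []
  box {suc k} len = cartesianProductWith _∷_ (downFrom (len zero)) (box (len ∘ suc))

  ∈-box⁺ : ∀ {k} {len : Fin k → ℕ} {j} → (∀ i → lookup j i ℕ.< len i) → j ∈ box len
  ∈-box⁺ {zero}  {j = []}    h = here refl
  ∈-box⁺ {suc k} {j = _ ∷ _} h =
    ∈-cartesianProductWith⁺ _∷_ (∈-downFrom⁺ (h zero)) (∈-box⁺ (h ∘ suc))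

  ∈-box⁻ : ∀ {k} {len : Fin k → ℕ} {j} → j ∈ box len → ∀ i → lookup j i ℕ.< len i
  ∈-box⁻ {suc k} {len} j∈
    with ∈-cartesianProductWith⁻ _∷_ (downFrom (len zero)) (box (len ∘ suc)) j∈
  ... | _ , _ , i∈ , v∈ , refl = λ where
    zero    → ∈-downFrom⁻ i∈
    (suc i) → ∈-box⁻ v∈ i

  box-unique : ∀ {k} (len : Fin k → ℕ) → Unique (box len)
  box-unique {zero}  len = [] ∷ []
  box-unique {suc k} len = Unique.cartesianProductWith⁺ _∷_ ∷-injective
    (Unique.downFrom⁺ (len zero)) (box-unique (len ∘ suc))

  length-cartesianProductWith : ∀ {A B C : Set} (f : A → B → C) xs ys →
    length (cartesianProductWith f xs ys) ≡ length xs ℕ.* length ys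
  length-cartesianProductWith f []       ys = refl
  length-cartesianProductWith f (x ∷ xs) ys = trans (length-++ (map (f x) ys))
    (cong₂ ℕ._+_ (length-map (f x) ys) (length-cartesianProductWith f xs ys))

  length-box : ∀ {k} (len : Fin (suc k) → ℕ) →
    length (box len) ≡ len zero ℕ.* length (box (len ∘ suc))
  length-box len = trans
    (length-cartesianProductWith _∷_ (downFrom (len zero)) (box (len ∘ suc)))
    (cong (ℕ._* length (box (len ∘ suc))) (length-downFrom (len zero)))

  module _ {M : ℚ} where

    ∣Σ∣≤length*M : ∀ {A : Set} (xs : List A) f → (∀ x → ∣ f x ∣ ≤ M) →
      ∣ Σℚ xs f ∣ ≤ ι (length xs) * M
    ∣Σ∣≤length*M xs f h = ≤-trans (∣Σ∣≤Σ∣∣ xs f)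
      (≤-trans (Σ-mono xs h) (≤-reflexive (Σ-const xs M)))

    private
      ∣p-q∣≤2M : ∀ {p q} → ∣ p ∣ ≤ M → ∣ q ∣ ≤ M → ∣ p - q ∣ ≤ M + M
      ∣p-q∣≤2M {p} {q} hp hq = ≤-trans (∣p-q∣≤∣p∣+∣q∣ p q) (+-mono-≤ hp hq)

    Σ-downFrom-suc : ∀ g l → Σℚ (downFrom l) (g ∘ suc) - Σℚ (downFrom l) g ≡ g l - g 0
    Σ-downFrom-suc g zero    = sym (+-inverseʳ (g 0))
    Σ-downFrom-suc g (suc l) = begin
      (g (suc l) + S′) - (g l + S)
        ≡⟨ solve 4 (λ a b c d → (a :+ b) :- (c :+ d) := (a :- c) :+ (b :- d)) refl (g (suc l)) S′ (g l) S ⟩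
      (g (suc l) - g l) + (S′ - S)
        ≡⟨ cong (g (suc l) - g l +_) (Σ-downFrom-suc g l) ⟩
      (g (suc l) - g l) + (g l - g 0)
        ≡⟨ solve 3 (λ a b c → (a :- b) :+ (b :- c) := a :- c) refl (g (suc l)) (g l) (g 0) ⟩
      g (suc l) - g 0 ∎
      where
      open ≡-Reasoning
      S′ = Σℚ (downFrom l) (g ∘ suc)
      S  = Σℚ (downFrom l) g

    -- A shift by one exchanges the term g 0 for g l, a change of at most 2M. The induction on h
    -- passes to `g ∘ suc` and adds up h such changes.
    interval-shift : ∀ g → (∀ i → ∣ g i ∣ ≤ M) → ∀ l h →
      ∣ Σℚ (downFrom l) (λ i → g (h ℕ.+ i)) - Σℚ (downFrom l) g ∣ ≤ ι h * (M + M)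
    interval-shift g bd l zero    = ≤-reflexive (trans
      (cong ∣_∣ (+-inverseʳ (Σℚ (downFrom l) g))) (sym (trans (cong (_* (M + M)) ι-0) (*-zeroˡ (M + M)))))
    interval-shift g bd l (suc h) = begin
      ∣ Σℚ (downFrom l) (λ i → g (suc h ℕ.+ i)) - S ∣
        ≤⟨ ∣p-q∣≤∣p-r∣+∣r-q∣ (Σℚ (downFrom l) (λ i → g (suc h ℕ.+ i))) S S′ ⟩
      ∣ Σℚ (downFrom l) (λ i → g (suc h ℕ.+ i)) - S′ ∣ + ∣ S′ - S ∣
        ≤⟨ +-mono-≤ (interval-shift (g ∘ suc) (bd ∘ suc) l h)
             (≤-trans (≤-reflexive (cong ∣_∣ (Σ-downFrom-suc g l))) (∣p-q∣≤2M {g l} {g 0} (bd l) (bd 0))) ⟩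
      ι h * (M + M) + (M + M)
        ≡⟨ solve 2 (λ h m → h :* m :+ m := (con 1ℚ :+ h) :* m) refl (ι h) (M + M) ⟩
      (1ℚ + ι h) * (M + M)
        ≡⟨ cong (_* (M + M)) (ι-suc h) ⟨
      ι (suc h) * (M + M) ∎
      where
      open ≤-Reasoning
      S′ = Σℚ (downFrom l) (g ∘ suc)
      S  = Σℚ (downFrom l) g

  infixl 6 _+ᵥ_
  _+ᵥ_ : ∀ {k} → Vec ℕ k → Vec ℕ k → Vec ℕ k
  _+ᵥ_ = zipWith ℕ._+_

  -- Moving by hᵢ in direction i replaces at most a fraction hᵢ / lenᵢ ≤ 1 / N of the box at either
  -- end, so each of the k directions costs at most 2M|box| / N. The induction compares through
  -- `mid`, the box shifted in its first direction only: `inner` shifts the remaining coordinates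
  -- within each slice, `outer` treats the slice sums as a function on an interval. The bound on f
  -- is required everywhere because shifted vectors leave the box.
  box-shift : ∀ N {M} → 0ℚ ≤ M → ∀ {k} (len : Fin k → ℕ) (h : Vec ℕ k) →
    (∀ i → N ℕ.* lookup h i ℕ.≤ len i) → ∀ f → (∀ v → ∣ f v ∣ ≤ M) →
    ι N * ∣ Σℚ (box len) (λ v → f (h +ᵥ v)) - Σℚ (box len) f ∣ ≤
    ι k * ((M + M) * ι (length (box len)))
  box-shift N {M} 0≤M {zero} len [] _ f bd = ≤-reflexive (begin
    ι N * ∣ (f [] + 0ℚ) - (f [] + 0ℚ) ∣   ≡⟨ cong (λ z → ι N * ∣ z ∣) (+-inverseʳ (f [] + 0ℚ)) ⟩
    ι N * 0ℚ                              ≡⟨ *-zeroʳ (ι N) ⟩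
    0ℚ                                    ≡⟨ *-zeroˡ ((M + M) * ι 1) ⟨
    0ℚ * ((M + M) * ι 1)                  ≡⟨ cong (_* ((M + M) * ι 1)) ι-0 ⟨
    ι 0 * ((M + M) * ι 1)                 ∎)
    where open ≡-Reasoning
  box-shift N {M} 0≤M {suc k} len (h ∷ hs) Nh≤len f bd = begin
    ι N * ∣ Σℚ (box len) (λ v → f ((h ∷ hs) +ᵥ v)) - Σℚ (box len) f ∣
      ≡⟨ cong (λ z → ι N * ∣ z ∣) (cong₂ _-_
           (Σ-cartesianProductWith _∷_ I (box (len ∘ suc)) (λ v → f ((h ∷ hs) +ᵥ v)))
           (Σ-cartesianProductWith _∷_ I (box (len ∘ suc)) f)) ⟩
    ι N * ∣ Σℚ I (λ i → G′ (h ℕ.+ i)) - Σℚ I G ∣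
      ≤⟨ *-monoˡ (ι N) (0≤ι N) (∣p-q∣≤∣p-r∣+∣r-q∣ (Σℚ I (λ i → G′ (h ℕ.+ i))) (Σℚ I G) mid) ⟩
    ι N * (∣ Σℚ I (λ i → G′ (h ℕ.+ i)) - mid ∣ + ∣ mid - Σℚ I G ∣)
      ≡⟨ *-distribˡ-+ (ι N) _ _ ⟩
    ι N * ∣ Σℚ I (λ i → G′ (h ℕ.+ i)) - mid ∣ + ι N * ∣ mid - Σℚ I G ∣
      ≤⟨ +-mono-≤ inner outer ⟩
    ι l * (ι k * ((M + M) * ι p)) + ι l * (ι p * M + ι p * M)
      ≡⟨ solve 4 (λ l k m p → l :* (k :* ((m :+ m) :* p)) :+ l :* (p :* m :+ p :* m) :=
                   (con 1ℚ :+ k) :* ((m :+ m) :* (l :* p))) refl (ι l) (ι k) M (ι p) ⟩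
    (1ℚ + ι k) * ((M + M) * (ι l * ι p))
      ≡⟨ cong₂ (λ a b → a * ((M + M) * b)) (ι-suc k) (trans (cong ι (length-box len)) (ι-* l p)) ⟨
    ι (suc k) * ((M + M) * ι (length (box len))) ∎
    where
    open ≤-Reasoning
    l = len zero
    p = length (box (len ∘ suc))
    I = downFrom l
    G G′ : ℕ → ℚ
    G  i = Σℚ (box (len ∘ suc)) (λ v → f (i ∷ v))
    G′ i = Σℚ (box (len ∘ suc)) (λ v → f (i ∷ (hs +ᵥ v)))
    mid = Σℚ I (λ i → G (h ℕ.+ i))
    inner : ι N * ∣ Σℚ I (λ i → G′ (h ℕ.+ i)) - mid ∣ ≤ ι l * (ι k * ((M + M) * ι p))
    inner = begin
      ι N * ∣ Σℚ I (λ i → G′ (h ℕ.+ i)) - mid ∣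
        ≡⟨ cong (λ z → ι N * ∣ z ∣) (Σ-minus I (λ i → G′ (h ℕ.+ i)) (λ i → G (h ℕ.+ i))) ⟨
      ι N * ∣ Σℚ I (λ i → G′ (h ℕ.+ i) - G (h ℕ.+ i)) ∣
        ≤⟨ *-monoˡ (ι N) (0≤ι N) (∣Σ∣≤Σ∣∣ I (λ i → G′ (h ℕ.+ i) - G (h ℕ.+ i))) ⟩
      ι N * Σℚ I (λ i → ∣ G′ (h ℕ.+ i) - G (h ℕ.+ i) ∣)
        ≡⟨ Σ-*ˡ I (ι N) (λ i → ∣ G′ (h ℕ.+ i) - G (h ℕ.+ i) ∣) ⟨
      Σℚ I (λ i → ι N * ∣ G′ (h ℕ.+ i) - G (h ℕ.+ i) ∣)
        ≤⟨ Σ-mono I (λ i → box-shift N 0≤M (len ∘ suc) hs (Nh≤len ∘ suc)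
             (λ v → f ((h ℕ.+ i) ∷ v)) (λ v → bd ((h ℕ.+ i) ∷ v))) ⟩
      Σℚ I (λ _ → ι k * ((M + M) * ι p))
        ≡⟨ Σ-const I (ι k * ((M + M) * ι p)) ⟩
      ι (length I) * (ι k * ((M + M) * ι p))
        ≡⟨ cong (λ n → ι n * (ι k * ((M + M) * ι p))) (length-downFrom l) ⟩
      ι l * (ι k * ((M + M) * ι p)) ∎
    outer : ι N * ∣ mid - Σℚ I G ∣ ≤ ι l * (ι p * M + ι p * M)
    outer = begin
      ι N * ∣ mid - Σℚ I G ∣
        ≤⟨ *-monoˡ (ι N) (0≤ι N) (interval-shift G (λ i → ∣Σ∣≤length*M (box (len ∘ suc)) (λ v → f (i ∷ v)) (λ v → bd (i ∷ v))) l h) ⟩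
      ι N * (ι h * (ι p * M + ι p * M))
        ≡⟨ trans (cong (_* (ι p * M + ι p * M)) (ι-* N h)) (*-assoc (ι N) (ι h) _) ⟨
      ι (N ℕ.* h) * (ι p * M + ι p * M)
        ≤⟨ *-monoʳ _ (+-mono-≤ 0≤pM 0≤pM) (ι-mono (Nh≤len zero)) ⟩
      ι l * (ι p * M + ι p * M) ∎
      where
      0≤pM : 0ℚ ≤ ι p * M
      0≤pM = 0≤p*q (0≤ι p) 0≤M

  module _ (N : ℕ) .{{_ : NonZero N}} where

    -- ⌈l / N⌉ for l ≥ 1.
    shrink : ℕ → ℕ
    shrink l = suc (pred l ℕ./ N)

    shrink-≤ : ∀ {l} → 1 ℕ.≤ l → shrink l ℕ.≤ l
    shrink-≤ {suc l} _ = ℕ.s≤s (m/n≤m l N)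

    -- This makes every vector of the shrunken box an admissible shift for `box-shift`.
    <shrink⇒*≤ : ∀ {l i} → i ℕ.< shrink l → N ℕ.* i ℕ.≤ l
    <shrink⇒*≤ {l} {i} i<s = begin
      N ℕ.* i                  ≤⟨ ℕ.*-monoʳ-≤ N (ℕ.s≤s⁻¹ i<s) ⟩
      N ℕ.* (pred l ℕ./ N)     ≡⟨ ℕ.*-comm N (pred l ℕ./ N) ⟩
      (pred l ℕ./ N) ℕ.* N     ≤⟨ m/n*n≤m (pred l) N ⟩
      pred l                   ≤⟨ ℕ.pred[n]≤n ⟩
      l                        ∎
      where open ℕ.≤-Reasoning

    ≤shrink* : ∀ l → l ℕ.≤ shrink l ℕ.* N
    ≤shrink* zero    = z≤n
    ≤shrink* (suc l) = subst (ℕ._< shrink (suc l) ℕ.* N) (sym (m≡m%n+[m/n]*n l N))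
      (ℕ.+-monoˡ-< ((l ℕ./ N) ℕ.* N) (m%n<n l N))

    -- Rounding each quotient up loses nothing: the side ⌈l/N⌉ times N is at least l. The product
    -- over the k directions is the lower bound |B| / N^k on the number of shifts.
    length-box-shrink : ∀ {k} (len : Fin k → ℕ) →
      length (box len) ℕ.≤ length (box (shrink ∘ len)) ℕ.* N ℕ.^ k
    length-box-shrink {zero}  len = ℕ.≤-refl
    length-box-shrink {suc k} len = begin
      length (box len)                                     ≡⟨ length-box len ⟩
      len zero ℕ.* length (box (len ∘ suc))                ≤⟨ ℕ.*-mono-≤ (≤shrink* (len zero)) (length-box-shrink (len ∘ suc)) ⟩
      (s ℕ.* N) ℕ.* (q ℕ.* N ℕ.^ k)                        ≡⟨ ℕ.[m*n]*[o*p]≡[m*o]*[n*p] s N q (N ℕ.^ k) ⟩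
      (s ℕ.* q) ℕ.* (N ℕ.* N ℕ.^ k)                        ≡⟨ cong (ℕ._* N ℕ.^ suc k) (length-box (shrink ∘ len)) ⟨
      length (box (shrink ∘ len)) ℕ.* N ℕ.^ suc k          ∎
      where
      open ℕ.≤-Reasoning
      s = shrink (len zero)
      q = length (box (shrink ∘ len ∘ suc))

-- Correlations and the mean square of shifted sums over the group.

module Correlation where

  open Rationals
  open Sums
  open FinSums
  open import Defs using (FiniteAbelianGroup; 0≤p*q)
  open import Algebra.Bundles using (AbelianGroup)
  import Algebra.Properties.AbelianGroup as AbelianGroupProperties
  open import Data.Bool.Base using (true; false)
  open import Data.Fin.Subset using (Subset; ∣_∣)
  open import Data.List.Base using (List; map; length; allFin)
  open import Data.List.Membership.Propositional using (_∈_)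
  open import Data.List.Membership.Propositional.Properties using (∈-allFin; ∈-map⁺)
  open import Data.List.Relation.Unary.Unique.Propositional using (Unique)
  import Data.List.Relation.Unary.Unique.Propositional.Properties as Unique
  open import Data.Rational.Base hiding (∣_∣)
  open import Data.Rational.Properties
  open import Data.Rational.Solver using (module +-*-Solver)
  open import Data.Vec.Base using (lookup)
  open import Relation.Binary.PropositionalEquality

  module _ (A : FiniteAbelianGroup) where

    open FiniteAbelianGroup A using (order; Carrier) renaming (_+_ to infixl 6 _⊕_; -_ to infix 8 ⊖_)
    private
      module A where
        open AbelianGroup (FiniteAbelianGroup.abelianGroup A) public
        open AbelianGroupProperties (FiniteAbelianGroup.abelianGroup A) public

    elements : List Carrier
    elements = allFin order

    Σ-translate : ∀ h f → Σℚ elements (λ x → f (x ⊕ h)) ≡ Σℚ elements f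
    Σ-translate h f = trans (sym (Σ-map (_⊕ h) elements f))
      (Σ-complete (Unique.map⁺ (A.∙-cancelʳ h _ _) (Unique.allFin⁺ order)) surj f)
      where
      surj : ∀ x → x ∈ map (_⊕ h) elements
      surj x = subst (_∈ map (_⊕ h) elements)
        (trans (A.assoc x (⊖ h) h) (trans (cong (x ⊕_) (A.inverseˡ h)) (A.identityʳ x)))
        (∈-map⁺ (_⊕ h) (∈-allFin (x ⊕ ⊖ h)))

    autocorrelation : (Carrier → ℚ) → Carrier → ℚ
    autocorrelation w a = Σℚ elements (λ x → w x * w (x ⊕ a))

    -- Replacing x by x - g is allowed since x runs through the whole group. This is why the sum
    -- over B has to be extended to A before the square is opened: only complete correlations are
    -- controlled.
    Σ-shifted-product : ∀ w g h →
      Σℚ elements (λ x → w (x ⊕ g) * w (x ⊕ h)) ≡ autocorrelation w (⊖ g ⊕ h)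
    Σ-shifted-product w g h = trans
      (Σ-cong elements λ x → cong (λ y → w (x ⊕ g) * w y) (sym (shift x)))
      (Σ-translate g (λ x → w x * w (x ⊕ (⊖ g ⊕ h))))
      where
      shift : ∀ x → (x ⊕ g) ⊕ (⊖ g ⊕ h) ≡ x ⊕ h
      shift x = trans (A.assoc x g (⊖ g ⊕ h)) (cong (x ⊕_)
        (trans (sym (A.assoc g (⊖ g) h)) (trans (cong (_⊕ h) (A.inverseʳ g)) (A.identityˡ h))))

    Σ-square-of-shifts : ∀ w (hs : List Carrier) →
      Σℚ elements (λ x → Σℚ hs (λ h → w (x ⊕ h)) * Σℚ hs (λ h → w (x ⊕ h))) ≡
      Σℚ hs (λ g → Σℚ hs (λ h → autocorrelation w (⊖ g ⊕ h)))
    Σ-square-of-shifts w hs = begin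
      Σℚ elements (λ x → Σℚ hs (λ h → w (x ⊕ h)) * Σℚ hs (λ h → w (x ⊕ h)))
        ≡⟨ Σ-cong elements (λ x → Σ-*-Σ hs hs (λ g → w (x ⊕ g)) (λ h → w (x ⊕ h))) ⟩
      Σℚ elements (λ x → Σℚ hs (λ g → Σℚ hs (λ h → w (x ⊕ g) * w (x ⊕ h))))
        ≡⟨ Σ-swap elements hs (λ x g → Σℚ hs (λ h → w (x ⊕ g) * w (x ⊕ h))) ⟩
      Σℚ hs (λ g → Σℚ elements (λ x → Σℚ hs (λ h → w (x ⊕ g) * w (x ⊕ h))))
        ≡⟨ Σ-cong hs (λ g → Σ-swap elements hs (λ x h → w (x ⊕ g) * w (x ⊕ h))) ⟩
      Σℚ hs (λ g → Σℚ hs (λ h → Σℚ elements (λ x → w (x ⊕ g) * w (x ⊕ h))))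
        ≡⟨ Σ-cong hs (λ g → Σ-cong hs (λ h → Σ-shifted-product w g h)) ⟩
      Σℚ hs (λ g → Σℚ hs (λ h → autocorrelation w (⊖ g ⊕ h))) ∎
      where open ≡-Reasoning

    -- Pointwise f ≤ R + T·1_D. For fixed g the differences -g + h are distinct as h varies, so at
    -- most |D| of them lie in D. Upper bounds on f suffice, without absolute values.
    Σ-differences-≤ : ∀ {hs : List Carrier} → Unique hs → (D : Subset order) (f : Carrier → ℚ) → ∀ {R T} →
      0ℚ ≤ R → 0ℚ ≤ T →
      (∀ a → lookup D a ≡ false → f a ≤ R) → (∀ a → f a ≤ T) →
      Σℚ hs (λ g → Σℚ hs (λ h → f (⊖ g ⊕ h))) ≤
      ι (length hs) * (ι (length hs) * R + T * ι ∣ D ∣)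
    Σ-differences-≤ {hs} uhs D f {R} {T} 0≤R 0≤T f≤R f≤T = begin
      Σℚ hs (λ g → Σℚ hs (λ h → f (⊖ g ⊕ h)))
        ≤⟨ Σ-mono hs inner ⟩
      Σℚ hs (λ _ → ι (length hs) * R + T * ι ∣ D ∣)
        ≡⟨ Σ-const hs _ ⟩
      ι (length hs) * (ι (length hs) * R + T * ι ∣ D ∣) ∎
      where
      open ≤-Reasoning
      0≤indicator : ∀ a → 0ℚ ≤ indicator D a
      0≤indicator a with lookup D a
      ... | true  = nonNegative⁻¹ 1ℚ
      ... | false = ≤-refl
      pointwise : ∀ a → f a ≤ R + T * indicator D a
      pointwise a with lookup D a in eq
      ... | true  = ≤-trans (f≤T a) (subst (_≤ R + T * 1ℚ) (+-identityˡ T)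
                      (+-mono-≤ 0≤R (≤-reflexive (sym (*-identityʳ T)))))
      ... | false = ≤-trans (f≤R a eq) (≤-reflexive (sym
                      (trans (cong (R +_) (*-zeroʳ T)) (+-identityʳ R))))
      inner : ∀ g → Σℚ hs (λ h → f (⊖ g ⊕ h)) ≤ ι (length hs) * R + T * ι ∣ D ∣
      inner g = begin
        Σℚ hs (λ h → f (⊖ g ⊕ h))
          ≤⟨ Σ-mono hs (λ h → pointwise (⊖ g ⊕ h)) ⟩
        Σℚ hs (λ h → R + T * indicator D (⊖ g ⊕ h))
          ≡⟨ Σ-+ hs (λ _ → R) (λ h → T * indicator D (⊖ g ⊕ h)) ⟩
        Σℚ hs (λ _ → R) + Σℚ hs (λ h → T * indicator D (⊖ g ⊕ h))
          ≡⟨ cong₂ _+_ (Σ-const hs R) (Σ-*ˡ hs T (λ h → indicator D (⊖ g ⊕ h))) ⟩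
        ι (length hs) * R + T * Σℚ hs (λ h → indicator D (⊖ g ⊕ h))
          ≡⟨ cong (λ s → ι (length hs) * R + T * s) (Σ-map (⊖ g ⊕_) hs (indicator D)) ⟨
        ι (length hs) * R + T * Σℚ (map (⊖ g ⊕_) hs) (indicator D)
          ≤⟨ +-monoʳ-≤ (ι (length hs) * R) (*-monoˡ T 0≤T
               (Σ-unique-≤ (Unique.map⁺ (A.∙-cancelˡ (⊖ g) _ _) uhs) (indicator D) 0≤indicator)) ⟩
        ι (length hs) * R + T * Σℚ elements (indicator D)
          ≡⟨ cong (λ s → ι (length hs) * R + T * s) (Σ-indicator D) ⟩
        ι (length hs) * R + T * ι ∣ D ∣ ∎

    module _ (u v : Carrier → ℚ) where

      -- The real part of 𝒞(φ, a) for φ = u + iv.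
      correlation : Carrier → ℚ
      correlation a = Σℚ elements (λ x → u x * u (x ⊕ a) + v x * v (x ⊕ a))

      -- Termwise 2(pp′ + qq′) ≤ (p² + q²) + (p′² + q′²), which needs no square roots. It is the
      -- trivial bound used at the differences in D.
      correlation-≤ : ∀ {Q} → (∀ x → u x * u x + v x * v x ≤ Q) → ∀ a → correlation a ≤ ι order * Q
      correlation-≤ {Q} norm≤Q a = ≤-trans (Σ-mono elements pointwise) (≤-reflexive
        (trans (Σ-const elements Q) (cong (λ n → ι n * Q) (length-tabulate _))))
        where
        open import Data.List.Properties using (length-tabulate)
        open +-*-Solver
        pointwise : ∀ x → u x * u (x ⊕ a) + v x * v (x ⊕ a) ≤ Q
        pointwise x = *-cancelˡ (1ℚ + 1ℚ) (positive⁻¹ (1ℚ + 1ℚ)) (≤-trans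
          (p≡q+d⇒q≤p ((p - p′) * (p - p′) + (q - q′) * (q - q′))
            (+-mono-≤ (0≤p*p (p - p′)) (0≤p*p (q - q′)))
            (solve 4 (λ p p′ q q′ → (p :* p :+ q :* q) :+ (p′ :* p′ :+ q′ :* q′) :=
              con (1ℚ + 1ℚ) :* (p :* p′ :+ q :* q′) :+
              ((p :- p′) :* (p :- p′) :+ (q :- q′) :* (q :- q′))) refl p p′ q q′))
          (≤-trans (+-mono-≤ (norm≤Q x) (norm≤Q (x ⊕ a)))
            (≤-reflexive (solve 1 (λ q → q :+ q := con (1ℚ + 1ℚ) :* q) refl Q))))
          where
          p = u x
          p′ = u (x ⊕ a)
          q = v x
          q′ = v (x ⊕ a)

      -- The sum over x in A of |Σ φ(x + h)|², the inner sum running over h in `hs`.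
      energy : List Carrier → ℚ
      energy hs = Σℚ elements (λ x →
        Σℚ hs (λ h → u (x ⊕ h)) * Σℚ hs (λ h → u (x ⊕ h)) +
        Σℚ hs (λ h → v (x ⊕ h)) * Σℚ hs (λ h → v (x ⊕ h)))

      energy≡Σcorrelation : ∀ hs → energy hs ≡ Σℚ hs (λ g → Σℚ hs (λ h → correlation (⊖ g ⊕ h)))
      energy≡Σcorrelation hs = begin
        energy hs
          ≡⟨ Σ-+ elements _ _ ⟩
        Σℚ elements (λ x → Σℚ hs (λ h → u (x ⊕ h)) * Σℚ hs (λ h → u (x ⊕ h))) +
        Σℚ elements (λ x → Σℚ hs (λ h → v (x ⊕ h)) * Σℚ hs (λ h → v (x ⊕ h)))
          ≡⟨ cong₂ _+_ (Σ-square-of-shifts u hs) (Σ-square-of-shifts v hs) ⟩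
        Σℚ hs (λ g → Σℚ hs (λ h → autocorrelation u (⊖ g ⊕ h))) +
        Σℚ hs (λ g → Σℚ hs (λ h → autocorrelation v (⊖ g ⊕ h)))
          ≡⟨ Σ-+ hs _ _ ⟨
        Σℚ hs (λ g → Σℚ hs (λ h → autocorrelation u (⊖ g ⊕ h)) +
                     Σℚ hs (λ h → autocorrelation v (⊖ g ⊕ h)))
          ≡⟨ Σ-cong hs (λ g → Σ-+ hs _ _) ⟨
        Σℚ hs (λ g → Σℚ hs (λ h → autocorrelation u (⊖ g ⊕ h) + autocorrelation v (⊖ g ⊕ h)))
          ≡⟨ Σ-cong hs (λ g → Σ-cong hs (λ h → Σ-+ elements _ _)) ⟨
        Σℚ hs (λ g → Σℚ hs (λ h → correlation (⊖ g ⊕ h))) ∎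
        where open ≡-Reasoning

      -- The factor E is carried along because the correlations off D are bounded only after
      -- multiplication by E, which clears √m from the right-hand side.
      energy-≤ : ∀ {hs} → Unique hs → (D : Subset order) → ∀ {E Q R} → 0ℚ ≤ E → 0ℚ ≤ Q → 0ℚ ≤ R →
        (∀ a → lookup D a ≡ false → E * correlation a ≤ R) →
        (∀ x → u x * u x + v x * v x ≤ Q) →
        E * energy hs ≤ ι (length hs) * (ι (length hs) * R + E * (ι order * Q) * ι ∣ D ∣)
      energy-≤ {hs} uhs D {E} {Q} {R} 0≤E 0≤Q 0≤R off-D norm≤Q = begin
        E * energy hs
          ≡⟨ cong (E *_) (energy≡Σcorrelation hs) ⟩
        E * Σℚ hs (λ g → Σℚ hs (λ h → correlation (⊖ g ⊕ h)))
          ≡⟨ Σ-*ˡ hs E _ ⟨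
        Σℚ hs (λ g → E * Σℚ hs (λ h → correlation (⊖ g ⊕ h)))
          ≡⟨ Σ-cong hs (λ g → Σ-*ˡ hs E _) ⟨
        Σℚ hs (λ g → Σℚ hs (λ h → E * correlation (⊖ g ⊕ h)))
          ≤⟨ Σ-differences-≤ uhs D (λ a → E * correlation a) 0≤R
               (0≤p*q 0≤E (0≤p*q (0≤ι order) 0≤Q)) off-D
               (λ a → *-monoˡ E 0≤E (correlation-≤ norm≤Q a)) ⟩
        ι (length hs) * (ι (length hs) * R + E * (ι order * Q) * ι ∣ D ∣) ∎
        where open ≤-Reasoning

-- The averaging argument on an injective image of a box.

module BoxSum where

  open Rationals
  open Sums
  open FinSums
  open Boxes
  open Correlation
  open import Defs using (FiniteAbelianGroup; 0≤p*q)
  open import Algebra.Bundles using (AbelianGroup)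
  import Algebra.Properties.AbelianGroup as AbelianGroupProperties
  open import Data.Bool.Base using (false)
  open import Data.Fin.Base using (Fin)
  open import Data.Fin.Subset as Subset using (Subset)
  open import Data.List.Base using (List; []; _∷_; map; length)
  open import Data.List.Membership.Propositional using (_∈_)
  open import Data.List.Properties using (length-map)
  open import Data.List.Relation.Unary.Any using (here; there)
  open import Data.List.Relation.Unary.All as All using (All)
  import Data.List.Relation.Unary.All.Properties as All
  open import Data.List.Relation.Unary.AllPairs using ([]; _∷_)
  open import Data.List.Relation.Unary.Unique.Propositional using (Unique)
  open import Data.Nat.Base as ℕ using (ℕ; suc)
  import Data.Nat.Properties as ℕ
  open import Data.Nat.Solver using () renaming (module +-*-Solver to ℕ-Solver)
  open import Data.Rational.Base hiding (NonZero; _/_)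
  open import Data.Rational.Properties
  open import Data.Rational.Solver using (module +-*-Solver)
  open import Data.Vec.Base using (Vec; lookup)
  open import Function.Base using (_∘_)
  open import Relation.Binary.PropositionalEquality

  -- Injectivity is asked on members of the list only, since properness separates index vectors
  -- inside the box and nowhere else.
  unique-map : ∀ {A B : Set} {f : A → B} {xs} →
    (∀ {x y} → x ∈ xs → y ∈ xs → f x ≡ f y → x ≡ y) → Unique xs → Unique (map f xs)
  unique-map inj []         = []
  unique-map inj (x∉ ∷ uxs) =
    All.map⁺ (All.tabulate λ y∈ fx≡fy → All.lookup x∉ y∈ (inj (here refl) (there y∈) fx≡fy))
    ∷ unique-map (λ x∈ y∈ → inj (there x∈) (there y∈)) uxs

  -- The term 2c comes from the differences off D, and (2c)²c from the at most c bad ones, each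
  -- weighted by the squared sup bound. Enlarging the total to a perfect square keeps the constant
  -- integral once roots are taken.
  2c+4c³≤[3c²]² : ∀ c → 1 ℕ.≤ c →
    (ι c + ι c) + (ι c + ι c) * (ι c + ι c) * ι c ≤
    (ι 3 * (ι c * ι c)) * (ι 3 * (ι c * ι c))
  2c+4c³≤[3c²]² c@(suc d) _ = subst₂ _≤_ left right (ι-mono (begin
    (c ℕ.+ c) ℕ.+ (c ℕ.+ c) ℕ.* (c ℕ.+ c) ℕ.* c
      ≤⟨ ℕ.m≤m+n _ _ ⟩
    ((c ℕ.+ c) ℕ.+ (c ℕ.+ c) ℕ.* (c ℕ.+ c) ℕ.* c) ℕ.+
    -- This is 9c⁴ - 4c³ - 2c expanded in d = c - 1; all coefficients are non-negative.
    (3 ℕ.+ 22 ℕ.* d ℕ.+ 42 ℕ.* (d ℕ.* d) ℕ.+ 32 ℕ.* (d ℕ.* (d ℕ.* d)) ℕ.+ 9 ℕ.* (d ℕ.* d ℕ.* (d ℕ.* d)))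
      ≡⟨ solve 1 (λ d →
           ((con 1 :+ d :+ (con 1 :+ d)) :+
            (con 1 :+ d :+ (con 1 :+ d)) :* (con 1 :+ d :+ (con 1 :+ d)) :* (con 1 :+ d)) :+
           (con 3 :+ con 22 :* d :+ con 42 :* (d :* d) :+ con 32 :* (d :* (d :* d)) :+
            con 9 :* (d :* d :* (d :* d))) :=
           (con 3 :* ((con 1 :+ d) :* (con 1 :+ d))) :* (con 3 :* ((con 1 :+ d) :* (con 1 :+ d))))
           refl d ⟩
    (3 ℕ.* (c ℕ.* c)) ℕ.* (3 ℕ.* (c ℕ.* c)) ∎))
    where
    open ℕ.≤-Reasoning
    open ℕ-Solver
    2c = ι-+ c c
    3c² = trans (ι-* 3 (c ℕ.* c)) (cong (ι 3 *_) (ι-* c c))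
    left : ι ((c ℕ.+ c) ℕ.+ (c ℕ.+ c) ℕ.* (c ℕ.+ c) ℕ.* c) ≡ _
    left = trans (ι-+ (c ℕ.+ c) _) (cong₂ _+_ 2c
      (trans (ι-* ((c ℕ.+ c) ℕ.* (c ℕ.+ c)) c)
        (cong (_* ι c) (trans (ι-* (c ℕ.+ c) (c ℕ.+ c)) (cong₂ _*_ 2c 2c)))))
    right : ι ((3 ℕ.* (c ℕ.* c)) ℕ.* (3 ℕ.* (c ℕ.* c))) ≡ _
    right = trans (ι-* (3 ℕ.* (c ℕ.* c)) (3 ℕ.* (c ℕ.* c))) (cong₂ _*_ 3c² 3c²)

  -- Here e = N^(k+2), ν = N^k, l = ∏ ⌈lᵢ/N⌉ counts the shifts, b = |B|, and Y is the sum of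
  -- the shifted sums.
  averaged-bound : ∀ {n ν e m b l d Y} c → 1 ℕ.≤ c →
    0ℚ ≤ n → 1ℚ ≤ ν → e ≡ n * n * ν → 0ℚ < e → 0ℚ ≤ m → 0ℚ ≤ b → 0ℚ ≤ l → d ≤ ι c →
    e * e * m ≤ b * b → b ≤ l * ν → ν ≤ e →
    e * (Y * Y) ≤ b * (l * (l * ((ι c + ι c) * b) + e * (m * ((ι c + ι c) * (ι c + ι c))) * d)) →
    n * ∣ Y ∣ ≤ ι 3 * (ι c * ι c) * (b * l)
  averaged-bound {n} {ν} {e} {m} {b} {l} {d} {Y} cₙ 1≤c 0≤n 1≤ν e≡n²ν 0<e 0≤m 0≤b 0≤l d≤c e²m≤b² b≤lν ν≤e eY²≤ =
    subst (_≤ ι 3 * (c * c) * (b * l)) (trans (∣p*q∣≡∣p∣*∣q∣ n Y) (cong (_* ∣ Y ∣) (0≤p⇒∣p∣≡p 0≤n)))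
      (p*p≤q*q⇒∣p∣≤q (0≤p*q (0≤p*q (0≤ι 3) (0≤p*q 0≤c 0≤c)) (0≤p*q 0≤b 0≤l)) square)
    where
    open ≤-Reasoning
    open +-*-Solver
    c = ι cₙ
    Q = (c + c) * (c + c)
    0≤c = 0≤ι cₙ
    0≤e = <⇒≤ 0<e
    0≤Q : 0ℚ ≤ Q
    0≤Q = 0≤p*p (c + c)
    0≤bl = 0≤p*q 0≤b 0≤l
    eY²≤b²l² : e * (Y * Y) ≤ (b * l) * (b * l) * ((c + c) + Q * c)
    -- Multiplying once more by e produces e²m in the term of the bad differences, the quantity that
    -- b² dominates.
    eY²≤b²l² = *-cancelˡ e 0<e (begin
      e * (e * (Y * Y))
        ≤⟨ *-monoˡ e 0≤e eY²≤ ⟩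
      e * (b * (l * (l * ((c + c) * b) + e * (m * Q) * d)))
        ≡⟨ solve 7 (λ e b l c m q d →
             e :* (b :* (l :* (l :* ((c :+ c) :* b) :+ e :* (m :* q) :* d))) :=
             b :* l :* (e :* (l :* ((c :+ c) :* b)) :+ (e :* e :* m) :* (q :* d)))
             refl e b l c m Q d ⟩
      b * l * (e * (l * ((c + c) * b)) + (e * e * m) * (Q * d))
        ≤⟨ *-monoˡ (b * l) 0≤bl (+-monoʳ-≤ (e * (l * ((c + c) * b))) (begin
             (e * e * m) * (Q * d)
               ≤⟨ *-monoˡ (e * e * m) (0≤p*q (0≤p*q 0≤e 0≤e) 0≤m) (*-monoˡ Q 0≤Q d≤c) ⟩
             (e * e * m) * (Q * c)
               ≤⟨ *-monoʳ (Q * c) (0≤p*q 0≤Q 0≤c) (begin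
                    -- One of the two factors b is exchanged for lν ≤ le, so that both terms carry
                    -- the same factor e·b·l and e can be cancelled.
                    e * e * m     ≤⟨ e²m≤b² ⟩
                    b * b         ≤⟨ *-monoˡ b 0≤b b≤lν ⟩
                    b * (l * ν)   ≤⟨ *-monoˡ b 0≤b (*-monoˡ l 0≤l ν≤e) ⟩
                    b * (l * e)   ∎) ⟩
             b * (l * e) * (Q * c) ∎)) ⟩
      b * l * (e * (l * ((c + c) * b)) + b * (l * e) * (Q * c))
        ≡⟨ solve 5 (λ e b l c q →
             b :* l :* (e :* (l :* ((c :+ c) :* b)) :+ b :* (l :* e) :* (q :* c)) :=
             e :* ((b :* l) :* (b :* l) :* ((c :+ c) :+ q :* c))) refl e b l c Q ⟩
      e * ((b * l) * (b * l) * ((c + c) + Q * c)) ∎)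
    square : (n * Y) * (n * Y) ≤ (ι 3 * (c * c) * (b * l)) * (ι 3 * (c * c) * (b * l))
    square = begin
      (n * Y) * (n * Y)
        ≡⟨ solve 2 (λ n y → (n :* y) :* (n :* y) := (n :* n) :* con 1ℚ :* (y :* y)) refl n Y ⟩
      (n * n) * 1ℚ * (Y * Y)
        -- The factor 1 grows to ν, and n²ν is e.
        ≤⟨ *-monoʳ (Y * Y) (0≤p*p Y) (*-monoˡ (n * n) (0≤p*p n) 1≤ν) ⟩
      (n * n) * ν * (Y * Y)
        ≡⟨ cong (_* (Y * Y)) e≡n²ν ⟨
      e * (Y * Y)
        ≤⟨ eY²≤b²l² ⟩
      (b * l) * (b * l) * ((c + c) + Q * c)
        ≤⟨ *-monoˡ ((b * l) * (b * l)) (0≤p*p (b * l)) (2c+4c³≤[3c²]² cₙ 1≤c) ⟩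
      (b * l) * (b * l) * ((ι 3 * (c * c)) * (ι 3 * (c * c)))
        ≡⟨ solve 2 (λ p q → p :* p :* (q :* q) := (q :* p) :* (q :* p)) refl (b * l) (ι 3 * (c * c)) ⟩
      (ι 3 * (c * c) * (b * l)) * (ι 3 * (c * c) * (b * l)) ∎

  module _ (A : FiniteAbelianGroup) (N : ℕ) .{{_ : ℕ.NonZero N}}
           {k : ℕ} (len : Fin k → ℕ) (1≤len : ∀ i → 1 ℕ.≤ len i) where

    open FiniteAbelianGroup A using (order; Carrier) renaming (_+_ to infixl 6 _⊕_; -_ to infix 8 ⊖_)
    private
      module A where
        open AbelianGroup (FiniteAbelianGroup.abelianGroup A) public
        open AbelianGroupProperties (FiniteAbelianGroup.abelianGroup A) public

      H = box (shrink N ∘ len)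
      b = length (box len)
      l = length H

    module _ (β : Carrier) (σ : Vec ℕ k → Carrier) (σ-+ : ∀ g h → σ (g +ᵥ h) ≡ σ g ⊕ σ h)
             (inj : ∀ {g h} → g ∈ box len → h ∈ box len → β ⊕ σ g ≡ β ⊕ σ h → g ≡ h) where

      private
        points = map (λ j → β ⊕ σ j) (box len)
        hs = map σ H

        points-unique : Unique points
        points-unique = unique-map inj (box-unique len)

        -- Since ⌈lᵢ/N⌉ ≤ lᵢ, the shifts are themselves index vectors of the box, so the injectivity
        -- that expresses properness also separates the translations.
        H⊆box : ∀ {j} → j ∈ H → j ∈ box len
        H⊆box j∈H = ∈-box⁺ λ i → ℕ.<-≤-trans (∈-box⁻ j∈H i) (shrink-≤ N (1≤len i))

        hs-unique : Unique hs
        hs-unique = unique-map (λ g∈ h∈ eq → inj (H⊆box g∈) (H⊆box h∈) (cong (β ⊕_) eq))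
          (box-unique (shrink N ∘ len))

        0<l : 1 ℕ.≤ l
        0<l = nonempty (∈-box⁺ {len = shrink N ∘ len} {j = replicate k 0}
          (λ i → subst (ℕ._< shrink N (len i)) (sym (lookup-replicate i 0)) (ℕ.s≤s ℕ.z≤n)))
          where
          open import Data.Vec.Base using (replicate)
          open import Data.Vec.Properties using (lookup-replicate)
          nonempty : ∀ {A : Set} {x : A} {xs} → x ∈ xs → 1 ℕ.≤ length xs
          nonempty (here _)  = ℕ.s≤s ℕ.z≤n
          nonempty (there _) = ℕ.s≤s ℕ.z≤n

      boxSum : (Carrier → ℚ) → ℚ
      boxSum w = Σℚ (box len) (λ j → w (β ⊕ σ j))

      shiftedSums : (Carrier → ℚ) → ℚ
      shiftedSums w = Σℚ points (λ x → Σℚ hs (λ h → w (x ⊕ h)))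

      -- The two orders of summation serve different ends: points outermost for Cauchy-Schwarz,
      -- shifts outermost for the comparison of each shifted sum with `boxSum`.
      shiftedSums≡ : ∀ w → shiftedSums w ≡ Σℚ H (λ h → Σℚ (box len) (λ j → w (β ⊕ σ (h +ᵥ j))))
      shiftedSums≡ w = begin
        Σℚ points (λ x → Σℚ hs (λ h → w (x ⊕ h)))
          ≡⟨ Σ-map (λ j → β ⊕ σ j) (box len) _ ⟩
        Σℚ (box len) (λ j → Σℚ hs (λ h → w (β ⊕ σ j ⊕ h)))
          ≡⟨ Σ-cong (box len) (λ j → Σ-map σ H (λ h → w (β ⊕ σ j ⊕ h))) ⟩
        Σℚ (box len) (λ j → Σℚ H (λ h → w (β ⊕ σ j ⊕ σ h)))
          ≡⟨ Σ-swap (box len) H (λ j h → w (β ⊕ σ j ⊕ σ h)) ⟩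
        Σℚ H (λ h → Σℚ (box len) (λ j → w (β ⊕ σ j ⊕ σ h)))
          ≡⟨ Σ-cong H (λ h → Σ-cong (box len) (λ j → cong w (regroup h j))) ⟩
        Σℚ H (λ h → Σℚ (box len) (λ j → w (β ⊕ σ (h +ᵥ j)))) ∎
        where
        open ≡-Reasoning
        regroup : ∀ h j → β ⊕ σ j ⊕ σ h ≡ β ⊕ σ (h +ᵥ j)
        regroup h j = trans (A.assoc β (σ j) (σ h))
          (cong (β ⊕_) (trans (A.comm (σ j) (σ h)) (sym (σ-+ h j))))

      shiftedSums-close : ∀ {M} w → 0ℚ ≤ M → (∀ x → ∣ w x ∣ ≤ M) →
        ι N * ∣ shiftedSums w - ι l * boxSum w ∣ ≤ ι l * (ι k * ((M + M) * ι b))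
      shiftedSums-close {M} w 0≤M ∣w∣≤M = begin
        ι N * ∣ shiftedSums w - ι l * boxSum w ∣
          ≡⟨ cong (λ z → ι N * ∣ z ∣) (trans
               (cong₂ _-_ (shiftedSums≡ w) (sym (Σ-const H (boxSum w))))
               (sym (Σ-minus H shifted (λ _ → boxSum w)))) ⟩
        ι N * ∣ Σℚ H (λ h → shifted h - boxSum w) ∣
          ≤⟨ *-monoˡ (ι N) (0≤ι N) (∣Σ∣≤Σ∣∣ H (λ h → shifted h - boxSum w)) ⟩
        ι N * Σℚ H (λ h → ∣ shifted h - boxSum w ∣)
          ≡⟨ Σ-*ˡ H (ι N) (λ h → ∣ shifted h - boxSum w ∣) ⟨
        Σℚ H (λ h → ι N * ∣ shifted h - boxSum w ∣)
          ≤⟨ Σ-mono-∈ H (λ {h} h∈ → box-shift N 0≤M len h (λ i → <shrink⇒*≤ N (∈-box⁻ h∈ i))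
               (λ j → w (β ⊕ σ j)) (λ j → ∣w∣≤M (β ⊕ σ j))) ⟩
        Σℚ H (λ _ → ι k * ((M + M) * ι b))
          ≡⟨ Σ-const H (ι k * ((M + M) * ι b)) ⟩
        ι l * (ι k * ((M + M) * ι b)) ∎
        where
        open ≤-Reasoning
        shifted : Vec ℕ k → ℚ
        shifted h = Σℚ (box len) (λ j → w (β ⊕ σ (h +ᵥ j)))

      module _ (K : ℕ) (1≤K : 1 ℕ.≤ K) (D : Subset order) (∣D∣≤K : Subset.∣ D ∣ ℕ.≤ K)
               (E²m≤b² : (N ℕ.^ (2 ℕ.+ k) ℕ.* N ℕ.^ (2 ℕ.+ k)) ℕ.* order ℕ.≤ b ℕ.* b)
               (u v : Carrier → ℚ)
               (norm≤ : ∀ x → u x * u x + v x * v x ≤ (ι K + ι K) * (ι K + ι K))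
               (correlation≤ : ∀ a → lookup D a ≡ false →
                 ι (N ℕ.^ (2 ℕ.+ k)) * correlation A u v a ≤ (ι K + ι K) * ι b) where

        private
          E = N ℕ.^ (2 ℕ.+ k)
          M = ι K + ι K
          0≤M = +-mono-≤ (0≤ι K) (0≤ι K)
          1≤N^k : 1 ℕ.≤ N ℕ.^ k
          1≤N^k = ℕ.>-nonZero⁻¹ _ {{ℕ.m^n≢0 N k}}

          F : (Carrier → ℚ) → Carrier → ℚ
          F w x = Σℚ hs (λ h → w (x ⊕ h))

          -- Here w is the real or the imaginary part. Cauchy-Schwarz is applied to this component
          -- alone, and its squares are then dominated by squared moduli, so that the energy of the
          -- complex function appears.
          boxSum-≤′ : ∀ w → (∀ x → w x * w x ≤ u x * u x + v x * v x) →
            (∀ x → F w x * F w x ≤ F u x * F u x + F v x * F v x) →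
            ι N * ∣ boxSum w ∣ ≤ (ι k * (M + M) + ι 3 * (ι K * ι K)) * ι b
          boxSum-≤′ w w²≤ F²≤ = *-cancelˡ (ι l)
            (<-≤-trans (positive⁻¹ 1ℚ) (subst (_≤ ι l) ι-1 (ι-mono 0<l))) (begin
              ι l * (ι N * ∣ boxSum w ∣)
                ≡⟨ solve 3 (λ l n p → l :* (n :* p) := n :* (l :* p)) refl (ι l) (ι N) ∣ boxSum w ∣ ⟩
              ι N * (ι l * ∣ boxSum w ∣)
                ≡⟨ cong (ι N *_) (trans (∣p*q∣≡∣p∣*∣q∣ (ι l) (boxSum w)) (cong (_* ∣ boxSum w ∣) (0≤p⇒∣p∣≡p (0≤ι l)))) ⟨
              ι N * ∣ ι l * boxSum w ∣
                ≤⟨ *-monoˡ (ι N) (0≤ι N) triangle ⟩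
              ι N * (∣ Y - ι l * boxSum w ∣ + ∣ Y ∣)
                ≡⟨ *-distribˡ-+ (ι N) _ _ ⟩
              ι N * ∣ Y - ι l * boxSum w ∣ + ι N * ∣ Y ∣
                ≤⟨ +-mono-≤ (shiftedSums-close w 0≤M ∣w∣≤M) NY≤ ⟩
              ι l * (ι k * ((M + M) * ι b)) + ι 3 * (ι K * ι K) * (ι b * ι l)
                ≡⟨ solve 5 (λ l k m b t → l :* (k :* (m :* b)) :+ t :* (b :* l) :=
                     l :* ((k :* m :+ t) :* b)) refl (ι l) (ι k) (M + M) (ι b) (ι 3 * (ι K * ι K)) ⟩
              ι l * ((ι k * (M + M) + ι 3 * (ι K * ι K)) * ι b) ∎)
            where
            open ≤-Reasoning
            open +-*-Solver
            Y = shiftedSums w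
            ∣w∣≤M : ∀ x → ∣ w x ∣ ≤ M
            ∣w∣≤M x = p*p≤q*q⇒∣p∣≤q 0≤M (≤-trans (w²≤ x) (norm≤ x))
            triangle : ∣ ι l * boxSum w ∣ ≤ ∣ Y - ι l * boxSum w ∣ + ∣ Y ∣
            triangle = begin
              ∣ ι l * boxSum w ∣
                ≡⟨ cong ∣_∣ (solve 2 (λ y p → p := :- (y :- p) :+ y) refl Y (ι l * boxSum w)) ⟩
              ∣ - (Y - ι l * boxSum w) + Y ∣
                ≤⟨ ∣p+q∣≤∣p∣+∣q∣ (- (Y - ι l * boxSum w)) Y ⟩
              ∣ - (Y - ι l * boxSum w) ∣ + ∣ Y ∣
                ≡⟨ cong (_+ ∣ Y ∣) (∣-p∣≡∣p∣ (Y - ι l * boxSum w)) ⟩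
              ∣ Y - ι l * boxSum w ∣ + ∣ Y ∣ ∎
            EY²≤ : ι E * (Y * Y) ≤
              ι b * (ι l * (ι l * (M * ι b) + ι E * (ι order * (M * M)) * ι Subset.∣ D ∣))
            EY²≤ = begin
              ι E * (Y * Y)
                ≤⟨ *-monoˡ (ι E) (0≤ι E) (cauchy-schwarz points (F w)) ⟩
              ι E * (ι (length points) * Σℚ points (λ x → F w x * F w x))
                ≡⟨ cong (λ z → ι E * (ι z * Σℚ points (λ x → F w x * F w x))) (length-map _ (box len)) ⟩
              ι E * (ι b * Σℚ points (λ x → F w x * F w x))
                ≡⟨ solve 3 (λ e b s → e :* (b :* s) := b :* (e :* s)) refl (ι E) (ι b) (Σℚ points (λ x → F w x * F w x)) ⟩
              ι b * (ι E * Σℚ points (λ x → F w x * F w x))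
                ≤⟨ *-monoˡ (ι b) (0≤ι b) (*-monoˡ (ι E) (0≤ι E) (≤-trans
                     -- The extension from B to A: the points are distinct and the summands are
                     -- squares.
                     (Σ-unique-≤ points-unique (λ x → F w x * F w x) (λ x → 0≤p*p (F w x)))
                     (Σ-mono (elements A) F²≤))) ⟩
              ι b * (ι E * energy A u v hs)
                ≤⟨ *-monoˡ (ι b) (0≤ι b) (energy-≤ A u v hs-unique D (0≤ι E) (0≤p*p M)
                     (0≤p*q 0≤M (0≤ι b)) correlation≤ norm≤) ⟩
              ι b * (ι (length hs) * (ι (length hs) * (M * ι b) + ι E * (ι order * (M * M)) * ι Subset.∣ D ∣))
                ≡⟨ cong (λ z → ι b * (ι z * (ι z * (M * ι b) + ι E * (ι order * (M * M)) * ι Subset.∣ D ∣)))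
                     (length-map σ H) ⟩
              ι b * (ι l * (ι l * (M * ι b) + ι E * (ι order * (M * M)) * ι Subset.∣ D ∣)) ∎
            NY≤ : ι N * ∣ Y ∣ ≤ ι 3 * (ι K * ι K) * (ι b * ι l)
            NY≤ = averaged-bound {ν = ι (N ℕ.^ k)} K 1≤K (0≤ι N)
              (subst (_≤ ι (N ℕ.^ k)) ι-1 (ι-mono 1≤N^k))
              (trans (ι-* N (N ℕ.* N ℕ.^ k)) (trans (cong (ι N *_) (ι-* N (N ℕ.^ k))) (sym (*-assoc (ι N) (ι N) (ι (N ℕ.^ k))))))
              (<-≤-trans (positive⁻¹ 1ℚ) (subst (_≤ ι E) ι-1 (ι-mono (ℕ.>-nonZero⁻¹ E {{ℕ.m^n≢0 N (2 ℕ.+ k)}}))))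
              (0≤ι order) (0≤ι b) (0≤ι l) (ι-mono ∣D∣≤K)
              (subst₂ _≤_ (trans (ι-* (E ℕ.* E) order) (cong (_* ι order) (ι-* E E))) (ι-* b b) (ι-mono E²m≤b²))
              (subst (ι b ≤_) (ι-* l (N ℕ.^ k)) (ι-mono (length-box-shrink N len)))
              (ι-mono (ℕ.^-monoʳ-≤ N (ℕ.m≤n+m k 2)))
              EY²≤

        boxSum-re-≤ : ι N * ∣ boxSum u ∣ ≤ (ι k * (M + M) + ι 3 * (ι K * ι K)) * ι b
        boxSum-re-≤ = boxSum-≤′ u (λ x → p≤p+q _ (0≤p*p (v x))) (λ x → p≤p+q _ (0≤p*p (F v x)))

        boxSum-im-≤ : ι N * ∣ boxSum v ∣ ≤ (ι k * (M + M) + ι 3 * (ι K * ι K)) * ι b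
        boxSum-im-≤ = boxSum-≤′ v
          (λ x → subst (v x * v x ≤_) (+-comm (v x * v x) (u x * u x)) (p≤p+q _ (0≤p*p (u x))))
          (λ x → subst (F v x * F v x ≤_) (+-comm (F v x * F v x) (F u x * F u x)) (p≤p+q _ (0≤p*p (F u x))))

-- Proper progressions as injective images of boxes.

module Progression where

  open Rationals
  open Sums
  open FinSums
  open Boxes
  open BoxSum
  open import Defs using (FiniteAbelianGroup; ProperGAP)
  open import Algebra.Bundles using (AbelianGroup)
  import Algebra.Properties.AbelianGroup as AbelianGroupProperties
  import Algebra.Properties.CommutativeMonoid.Sum as SumProperties
  import Algebra.Properties.Monoid.Mult as MultProperties
  open import Data.Bool.Base using (true; if_then_else_)
  open import Data.Fin.Base using (Fin)
  open import Data.Fin.Subset using (Subset; ∣_∣)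
  open import Data.Integer.Base as ℤ using (ℤ; +_; -[1+_])
  import Data.Integer.Properties as ℤ
  open import Data.List.Base using (map; length; allFin)
  open import Data.List.Membership.Propositional using (_∈_)
  open import Data.List.Membership.Propositional.Properties using (∈-map⁺; ∈-map⁻)
  open import Data.List.Properties using (length-map)
  open import Data.List.Relation.Unary.Unique.Propositional using (Unique)
  open import Data.Nat.Base as ℕ using (ℕ; zero; suc)
  import Data.Nat.Properties as ℕ
  open import Data.Product.Base using (_,_; proj₁; proj₂)
  open import Data.Rational.Base using (ℚ; 0ℚ)
  import Data.Rational.Properties as ℚ
  open import Data.Vec.Base using (Vec; lookup; tabulate)
  open import Data.Vec.Properties using (lookup∘tabulate; lookup-zipWith; []=⇒lookup; lookup⇒[]=)
  open import Data.Vec.Relation.Binary.Pointwise.Extensional using (ext; Pointwise-≡⇒≡)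
  open import Function.Bundles using (_⇔_; mk⇔; Equivalence)
  open import Relation.Binary.PropositionalEquality

  private module ℤ+ = AbelianGroupProperties ℤ.+-0-abelianGroup

  module _ (A : FiniteAbelianGroup) where

    open FiniteAbelianGroup A renaming (_+_ to infixl 6 _⊕_; -_ to infix 8 ⊖_)
    private
      module A where
        open AbelianGroup (FiniteAbelianGroup.abelianGroup A) public
        open AbelianGroupProperties (FiniteAbelianGroup.abelianGroup A) public
        open SumProperties (AbelianGroup.commutativeMonoid (FiniteAbelianGroup.abelianGroup A)) public
          using (∑-distrib-+; sum-cong-≗)
        open MultProperties (AbelianGroup.monoid (FiniteAbelianGroup.abelianGroup A)) public
          using (×-homo-+)

    ·-suc : ∀ z x → (z ℤ.+ + 1) · x ≡ z · x ⊕ x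
    ·-suc (+ n) x = trans (A.×-homo-+ x n 1) (cong (n ℕ· x ⊕_) (A.identityʳ x))
    ·-suc -[1+ zero ] x = sym (trans (cong (λ y → ⊖ y ⊕ x) (A.identityʳ x)) (A.inverseˡ x))
    ·-suc -[1+ suc n ] x = sym (begin
      ⊖ (x ⊕ suc n ℕ· x) ⊕ x           ≡⟨ cong (λ y → ⊖ y ⊕ x) (A.comm x (suc n ℕ· x)) ⟩
      ⊖ (suc n ℕ· x ⊕ x) ⊕ x           ≡⟨ cong (_⊕ x) (A.⁻¹-∙-comm (suc n ℕ· x) x) ⟨
      ⊖ (suc n ℕ· x) ⊕ ⊖ x ⊕ x         ≡⟨ A.assoc _ _ _ ⟩
      ⊖ (suc n ℕ· x) ⊕ (⊖ x ⊕ x)       ≡⟨ cong (⊖ (suc n ℕ· x) ⊕_) (A.inverseˡ x) ⟩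
      ⊖ (suc n ℕ· x) ⊕ 0#              ≡⟨ A.identityʳ _ ⟩
      ⊖ (suc n ℕ· x)                   ∎)
      where open ≡-Reasoning

    -- Coordinates are measured upwards from the lower end of each interval, so the second summand
    -- is a natural number and induction by single steps works; the change of sign is handled in
    -- `·-suc`.
    ·-+ : ∀ z n x → (z ℤ.+ + n) · x ≡ z · x ⊕ n ℕ· x
    ·-+ z zero    x = trans (cong (_· x) (ℤ.+-identityʳ z)) (sym (A.identityʳ (z · x)))
    ·-+ z (suc n) x = begin
      (z ℤ.+ + suc n) · x              ≡⟨ cong (_· x) (ℤ.+-assoc z (+ 1) (+ n)) ⟨
      (z ℤ.+ + 1 ℤ.+ + n) · x          ≡⟨ ·-+ (z ℤ.+ + 1) n x ⟩
      (z ℤ.+ + 1) · x ⊕ n ℕ· x         ≡⟨ cong (_⊕ n ℕ· x) (·-suc z x) ⟩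
      z · x ⊕ x ⊕ n ℕ· x               ≡⟨ A.assoc _ _ _ ⟩
      z · x ⊕ (x ⊕ n ℕ· x)             ∎
      where open ≡-Reasoning

    module _ {k : ℕ} {B : Subset order} (gap : ProperGAP A k B) where

      open ProperGAP gap

      offset : Vec ℕ k → Carrier
      offset j = sum (λ i → lookup j i ℕ· a i)

      offset-+ : ∀ g h → offset (g +ᵥ h) ≡ offset g ⊕ offset h
      offset-+ g h = trans
        (A.sum-cong-≗ λ i → trans (cong (_ℕ· a i) (lookup-zipWith ℕ._+_ i g h))
          (A.×-homo-+ (a i) (lookup g i) (lookup h i)))
        (A.∑-distrib-+ (λ i → lookup g i ℕ· a i) (λ i → lookup h i ℕ· a i))

      coordinates : Vec ℕ k → Fin k → ℤ
      coordinates j i = lo i ℤ.+ + lookup j i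

      -- Separating the base point `point lo` from an additive offset brings the progression into
      -- the form required by the averaging argument.
      point-coordinates : ∀ j → point (coordinates j) ≡ point lo ⊕ offset j
      point-coordinates j = trans
        (cong (a₀ ⊕_) (trans (A.sum-cong-≗ λ i → ·-+ (lo i) (lookup j i) (a i))
          (A.∑-distrib-+ (λ i → lo i · a i) (λ i → lookup j i ℕ· a i))))
        (sym (A.assoc a₀ _ _))

      coordinates-InBox : ∀ {j} → j ∈ box len → InBox (coordinates j)
      coordinates-InBox j∈ i = ℤ.i≤i+j (lo i) (+ _) , ℤ.+-monoʳ-< (lo i) (ℤ.+<+ (∈-box⁻ j∈ i))

      offset-injective : ∀ {g h} → g ∈ box len → h ∈ box len →
        point lo ⊕ offset g ≡ point lo ⊕ offset h → g ≡ h
      offset-injective {g} {h} g∈ h∈ eq = Pointwise-≡⇒≡ (ext λ i → ℤ.+-injective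
        (ℤ+.∙-cancelˡ (lo i) (+ lookup g i) (+ lookup h i)
          (proper (coordinates g) (coordinates h) (coordinates-InBox g∈) (coordinates-InBox h∈)
            (trans (point-coordinates g) (trans eq (sym (point-coordinates h)))) i)))

      private
        points = map (λ j → point lo ⊕ offset j) (box len)

        points-unique : Unique points
        points-unique = unique-map offset-injective (box-unique len)

        B⇔points : ∀ x → lookup B x ≡ true ⇔ x ∈ points
        B⇔points x = mk⇔ to from
          where
          from : x ∈ points → lookup B x ≡ true
          from x∈ with ∈-map⁻ _ x∈
          ... | j , j∈ , refl = []=⇒lookup (Equivalence.from (elements x)
            (coordinates j , coordinates-InBox j∈ , sym (point-coordinates j)))
          to : lookup B x ≡ true → x ∈ points
          to x∈B with Equivalence.to (elements x) (lookup⇒[]= x B x∈B)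
          ... | n , n∈ , refl = subst (_∈ points)
            (trans (sym (point-coordinates j)) (cong (a₀ ⊕_) (A.sum-cong-≗ λ i → cong (_· a i) (n≡ i))))
            (∈-map⁺ (λ j → point lo ⊕ offset j) (∈-box⁺ {j = j} j<len))
            where
            j : Vec ℕ k
            -- The absolute value is the plain difference here, because n i is at least lo i.
            j = tabulate (λ i → ℤ.∣ n i ℤ.- lo i ∣)
            n≡ : ∀ i → coordinates j i ≡ n i
            n≡ i = begin
              lo i ℤ.+ + lookup j i             ≡⟨ cong (λ m → lo i ℤ.+ + m) (lookup∘tabulate _ i) ⟩
              lo i ℤ.+ + ℤ.∣ n i ℤ.- lo i ∣     ≡⟨ cong (λ m → lo i ℤ.+ m) (ℤ.0≤i⇒+∣i∣≡i (ℤ.i≤j⇒0≤j-i (proj₁ (n∈ i)))) ⟩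
              lo i ℤ.+ (n i ℤ.- lo i)           ≡⟨ ℤ.+-comm (lo i) _ ⟩
              n i ℤ.- lo i ℤ.+ lo i             ≡⟨ ℤ.+-assoc (n i) (ℤ.- lo i) (lo i) ⟩
              n i ℤ.+ (ℤ.- lo i ℤ.+ lo i)       ≡⟨ cong (λ m → n i ℤ.+ m) (ℤ.+-inverseˡ (lo i)) ⟩
              n i ℤ.+ + 0                       ≡⟨ ℤ.+-identityʳ (n i) ⟩
              n i                               ∎
              where open ≡-Reasoning
            j<len : ∀ i → lookup j i ℕ.< len i
            j<len i = ℕ.≰⇒> λ len≤j → ℤ.<⇒≱ (proj₂ (n∈ i))
              (subst (λ m → lo i ℤ.+ + len i ℤ.≤ m) (n≡ i) (ℤ.+-monoʳ-≤ (lo i) (ℤ.+≤+ len≤j)))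

      Σ-progression : ∀ w → Σℚ (allFin order) (λ x → if lookup B x then w x else 0ℚ) ≡
        Σℚ (box len) (λ j → w (point lo ⊕ offset j))
      Σ-progression w = trans (Σ-subset points-unique B B⇔points w) (Σ-map _ (box len) w)

      -- Cardinality is the sum of the constant 1, so the comparison of sums already contains the
      -- count; it is read back in ℕ by cancelling `ι`.
      ∣progression∣ : ∣ B ∣ ≡ length (box len)
      ∣progression∣ = trans
        (ℕ.≤-antisym (ι-cancel-≤ (ℚ.≤-reflexive eq)) (ι-cancel-≤ (ℚ.≤-reflexive (sym eq))))
        (length-map _ (box len))
        where
        eq : ι ∣ B ∣ ≡ ι (length points)
        eq = ∣subset∣≡length points-unique B B⇔points

-- Arithmetic, powers and roots of Cauchy reals.

module Reals where

  open import Defs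
  open Rationals
  open import Algebra.Bundles using (CommutativeSemiring)
  import Algebra.Definitions.RawSemiring as RawSemiringDefs
  import Algebra.Properties.CommutativeSemiring.Exp as ExpProperties
  import Algebra.Properties.Semiring.Exp as SemiringExpProperties
  open import Data.Nat.Base as ℕ using (ℕ; zero; suc)
  import Data.Nat.Properties as ℕ
  open import Data.Integer.Base as ℤ using ()
  open import Data.Product.Base using (∃; _×_; _,_)
  open import Data.Rational.Base using (0ℚ; ½; _+_; _*_; _-_; -_; ∣_∣; _≤_; _<_; _/_; _⊔_; 1/_; positive; Positive; NonZero)
  open import Data.Rational.Properties
  open import Data.Rational.Solver using (module +-*-Solver)
  open import Level using (0ℓ)
  open import Relation.Binary.Bundles using (Setoid)
  open import Relation.Binary.PropositionalEquality
  import Relation.Binary.Reasoning.Setoid as SetoidReasoning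

  open RawSemiringDefs +-*-rawSemiring using () renaming (_^_ to _^ℚ_)

  Eventually : (ℕ → Set) → Set
  Eventually P = ∃ λ N → ∀ n → N ℕ.≤ n → P n

  eventually-map : ∀ {P Q : ℕ → Set} → (∀ {n} → P n → Q n) → Eventually P → Eventually Q
  eventually-map f (N , h) = N , λ n N≤n → f (h n N≤n)

  eventually-map₂ : ∀ {P Q R : ℕ → Set} → (∀ {n} → P n → Q n → R n) →
    Eventually P → Eventually Q → Eventually R
  eventually-map₂ f (M , g) (N , h) = M ℕ.⊔ N , λ n l →
    f (g n (ℕ.m⊔n≤o⇒m≤o M N l)) (h n (ℕ.m⊔n≤o⇒n≤o M N l))

  eventually-const : ∀ {P : Set} → Eventually (λ _ → P) → P
  eventually-const (N , h) = h N ℕ.≤-refl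

  always : ∀ {P : ℕ → Set} → (∀ n → P n) → Eventually P
  always h = 0 , λ n _ → h n

  pointwise⇒≃ : ∀ {x y} → (∀ n → seq x n ≡ seq y n) → x ≃ℝ y
  pointwise⇒≃ {x} {y} h = mk≃ λ ε 0<ε → always λ n →
    ≤-trans (≤-reflexive (cong ∣_∣ (trans (cong (_- seq y n) (h n)) (+-inverseʳ (seq y n))))) (<⇒≤ 0<ε)

  pointwise⇒≤ : ∀ {x y} → Eventually (λ n → seq x n ≤ seq y n) → x ≤ℝ y
  pointwise⇒≤ h = mk≤ λ ε 0<ε → eventually-map (λ {n} p → ≤-trans p (p≤p+q _ (<⇒≤ 0<ε))) h

  ≃⇒≤ : ∀ {x y} → x ≃ℝ y → x ≤ℝ y
  ≃⇒≤ {x} {y} (mk≃ h) = mk≤ λ ε 0<ε → eventually-map (∣p-q∣≤ε⇒p≤q+ε _ _) (h ε 0<ε)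

  ≤-antisymℝ : ∀ {x y} → x ≤ℝ y → y ≤ℝ x → x ≃ℝ y
  ≤-antisymℝ (mk≤ g) (mk≤ h) = mk≃ λ ε 0<ε →
    eventually-map₂ (p≤q+ε⇒∣p-q∣≤ε _ _) (g ε 0<ε) (h ε 0<ε)

  ≃-reflℝ : ∀ {x} → x ≃ℝ x
  ≃-reflℝ = pointwise⇒≃ λ _ → refl

  ≃-symℝ : ∀ {x y} → x ≃ℝ y → y ≃ℝ x
  ≃-symℝ {x} {y} (mk≃ h) = mk≃ λ ε 0<ε → eventually-map
    (λ {n} p → subst (_≤ ε) (trans (sym (∣-p∣≡∣p∣ (seq x n - seq y n)))
      (cong ∣_∣ (solve 2 (λ p q → :- (p :- q) := q :- p) refl (seq x n) (seq y n)))) p) (h ε 0<ε)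
    where open +-*-Solver

  ≤-transℝ : ∀ {x y z} → x ≤ℝ y → y ≤ℝ z → x ≤ℝ z
  ≤-transℝ {x} {y} {z} (mk≤ g) (mk≤ h) = mk≤ λ ε 0<ε → eventually-map₂
    (λ {n} p q → begin
      seq x n                                ≤⟨ p ⟩
      seq y n + ½ * ε                        ≤⟨ +-monoˡ-≤ (½ * ε) q ⟩
      seq z n + ½ * ε + ½ * ε                ≡⟨ +-assoc (seq z n) (½ * ε) (½ * ε) ⟩
      seq z n + (½ * ε + ½ * ε)              ≡⟨ cong (seq z n +_) (½*ε+½*ε≡ε ε) ⟩
      seq z n + ε                            ∎)
    (g (½ * ε) (0<½*ε 0<ε)) (h (½ * ε) (0<½*ε 0<ε))
    where open ≤-Reasoning

  ≃-transℝ : ∀ {x y z} → x ≃ℝ y → y ≃ℝ z → x ≃ℝ z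
  ≃-transℝ p q = ≤-antisymℝ (≤-transℝ (≃⇒≤ p) (≃⇒≤ q)) (≤-transℝ (≃⇒≤ (≃-symℝ q)) (≃⇒≤ (≃-symℝ p)))

  +-congℝ : ∀ {x x′ y y′} → x ≃ℝ x′ → y ≃ℝ y′ → x +ℝ y ≃ℝ x′ +ℝ y′
  +-congℝ {x} {x′} {y} {y′} (mk≃ g) (mk≃ h) = mk≃ λ ε 0<ε → eventually-map₂
    (λ {n} p q → begin
      ∣ (seq x n + seq y n) - (seq x′ n + seq y′ n) ∣
        ≡⟨ cong ∣_∣ (solve 4 (λ a b c d → (a :+ b) :- (c :+ d) := (a :- c) :+ (b :- d)) refl
             (seq x n) (seq y n) (seq x′ n) (seq y′ n)) ⟩
      ∣ (seq x n - seq x′ n) + (seq y n - seq y′ n) ∣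
        ≤⟨ ∣p+q∣≤∣p∣+∣q∣ (seq x n - seq x′ n) (seq y n - seq y′ n) ⟩
      ∣ seq x n - seq x′ n ∣ + ∣ seq y n - seq y′ n ∣
        ≤⟨ +-mono-≤ p q ⟩
      ½ * ε + ½ * ε
        ≡⟨ ½*ε+½*ε≡ε ε ⟩
      ε ∎)
    (g (½ * ε) (0<½*ε 0<ε)) (h (½ * ε) (0<½*ε 0<ε))
    where
    open ≤-Reasoning
    open +-*-Solver

  opaque
    scaled : ∀ {K ε} → 0ℚ < K → 0ℚ < ε → ∃ λ δ → 0ℚ < δ × K * δ ≡ ε
    scaled {K} {ε} 0<K 0<ε =
      let instance
            K⁺ : Positive K
            K⁺ = positive 0<K
            K≢0 : NonZero K
            K≢0 = pos⇒nonZero K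
      in 1/ K * ε , 0<p*q (positive⁻¹ (1/ K) {{1/pos⇒pos K}}) 0<ε ,
         trans (sym (*-assoc K (1/ K) ε)) (trans (cong (_* ε) (*-inverseʳ K)) (*-identityˡ ε))

  opaque
    seq-bounded : ∀ x → ∃ λ K → 0ℚ < K × Eventually λ n → ∣ seq x n ∣ ≤ K
    seq-bounded x = cauchy⇒bounded (seq x) (cauchy x)

  *-congʳℝ : ∀ {x x′} y → x ≃ℝ x′ → x *ℝ y ≃ℝ x′ *ℝ y
  *-congʳℝ {x} {x′} y (mk≃ h) = mk≃ λ ε 0<ε →
    let K , 0<K , y-bounded = seq-bounded y
        δ , 0<δ , Kδ≡ε = scaled 0<K 0<ε
    in eventually-map₂ (λ {n} p q → begin
      ∣ seq x n * seq y n - seq x′ n * seq y n ∣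
        ≡⟨ cong ∣_∣ (solve 3 (λ a b c → a :* c :- b :* c := (a :- b) :* c) refl (seq x n) (seq x′ n) (seq y n)) ⟩
      ∣ (seq x n - seq x′ n) * seq y n ∣
        ≡⟨ ∣p*q∣≡∣p∣*∣q∣ (seq x n - seq x′ n) (seq y n) ⟩
      ∣ seq x n - seq x′ n ∣ * ∣ seq y n ∣
        ≤⟨ *-mono-≤-nonNeg (0≤∣p∣ (seq y n)) (<⇒≤ 0<δ) q p ⟩
      δ * K
        ≡⟨ trans (*-comm δ K) Kδ≡ε ⟩
      ε ∎) y-bounded (h δ 0<δ)
    where
    open ≤-Reasoning
    open +-*-Solver

  *-commℝ : ∀ x y → x *ℝ y ≃ℝ y *ℝ x
  *-commℝ x y = pointwise⇒≃ λ n → *-comm (seq x n) (seq y n)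

  *-congˡℝ : ∀ {y y′} x → y ≃ℝ y′ → x *ℝ y ≃ℝ x *ℝ y′
  *-congˡℝ {y} {y′} x p = ≃-transℝ (*-commℝ x y) (≃-transℝ (*-congʳℝ x p) (*-commℝ y′ x))

  *-congℝ : ∀ {x x′ y y′} → x ≃ℝ x′ → y ≃ℝ y′ → x *ℝ y ≃ℝ x′ *ℝ y′
  *-congℝ {x} {x′} {y} {y′} p q = ≃-transℝ (*-congʳℝ y p) (*-congˡℝ x′ q)

  ℝ-commutativeSemiring : CommutativeSemiring 0ℓ 0ℓ
  ℝ-commutativeSemiring = record
    { Carrier = ℝ ; _≈_ = _≃ℝ_ ; _+_ = _+ℝ_ ; _*_ = _*ℝ_ ; 0# = 0ℝ ; 1# = 1ℝ
    ; isCommutativeSemiring = record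
      { isSemiring = record
        { isSemiringWithoutAnnihilatingZero = record
          { +-isCommutativeMonoid = record
            { isMonoid = record
              { isSemigroup = record
                { isMagma = record
                  { isEquivalence = record { refl = ≃-reflℝ ; sym = ≃-symℝ ; trans = ≃-transℝ }
                  ; ∙-cong = +-congℝ
                  }
                ; assoc = λ x y z → pointwise⇒≃ λ n → +-assoc (seq x n) (seq y n) (seq z n)
                }
              ; identity = (λ x → pointwise⇒≃ λ n → +-identityˡ (seq x n))
                         , (λ x → pointwise⇒≃ λ n → +-identityʳ (seq x n))
              }
            ; comm = λ x y → pointwise⇒≃ λ n → +-comm (seq x n) (seq y n)
            }
          ; *-cong = *-congℝ
          ; *-assoc = λ x y z → pointwise⇒≃ λ n → *-assoc (seq x n) (seq y n) (seq z n)
          ; *-identity = (λ x → pointwise⇒≃ λ n → *-identityˡ (seq x n))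
                       , (λ x → pointwise⇒≃ λ n → *-identityʳ (seq x n))
          ; distrib = (λ x y z → pointwise⇒≃ λ n → *-distribˡ-+ (seq x n) (seq y n) (seq z n))
                    , (λ x y z → pointwise⇒≃ λ n → *-distribʳ-+ (seq x n) (seq y n) (seq z n))
          }
        ; zero = (λ x → pointwise⇒≃ λ n → *-zeroˡ (seq x n))
               , (λ x → pointwise⇒≃ λ n → *-zeroʳ (seq x n))
        }
      ; *-comm = *-commℝ
      }
    }

  open CommutativeSemiring ℝ-commutativeSemiring public using ()
    renaming (setoid to ℝ-setoid; *-assoc to *-assocℝ; *-identityʳ to *-identityʳℝ; *-identityˡ to *-identityˡℝ)
  open ExpProperties ℝ-commutativeSemiring public using () renaming (^-distrib-* to ^-distrib-*ℝ)
  open SemiringExpProperties (CommutativeSemiring.semiring ℝ-commutativeSemiring) public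
    using () renaming (^-congˡ to ^-congˡℝ; ^-assocʳ to ^-assocʳℝ; ^-congʳ to ^-congʳℝ)

  seq-^ : ∀ x p n → seq (x ^ℝ p) n ≡ seq x n ^ℚ p
  seq-^ x zero    n = refl
  seq-^ x (suc p) n = cong (seq x n *_) (seq-^ x p n)

  *-monoˡℝ : ∀ {x y q} → 0ℚ < q → x ≤ℝ y → fromℚ q *ℝ x ≤ℝ fromℚ q *ℝ y
  *-monoˡℝ {x} {y} {q} 0<q (mk≤ h) = mk≤ λ ε 0<ε → let δ , 0<δ , qδ≡ε = scaled 0<q 0<ε in
    eventually-map (λ {n} p → begin
      q * seq x n            ≤⟨ *-monoˡ q (<⇒≤ 0<q) p ⟩
      q * (seq y n + δ)      ≡⟨ *-distribˡ-+ q (seq y n) δ ⟩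
      q * seq y n + q * δ    ≡⟨ cong (q * seq y n +_) qδ≡ε ⟩
      q * seq y n + ε        ∎) (h δ 0<δ)
    where open ≤-Reasoning

  -- A condition on every approximation, stronger than 0 ≤ x in ℝ and not invariant under `_≃ℝ_`.
  -- Naturals, roots and their products satisfy it by construction, and it permits monotonicity of
  -- powers at each index.
  NonNegative : ℝ → Set
  NonNegative x = ∀ n → 0ℚ ≤ seq x n

  ^-cancel-< : ∀ {p q} n → 0ℚ ≤ q → q < p → q ^ℚ suc n < p ^ℚ suc n
  ^-cancel-< {p} {q} n 0≤q q<p = begin-strict
    q * q ^ℚ n   ≤⟨ *-monoˡ q 0≤q (^-mono-≤ n 0≤q (<⇒≤ q<p)) ⟩
    q * p ^ℚ n   <⟨ *-monoˡ-<-pos (p ^ℚ n) {{positive (0<p^n n (≤-<-trans 0≤q q<p))}} q<p ⟩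
    p * p ^ℚ n   ∎
    where open ≤-Reasoning

  -- Powers are superadditive: yᵖ + εᵖ ≤ (y + ε)ᵖ. Hence the tolerance εᵖ between the powers yields
  -- the tolerance ε between the bases.
  ^-cancel-≤ℝ : ∀ {x y} p .{{_ : ℕ.NonZero p}} → NonNegative y → x ^ℝ p ≤ℝ y ^ℝ p → x ≤ℝ y
  ^-cancel-≤ℝ {x} {y} p@(suc p-1) 0≤y (mk≤ h) = mk≤ λ ε 0<ε → eventually-map
    (λ {n} xᵖ≤yᵖ+εᵖ → ≮⇒≥ λ y+ε<x → <-irrefl refl (begin-strict
      (seq y n + ε) ^ℚ p            <⟨ ^-cancel-< p-1 (+-mono-≤ (0≤y n) (<⇒≤ 0<ε)) y+ε<x ⟩
      seq x n ^ℚ p                  ≡⟨ seq-^ x p n ⟨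
      seq (x ^ℝ p) n                ≤⟨ xᵖ≤yᵖ+εᵖ ⟩
      seq (y ^ℝ p) n + ε ^ℚ p       ≡⟨ cong (_+ ε ^ℚ p) (seq-^ y p n) ⟩
      seq y n ^ℚ p + ε ^ℚ p         ≤⟨ ^-superadditive p (0≤y n) (<⇒≤ 0<ε) ⟩
      (seq y n + ε) ^ℚ p            ∎)) (h (ε ^ℚ p) (0<p^n p 0<ε))
    where open ≤-Reasoning

  ^-cancel-≃ℝ : ∀ {x y} p .{{_ : ℕ.NonZero p}} → NonNegative x → NonNegative y → x ^ℝ p ≃ℝ y ^ℝ p → x ≃ℝ y
  ^-cancel-≃ℝ p 0≤x 0≤y xᵖ≃yᵖ =
    ≤-antisymℝ (^-cancel-≤ℝ p 0≤y (≃⇒≤ xᵖ≃yᵖ)) (^-cancel-≤ℝ p 0≤x (≃⇒≤ (≃-symℝ xᵖ≃yᵖ)))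

  0≤root : ∀ p x .{{_ : ℕ.NonZero p}} → NonNegative (root p x)
  0≤root p x n = 0≤approxRoot p n (seq x n)

  0≤* : ∀ {x y} → NonNegative x → NonNegative y → NonNegative (x *ℝ y)
  0≤* 0≤x 0≤y n = 0≤p*q (0≤x n) (0≤y n)

  0≤^ : ∀ {x} p → NonNegative x → NonNegative (x ^ℝ p)
  0≤^ {x} p 0≤x n = subst (0ℚ ≤_) (sym (seq-^ x p n)) (0≤p^n p (0≤x n))

  -- A representative of zero whose j-th term 1/(j + 1) is exactly the error allowed to `approxRoot`
  -- at index j.
  reciprocals : ℝ
  reciprocals = mkℝ (λ j → ℤ.+ 1 / suc j) (one-sided⇒cauchy _ λ ε 0<ε → _ , λ i j N≤i _ →
    ≤-trans (archimedean ε 0<ε i N≤i)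
      (subst (_≤ ℤ.+ 1 / suc j + ε) (+-identityˡ ε) (+-monoˡ-≤ ε (0≤n/d 1 (suc j)))))

  reciprocals≃0 : reciprocals ≃ℝ 0ℝ
  reciprocals≃0 = mk≃ λ ε 0<ε → _ , λ n N≤n → subst (_≤ ε)
    (sym (trans (cong ∣_∣ (+-identityʳ (ℤ.+ 1 / suc n))) (0≤p⇒∣p∣≡p (0≤n/d 1 (suc n)))))
    (archimedean ε 0<ε n N≤n)

  -- Approximate roots lie below the true root, which gives one inequality at each index. For the
  -- other, root plus `reciprocals` lies above it, and `reciprocals` vanishes in ℝ.
  root-^ : ∀ p x .{{_ : ℕ.NonZero p}} → NonNegative x → root p x ^ℝ p ≃ℝ x
  root-^ p x 0≤x = ≤-antisymℝ
    (pointwise⇒≤ (always λ n → begin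
      seq (root p x ^ℝ p) n       ≡⟨ seq-^ (root p x) p n ⟩
      seq (root p x) n ^ℚ p       ≤⟨ approxRoot-lower p n (seq x n) ⟩
      seq x n ⊔ 0ℚ                ≡⟨ p≥q⇒p⊔q≡p (0≤x n) ⟩
      seq x n                     ∎))
    (≤-transℝ {y = (root p x +ℝ reciprocals) ^ℝ p}
      (pointwise⇒≤ (always λ n → begin
        seq x n                                       ≡⟨ p≥q⇒p⊔q≡p (0≤x n) ⟨
        seq x n ⊔ 0ℚ                                  ≤⟨ <⇒≤ (approxRoot-upper p n (seq x n)) ⟩
        (seq (root p x) n + ℤ.+ 1 / suc n) ^ℚ p         ≡⟨ seq-^ (root p x +ℝ reciprocals) p n ⟨
        seq ((root p x +ℝ reciprocals) ^ℝ p) n        ∎))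
      (≃⇒≤ (^-congˡℝ p (≃-transℝ (+-congℝ ≃-reflℝ reciprocals≃0)
        (pointwise⇒≃ λ n → +-identityʳ (seq (root p x) n))))))
    where open ≤-Reasoning

  opaque
    -- Half of ε absorbs the tolerance in the real inequality, the other half the error of the
    -- approximate root. This is how hypotheses with a root become rational inequalities at large
    -- indices.
    √≤⇒≤² : ∀ {x y} → √ x ≤ℝ y → ∀ {ε} → 0ℚ < ε →
      Eventually λ n → seq x n ≤ (seq y n + ε) * (seq y n + ε)
    √≤⇒≤² {x} {y} (mk≤ h) {ε} 0<ε = eventually-map₂ (λ {n} √x≤y 1/n≤ → begin
        seq x n                                      ≤⟨ p≤p⊔q (seq x n) 0ℚ ⟩
        seq x n ⊔ 0ℚ                                 ≤⟨ <⇒≤ (approxRoot-upper 2 n (seq x n)) ⟩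
        (seq (√ x) n + ℤ.+ 1 / suc n) ^ℚ 2             ≤⟨ ^-mono-≤ 2 (+-mono-≤ (0≤root 2 x n) (0≤n/d 1 (suc n))) (begin
          seq (√ x) n + ℤ.+ 1 / suc n                    ≤⟨ +-mono-≤ √x≤y 1/n≤ ⟩
          seq y n + ½ * ε + ½ * ε                      ≡⟨ +-assoc (seq y n) (½ * ε) (½ * ε) ⟩
          seq y n + (½ * ε + ½ * ε)                    ≡⟨ cong (seq y n +_) (½*ε+½*ε≡ε ε) ⟩
          seq y n + ε                                  ∎) ⟩
        (seq y n + ε) ^ℚ 2                           ≡⟨ cong ((seq y n + ε) *_) (*-identityʳ (seq y n + ε)) ⟩
        (seq y n + ε) * (seq y n + ε)                ∎)
      (h (½ * ε) (0<½*ε 0<ε)) (_ , archimedean (½ * ε) (0<½*ε 0<ε))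
      where open ≤-Reasoning

-- The two forms of the bound and the passage from N to roots.

module RootBounds where

  open import Defs
  open Rationals
  open Reals
  open import Data.Integer.Base as ℤ using ()
  import Data.Integer.Properties as ℤ
  open import Data.Nat.Base as ℕ using (ℕ; zero; suc; NonZero)
  import Data.Nat.Properties as ℕ
  open import Data.Rational.Base using (0ℚ; 1ℚ; _+_; _*_; _≤_; _<_; _/_)
  open import Data.Rational.Properties hiding (module ≤-Reasoning)
  open import Data.Rational.Solver using (module +-*-Solver)
  open import Data.Rational.Unnormalised.Base as ℚᵘ using (mkℚᵘ; *≡*)
  import Data.Rational.Unnormalised.Properties as ℚᵘ
  open import Relation.Binary.PropositionalEquality
  import Relation.Binary.Reasoning.Setoid as SetoidReasoning

  opaque
    n*1/n≡1 : ∀ n .{{_ : NonZero n}} → ι n * (ℤ.+ 1 / n) ≡ 1ℚ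
    n*1/n≡1 (suc d) = trans (cong (_* (ℤ.+ 1 / suc d)) (ι-/ (suc d))) (toℚᵘ-injective (begin
      toℚᵘ ((ℤ.+ suc d / 1) * (ℤ.+ 1 / suc d))           ≈⟨ toℚᵘ-homo-* (ℤ.+ suc d / 1) (ℤ.+ 1 / suc d) ⟩
      toℚᵘ (ℤ.+ suc d / 1) ℚᵘ.* toℚᵘ (ℤ.+ 1 / suc d)     ≈⟨ ℚᵘ.*-cong (toℚᵘ-/ (ℤ.+ suc d) 0) (toℚᵘ-/ (ℤ.+ 1) d) ⟩
      mkℚᵘ (ℤ.+ suc d) 0 ℚᵘ.* mkℚᵘ (ℤ.+ 1) d             ≈⟨ *≡* (trans (trans (ℤ.*-identityʳ _) (ℤ.*-identityʳ _))
                                                              (sym (trans (ℤ.*-identityˡ _) (cong ℤ.+_ (ℕ.*-identityˡ (suc d)))))) ⟩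
      toℚᵘ 1ℚ                                            ∎))
      where
      open ℚᵘ.≃-Reasoning
      open import Data.Rational.Base using (toℚᵘ)

  0<1/n : ∀ n .{{_ : NonZero n}} → 0ℚ < ℤ.+ 1 / n
  0<1/n n = positive⁻¹ (ℤ.+ 1 / n) {{normalize-pos 1 n}}

  0<ι : ∀ n .{{_ : NonZero n}} → 0ℚ < ι n
  0<ι n = <-≤-trans (positive⁻¹ 1ℚ) (subst (_≤ ι n) ι-1 (ι-mono (ℕ.>-nonZero⁻¹ n)))

  fromℕ-ι : ∀ n i → seq (fromℕ n) i ≡ ι n
  fromℕ-ι n i = sym (ι-/ n)

  0≤fromℕ : ∀ n → NonNegative (fromℕ n)
  0≤fromℕ n i = 0≤n/d n 1

  fromℕ-* : ∀ m n → fromℕ (m ℕ.* n) ≃ℝ fromℕ m *ℝ fromℕ n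
  fromℕ-* m n = pointwise⇒≃ λ i → trans (sym (ι-/ (m ℕ.* n))) (trans (ι-* m n) (cong₂ _*_ (ι-/ m) (ι-/ n)))

  fromℕ-mono : ∀ {m n} → m ℕ.≤ n → fromℕ m ≤ℝ fromℕ n
  fromℕ-mono {m} {n} m≤n = pointwise⇒≤ (always λ i → subst₂ _≤_ (ι-/ m) (ι-/ n) (ι-mono m≤n))

  fromℕ-^ : ∀ n p → fromℕ (n ℕ.^ p) ≃ℝ fromℕ n ^ℝ p
  fromℕ-^ n zero    = ≃-reflℝ
  fromℕ-^ n (suc p) = ≃-transℝ (fromℕ-* n (n ℕ.^ p)) (*-congˡℝ (fromℕ n) (fromℕ-^ n p))

  1^n≃1 : ∀ n → 1ℝ ^ℝ n ≃ℝ 1ℝ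
  1^n≃1 zero    = ≃-reflℝ
  1^n≃1 (suc n) = ≃-transℝ (*-identityˡℝ (1ℝ ^ℝ n)) (1^n≃1 n)

  ^2≃* : ∀ x → x ^ℝ 2 ≃ℝ x *ℝ x
  ^2≃* x = *-congˡℝ x (*-identityʳℝ x)

  module _ (k b m : ℕ) .{{_ : NonZero b}} where

    private
      p = 2 ℕ.+ k
      α = root p (fromℕ b)
      β = root (2 ℕ.* p) (fromℕ m)
      s = √ fromℕ m
      r = fromℚ (ℤ.+ 1 / b)
      T = root p (s /ℝ b)
      0≤s = 0≤root 2 (fromℕ m)

      b*r≃1 : fromℕ b *ℝ r ≃ℝ 1ℝ
      b*r≃1 = pointwise⇒≃ λ i → trans (cong (_* (ℤ.+ 1 / b)) (fromℕ-ι b i)) (n*1/n≡1 b)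

      0≤s/b : NonNegative (s /ℝ b)
      0≤s/b = 0≤* {s} {r} 0≤s (λ _ → 0≤n/d 1 b)

      open SetoidReasoning ℝ-setoid

      s²≃m : s ^ℝ 2 ≃ℝ fromℕ m
      s²≃m = root-^ 2 (fromℕ m) (0≤fromℕ m)

      -- Both sides are non-negative and have square m.
      β^p≃s : β ^ℝ p ≃ℝ s
      β^p≃s = ^-cancel-≃ℝ 2 (0≤^ {β} p (0≤root (2 ℕ.* p) (fromℕ m))) 0≤s (begin
        (β ^ℝ p) ^ℝ 2       ≈⟨ ^-assocʳℝ β p 2 ⟩
        β ^ℝ (p ℕ.* 2)      ≈⟨ ^-congʳℝ β (ℕ.*-comm p 2) ⟩
        β ^ℝ (2 ℕ.* p)      ≈⟨ root-^ (2 ℕ.* p) (fromℕ m) (0≤fromℕ m) ⟩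
        fromℕ m             ≈⟨ s²≃m ⟨
        s ^ℝ 2              ∎)

      -- Non-negative p-th roots are unique, and both sides have p-th power √m.
      αT≃β : α *ℝ T ≃ℝ β
      αT≃β = ^-cancel-≃ℝ p (0≤* {α} {T} (0≤root p (fromℕ b)) (0≤root p (s /ℝ b))) (0≤root (2 ℕ.* p) (fromℕ m)) (begin
        (α *ℝ T) ^ℝ p                ≈⟨ ^-distrib-*ℝ α T p ⟩
        α ^ℝ p *ℝ T ^ℝ p             ≈⟨ *-congℝ (root-^ p (fromℕ b) (0≤fromℕ b)) (root-^ p (s /ℝ b) 0≤s/b) ⟩
        fromℕ b *ℝ (s *ℝ r)          ≈⟨ *-congˡℝ (fromℕ b) (*-commℝ s r) ⟩
        fromℕ b *ℝ (r *ℝ s)          ≈⟨ *-assocℝ (fromℕ b) r s ⟨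
        fromℕ b *ℝ r *ℝ s            ≈⟨ *-congʳℝ s b*r≃1 ⟩
        1ℝ *ℝ s                      ≈⟨ *-identityˡℝ s ⟩
        s                            ≈⟨ β^p≃s ⟨
        β ^ℝ p                       ∎)

    -- With p = k + 2, α = b^(1/p), β = m^(1/(2p)) and T = (√m/b)^(1/p), the identity β = αT gives
    -- α^(k+1) β = α^p T = bT.
    bounds-agree : ∀ C →
      C *ℝ fromℕ b ^[ 1 ℕ.+ k / 2 ℕ.+ k ] *ℝ fromℕ m ^[ 1 / 2 ℕ.* (2 ℕ.+ k) ] ≃ℝ
      C *ℝ fromℕ b *ℝ (√ fromℕ m /ℝ b) ^[ 1 / 2 ℕ.+ k ]
    bounds-agree C = begin
      C *ℝ α^ *ℝ (β *ℝ 1ℝ)        ≈⟨ *-congˡℝ (C *ℝ α^) (*-identityʳℝ β) ⟩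
      C *ℝ α^ *ℝ β                ≈⟨ *-congˡℝ (C *ℝ α^) αT≃β ⟨
      C *ℝ α^ *ℝ (α *ℝ T)         ≈⟨ *-assocℝ (C *ℝ α^) α T ⟨
      C *ℝ α^ *ℝ α *ℝ T           ≈⟨ *-congʳℝ T (*-assocℝ C α^ α) ⟩
      C *ℝ (α^ *ℝ α) *ℝ T         ≈⟨ *-congʳℝ T (*-congˡℝ C (*-commℝ α^ α)) ⟩
      C *ℝ α ^ℝ p *ℝ T            ≈⟨ *-congʳℝ T (*-congˡℝ C (root-^ p (fromℕ b) (0≤fromℕ b))) ⟩
      C *ℝ fromℕ b *ℝ T           ≈⟨ *-congˡℝ (C *ℝ fromℕ b) (*-identityʳℝ T) ⟨
      C *ℝ fromℕ b *ℝ (T *ℝ 1ℝ)   ∎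
      where
      α^ = α ^ℝ (1 ℕ.+ k)

    -- After p-th powers this reads b ≤ (2N)^p √m, and after squaring it is the hypothesis. It says
    -- that 1/N is at most 2T, which turns a saving of N into the saving claimed.
    1≤2N*T : ∀ N → b ℕ.* b ℕ.≤ ((2 ℕ.* N) ℕ.^ p ℕ.* (2 ℕ.* N) ℕ.^ p) ℕ.* m →
      1ℝ ≤ℝ fromℕ (2 ℕ.* N) *ℝ T
    1≤2N*T N b²≤e²m = ^-cancel-≤ℝ p (0≤* {c} {T} (0≤fromℕ (2 ℕ.* N)) (0≤root p (s /ℝ b)))
      (≤-transℝ (≃⇒≤ (begin
        1ℝ ^ℝ p                 ≈⟨ 1^n≃1 p ⟩
        1ℝ                      ≈⟨ b*r≃1 ⟨
        fromℕ b *ℝ r            ≈⟨ *-commℝ (fromℕ b) r ⟩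
        r *ℝ fromℕ b            ∎))
      (≤-transℝ (*-monoˡℝ (0<1/n b) b≤es) (≃⇒≤ (begin
        r *ℝ (fromℕ e *ℝ s)     ≈⟨ *-commℝ r (fromℕ e *ℝ s) ⟩
        fromℕ e *ℝ s *ℝ r       ≈⟨ *-assocℝ (fromℕ e) s r ⟩
        fromℕ e *ℝ (s *ℝ r)     ≈⟨ *-congℝ (fromℕ-^ (2 ℕ.* N) p) (≃-symℝ (root-^ p (s /ℝ b) 0≤s/b)) ⟩
        c ^ℝ p *ℝ T ^ℝ p        ≈⟨ ^-distrib-*ℝ c T p ⟨
        (c *ℝ T) ^ℝ p           ∎))))
      where
      c = fromℕ (2 ℕ.* N)
      e = (2 ℕ.* N) ℕ.^ p
      b≤es : fromℕ b ≤ℝ fromℕ e *ℝ s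
      b≤es = ^-cancel-≤ℝ 2 (0≤* {fromℕ e} {s} (0≤fromℕ e) 0≤s)
        (≤-transℝ (≃⇒≤ (≃-transℝ (^2≃* (fromℕ b)) (≃-symℝ (fromℕ-* b b))))
        (≤-transℝ (fromℕ-mono b²≤e²m) (≃⇒≤ (begin
          fromℕ (e ℕ.* e ℕ.* m)              ≈⟨ fromℕ-* (e ℕ.* e) m ⟩
          fromℕ (e ℕ.* e) *ℝ fromℕ m         ≈⟨ *-congℝ (≃-transℝ (fromℕ-* e e) (≃-symℝ (^2≃* (fromℕ e)))) (≃-symℝ s²≃m) ⟩
          fromℕ e ^ℝ 2 *ℝ s ^ℝ 2             ≈⟨ ^-distrib-*ℝ (fromℕ e) s 2 ⟨
          (fromℕ e *ℝ s) ^ℝ 2                ∎))))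

    -- The eventual bound gives x ≤ q = Gb/N, and multiplying q by 2N·T ≥ 1 gives 2G·b·T; the
    -- doubling of G stems from this factor.
    eventual-bound⇒≤ : ∀ N G x .{{_ : NonZero N}} .{{_ : NonZero G}} →
      b ℕ.* b ℕ.≤ ((2 ℕ.* N) ℕ.^ p ℕ.* (2 ℕ.* N) ℕ.^ p) ℕ.* m →
      Eventually (λ n → ι N * seq x n ≤ ι G * ι b) →
      x ≤ℝ fromℕ (2 ℕ.* G) *ℝ fromℕ b *ℝ (√ fromℕ m /ℝ b) ^[ 1 / 2 ℕ.+ k ]
    eventual-bound⇒≤ N G x b²≤e²m Nx≤Gb =
      ≤-transℝ {y = fromℚ q} (pointwise⇒≤ (eventually-map x≤q Nx≤Gb))
      (≤-transℝ (≃⇒≤ (≃-symℝ (*-identityʳℝ (fromℚ q))))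
      (≤-transℝ (*-monoˡℝ 0<q (1≤2N*T N b²≤e²m))
      (≃⇒≤ (pointwise⇒≃ λ n → rearrange (seq T n) n))))
      where
      open +-*-Solver
      N⁻¹ = ℤ.+ 1 / N
      q = ι G * ι b * N⁻¹
      0<q : 0ℚ < q
      0<q = 0<p*q (0<p*q (0<ι G) (0<ι b)) (0<1/n N)
      x≤q : ∀ {n} → ι N * seq x n ≤ ι G * ι b → seq x n ≤ q
      x≤q {n} h = subst (_≤ q) (trans
        (solve 3 (λ n x r → n :* x :* r := n :* r :* x) refl (ι N) (seq x n) N⁻¹)
        (trans (cong (_* seq x n) (n*1/n≡1 N)) (*-identityˡ (seq x n))))
        (*-monoʳ N⁻¹ (<⇒≤ (0<1/n N)) h)
      rearrange : ∀ t n → q * (seq (fromℕ (2 ℕ.* N)) n * t) ≡ seq (fromℕ (2 ℕ.* G)) n * seq (fromℕ b) n * (t * 1ℚ)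
      rearrange t n = trans (cong (λ z → q * (z * t)) (trans (fromℕ-ι (2 ℕ.* N) n) (ι-* 2 N)))
        (trans (solve 6 (λ g b r n t w → g :* b :* r :* (w :* n :* t) := n :* r :* (w :* g :* b :* (t :* con 1ℚ)))
          refl (ι G) (ι b) N⁻¹ (ι N) t (ι 2))
        (trans (cong (_* (ι 2 * ι G * ι b * (t * 1ℚ))) (n*1/n≡1 N))
        (trans (*-identityˡ _)
          (cong₂ (λ y z → y * z * (t * 1ℚ)) (trans (sym (ι-* 2 G)) (sym (fromℕ-ι (2 ℕ.* G) n)))
            (sym (fromℕ-ι b n))))))

-- Choice of N and transfer from Condition H(c) to rational estimates.

module IncompleteSums where

  open import Defs
  open Rationals
  open Sums
  open FinSums
  open Boxes
  open Correlation
  open BoxSum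
  open Progression
  open Reals
  open RootBounds
  open import Data.Bool.Base using (true; false; if_then_else_)
  open import Data.Empty using (⊥-elim)
  open import Data.Fin.Base using (Fin; zero; suc)
  open import Data.Fin.Subset as Subset using (Subset; _∉_)
  open import Data.Integer.Base as ℤ using ()
  open import Data.List.Base using (allFin; length)
  open import Data.Nat.Base as ℕ using (ℕ; zero; suc; NonZero)
  import Data.Nat.Properties as ℕ
  open import Data.Product.Base using (∃; _×_; _,_; proj₁; proj₂)
  open import Data.Rational.Base hiding (NonZero; NonNegative)
  open import Data.Rational.Properties
  open import Data.Rational.Solver using (module +-*-Solver)
  open import Data.Vec.Base using (lookup)
  open import Data.Vec.Properties using ([]=⇒lookup)
  import Data.Vec.Functional as Vector
  open import Function.Base using (_∘_)
  open import Relation.Binary.PropositionalEquality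
  open import Relation.Nullary.Decidable.Core using (yes; no)
  open import Relation.Nullary.Negation.Core using (¬_)
  open import Relation.Unary using (Decidable)

  -- A downward search from n: as long as the test fails, the failure becomes the new upper end, and
  -- P 1 stops the search at the latest.
  last-true : ∀ {P : ℕ → Set} → Decidable P → P 1 → ∀ n → ¬ P (suc n) →
    ∃ λ N → 1 ℕ.≤ N × P N × ¬ P (suc N)
  last-true P? P1 zero    ¬P = ⊥-elim (¬P P1)
  last-true P? P1 (suc n) ¬P with P? (suc n)
  ... | yes P  = suc n , ℕ.s≤s ℕ.z≤n , P , ¬P
  ... | no ¬P′ = last-true P? P1 n ¬P′

  module _ (p m b : ℕ) .{{_ : NonZero p}} .{{_ : NonZero m}} where

    -- Taken at n = b², it shows that b² + 1 fails the test defining N, which gives the search its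
    -- starting point.
    n≤n^p*n^p*m : ∀ n → suc n ℕ.≤ suc n ℕ.^ p ℕ.* suc n ℕ.^ p ℕ.* m
    n≤n^p*n^p*m n = begin
      suc n                                    ≡⟨ ℕ.*-identityʳ (suc n) ⟨
      suc n ℕ.^ 1                              ≤⟨ ℕ.^-monoʳ-≤ (suc n) (ℕ.>-nonZero⁻¹ p) ⟩
      suc n ℕ.^ p                              ≤⟨ ℕ.m≤m*n (suc n ℕ.^ p) (suc n ℕ.^ p) {{ℕ.m^n≢0 (suc n) p}} ⟩
      suc n ℕ.^ p ℕ.* suc n ℕ.^ p              ≤⟨ ℕ.m≤m*n _ m ⟩
      suc n ℕ.^ p ℕ.* suc n ℕ.^ p ℕ.* m        ∎
      where open ℕ.≤-Reasoning

    -- N equals (b / √m)^(1/p) up to a factor 2.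
    scale : m ℕ.≤ b ℕ.* b → ∃ λ N → 1 ℕ.≤ N ×
      N ℕ.^ p ℕ.* N ℕ.^ p ℕ.* m ℕ.≤ b ℕ.* b ×
      b ℕ.* b ℕ.≤ (2 ℕ.* N) ℕ.^ p ℕ.* (2 ℕ.* N) ℕ.^ p ℕ.* m
    scale m≤b² =
      -- The test is N^p √m ≤ b in squared form, a comparison of natural numbers and therefore
      -- decidable. It holds at 1 because m ≤ b².
      let N , 1≤N , yes-N , no-N+1 = last-true (λ N → N ℕ.^ p ℕ.* N ℕ.^ p ℕ.* m ℕ.≤? b ℕ.* b)
            (subst (ℕ._≤ b ℕ.* b) (sym (trans (cong (λ e → e ℕ.* e ℕ.* m) (ℕ.^-zeroˡ p)) (ℕ.*-identityˡ m))) m≤b²)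
            (b ℕ.* b) (ℕ.<⇒≱ (n≤n^p*n^p*m (b ℕ.* b)))
          -- The failure at N + 1 is restated at 2N; the factor 2 in the comparison of N with
          -- (b/√m)^(1/p) arises here.
          N+1≤2N = subst (suc N ℕ.≤_) (cong (N ℕ.+_) (sym (ℕ.+-identityʳ N))) (ℕ.+-monoˡ-≤ N 1≤N)
          e≤ = ℕ.^-monoˡ-≤ p N+1≤2N
      in N , 1≤N , yes-N , ℕ.≤-trans (ℕ.<⇒≤ (ℕ.≰⇒> no-N+1)) (ℕ.*-monoˡ-≤ m (ℕ.*-mono-≤ e≤ e≤))

  -- The real hypothesis yields m ≤ (b + δ)² for every δ > 0. With δ = 1/(2(1 + b)) the right-hand
  -- side is below b² + 1, and integrality of m finishes.
  √m≤b⇒m≤b² : ∀ m b → √ fromℕ m ≤ℝ fromℕ b → m ℕ.≤ b ℕ.* b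
  √m≤b⇒m≤b² m b √m≤b =
    let δ , 0<δ , wδ≡1 = scaled 0<w (positive⁻¹ 1ℚ)
    in m≤[b+δ]²⇒m≤b² 0<δ wδ≡1 (eventually-const (eventually-map
         (λ {n} → subst₂ (λ p q → p ≤ (q + δ) * (q + δ)) (fromℕ-ι m n) (fromℕ-ι b n))
         (√≤⇒≤² √m≤b 0<δ)))
    where
    open ≤-Reasoning
    open +-*-Solver
    w = (1ℚ + 1ℚ) * (1ℚ + ι b)
    2≤w : 1ℚ + 1ℚ ≤ w
    2≤w = p≡q+d⇒q≤p ((1ℚ + 1ℚ) * ι b) (0≤p*q (<⇒≤ (positive⁻¹ (1ℚ + 1ℚ))) (0≤ι b))
      (solve 1 (λ b → (con 1ℚ :+ con 1ℚ) :* (con 1ℚ :+ b) := con 1ℚ :+ con 1ℚ :+ (con 1ℚ :+ con 1ℚ) :* b) refl (ι b))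
    0<w : 0ℚ < w
    0<w = <-≤-trans (positive⁻¹ (1ℚ + 1ℚ)) 2≤w
    m≤[b+δ]²⇒m≤b² : ∀ {δ} → 0ℚ < δ → w * δ ≡ 1ℚ → ι m ≤ (ι b + δ) * (ι b + δ) → m ℕ.≤ b ℕ.* b
    m≤[b+δ]²⇒m≤b² {δ} 0<δ wδ≡1 m≤x = ℕ.≮⇒≥ λ b²<m → <-irrefl refl (begin-strict
      x                                 <⟨ subst (_< x + δ) (+-identityʳ x) (+-monoʳ-< x 0<δ) ⟩
      x + δ                             ≤⟨ p≤p+q (x + δ) (0≤p*q (<⇒≤ 0<δ) 0≤1-δ) ⟩
      x + δ + δ * (1ℚ - δ)              ≡⟨ solve 2 (λ b δ → (b :+ δ) :* (b :+ δ) :+ δ :+ δ :* (con 1ℚ :- δ) :=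
                                             b :* b :+ (con 1ℚ :+ con 1ℚ) :* (con 1ℚ :+ b) :* δ) refl (ι b) δ ⟩
      ι b * ι b + w * δ                 ≡⟨ cong (ι b * ι b +_) wδ≡1 ⟩
      ι b * ι b + 1ℚ                    ≡⟨ +-comm (ι b * ι b) 1ℚ ⟩
      1ℚ + ι b * ι b                    ≡⟨ trans (ι-suc (b ℕ.* b)) (cong (1ℚ +_) (ι-* b b)) ⟨
      ι (suc (b ℕ.* b))                 ≤⟨ ι-mono b²<m ⟩
      ι m                               ≤⟨ m≤x ⟩
      x                                 ∎)
      where
      x = (ι b + δ) * (ι b + δ)
      0≤1-δ : 0ℚ ≤ 1ℚ - δ
      0≤1-δ = subst (_≤ 1ℚ - δ) (+-inverseʳ δ) (+-monoˡ-≤ (- δ) (begin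
        δ           ≡⟨ *-identityˡ δ ⟨
        1ℚ * δ      ≤⟨ *-monoʳ δ (<⇒≤ 0<δ) (≤-trans (p≤p+q 1ℚ (<⇒≤ (positive⁻¹ 1ℚ))) 2≤w) ⟩
        w * δ       ≡⟨ wδ≡1 ⟩
        1ℚ          ∎))

  -- Finitely many thresholds have a maximum. Finiteness of the group thus provides one index at
  -- which the bounds for all x and all a hold together.
  eventually-∀ : ∀ {k} {P : Fin k → ℕ → Set} → (∀ i → Eventually (P i)) → Eventually λ n → ∀ i → P i n
  eventually-∀ {zero}  h = always λ _ ()
  eventually-∀ {suc k} h = eventually-map₂ (λ p q → λ { zero → p ; (suc i) → q i })
    (h zero) (eventually-∀ (h ∘ suc))

  seq≤seq-max : ∀ {k} (f : Fin k → ℝ) i n → seq (f i) n ≤ seq (Vector.foldr _⊔ℝ_ 0ℝ f) n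
  seq≤seq-max f zero    n = p≤p⊔q (seq (f zero) n) _
  seq≤seq-max f (suc i) n = ≤-trans (seq≤seq-max (f ∘ suc) i n) (p≤q⊔p (seq (f zero) n) _)

  seq-re-sumℂ : ∀ {k} (f : Fin k → ℂ) n → seq (re (sumℂ f)) n ≡ Σℚ (allFin k) (λ x → seq (re (f x)) n)
  seq-re-sumℂ {zero}  f n = refl
  seq-re-sumℂ {suc k} f n = trans (cong (seq (re (f zero)) n +_) (seq-re-sumℂ (f ∘ suc) n))
    (sym (Σ-allFin-suc k (λ x → seq (re (f x)) n)))

  seq-im-sumℂ : ∀ {k} (f : Fin k → ℂ) n → seq (im (sumℂ f)) n ≡ Σℚ (allFin k) (λ x → seq (im (f x)) n)
  seq-im-sumℂ {zero}  f n = refl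
  seq-im-sumℂ {suc k} f n = trans (cong (seq (im (f zero)) n +_) (seq-im-sumℂ (f ∘ suc) n))
    (sym (Σ-allFin-suc k (λ x → seq (im (f x)) n)))

  seq-re-∑ : ∀ {k} (B : Subset k) f n →
    seq (re (∑[ B ] f)) n ≡ Σℚ (allFin k) (λ x → if lookup B x then seq (re (f x)) n else 0ℚ)
  seq-re-∑ {k} B f n = trans (seq-re-sumℂ (λ x → if lookup B x then f x else 0ℂ) n) (Σ-cong (allFin k) eq)
    where
    eq : ∀ x → seq (re (if lookup B x then f x else 0ℂ)) n ≡ (if lookup B x then seq (re (f x)) n else 0ℚ)
    eq x with lookup B x
    ... | true  = refl
    ... | false = refl

  seq-im-∑ : ∀ {k} (B : Subset k) f n →
    seq (im (∑[ B ] f)) n ≡ Σℚ (allFin k) (λ x → if lookup B x then seq (im (f x)) n else 0ℚ)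
  seq-im-∑ {k} B f n = trans (seq-im-sumℂ (λ x → if lookup B x then f x else 0ℂ) n) (Σ-cong (allFin k) eq)
    where
    eq : ∀ x → seq (im (if lookup B x then f x else 0ℂ)) n ≡ (if lookup B x then seq (im (f x)) n else 0ℚ)
    eq x with lookup B x
    ... | true  = refl
    ... | false = refl

  seq-re-𝒞 : ∀ A φ a n → seq (re (𝒞 A φ a)) n ≡
    correlation A (λ x → seq (re (φ x)) n) (λ x → seq (im (φ x)) n) a
  seq-re-𝒞 A φ a n = trans (seq-re-sumℂ (λ x → φ x *ℂ conj (φ (x ⊕ a))) n)
    (Σ-cong (elements A) λ x → solve 4 (λ p p′ q q′ → p :* p′ :- q :* (:- q′) := p :* p′ :+ q :* q′) refl
      (seq (re (φ x)) n) (seq (re (φ (x ⊕ a))) n) (seq (im (φ x)) n) (seq (im (φ (x ⊕ a))) n))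
    where
    open FiniteAbelianGroup A using () renaming (_+_ to _⊕_)
    open +-*-Solver

  opaque
    -- The additional 1 leaves room for the tolerances lost when real hypotheses on φ and D are read
    -- at a rational index.
    integral-bound : ∀ c → ∃ λ K → 1 ℕ.≤ K × Eventually λ n → ∣ seq c n ∣ + 1ℚ ≤ ι K
    integral-bound c =
      let q , _ , h = seq-bounded c
          -- The search bound for first roots with denominator 1 serves as an integer above q + 1.
          K = suc (rootBound 0 (q + 1ℚ))
      in K , ℕ.s≤s ℕ.z≤n , eventually-map (λ {n} p → ≤-trans (+-monoˡ-≤ 1ℚ p)
           (≤-trans (<⇒≤ (rootBound-upper 1 0 (q + 1ℚ)))
             (≤-reflexive (trans (*-identityʳ _) (sym (ι-/ K)))))) h

  -- With the sup bound 2K, shifting costs 4K for each of the k directions, and 3K² is the bound on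
  -- the averaged sum.
  constant : ℕ → ℕ → ℕ
  constant k K = k ℕ.* ((K ℕ.+ K) ℕ.+ (K ℕ.+ K)) ℕ.+ 3 ℕ.* (K ℕ.* K)

  ι-constant : ∀ k K → ι (constant k K) ≡ ι k * ((ι K + ι K) + (ι K + ι K)) + ι 3 * (ι K * ι K)
  ι-constant k K = trans (ι-+ (k ℕ.* ((K ℕ.+ K) ℕ.+ (K ℕ.+ K))) (3 ℕ.* (K ℕ.* K))) (cong₂ _+_
    (trans (ι-* k ((K ℕ.+ K) ℕ.+ (K ℕ.+ K)))
      (cong (ι k *_) (trans (ι-+ (K ℕ.+ K) (K ℕ.+ K)) (cong₂ _+_ (ι-+ K K) (ι-+ K K)))))
    (trans (ι-* 3 (K ℕ.* K)) (cong (ι 3 *_) (ι-* K K))))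

  module _ (A : FiniteAbelianGroup) {k : ℕ} {B : Subset (FiniteAbelianGroup.order A)}
           (gap : ProperGAP A k B) (K : ℕ) (1≤K : 1 ℕ.≤ K) where

    open FiniteAbelianGroup A using (order; Carrier)
    private
      b = Subset.∣ B ∣
      p = 2 ℕ.+ k
      G = constant k K

    module _ (N : ℕ) .{{_ : NonZero N}}
             (E²m≤b² : N ℕ.^ p ℕ.* N ℕ.^ p ℕ.* order ℕ.≤ b ℕ.* b)
             (D : Subset order) (∣D∣≤K : Subset.∣ D ∣ ℕ.≤ K) where

      progression-bound : ∀ u v →
        (∀ x → u x * u x + v x * v x ≤ (ι K + ι K) * (ι K + ι K)) →
        (∀ a → lookup D a ≡ false → ι (N ℕ.^ p) * correlation A u v a ≤ (ι K + ι K) * ι b) →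
        ι N * ∣ Σℚ (allFin order) (λ x → if lookup B x then u x else 0ℚ) ∣ ≤ ι G * ι b ×
        ι N * ∣ Σℚ (allFin order) (λ x → if lookup B x then v x else 0ℚ) ∣ ≤ ι G * ι b
      progression-bound u v norm≤ correlation≤ =
        convert u (boxSum-re-≤ A N len 1≤len β σ (offset-+ A gap) (offset-injective A gap)
          K 1≤K D ∣D∣≤K E²m≤l² u v norm≤ correlation≤′) ,
        convert v (boxSum-im-≤ A N len 1≤len β σ (offset-+ A gap) (offset-injective A gap)
          K 1≤K D ∣D∣≤K E²m≤l² u v norm≤ correlation≤′)
        where
        open ProperGAP gap using (len; 2≤len; point; lo)
        β = point lo
        σ = offset A gap
        1≤len : ∀ i → 1 ℕ.≤ len i
        1≤len i = ℕ.≤-trans (ℕ.n≤1+n 1) (2≤len i)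
        l = length (box len)
        b≡l = ∣progression∣ A gap
        E²m≤l² : N ℕ.^ p ℕ.* N ℕ.^ p ℕ.* order ℕ.≤ l ℕ.* l
        E²m≤l² = subst (λ z → N ℕ.^ p ℕ.* N ℕ.^ p ℕ.* order ℕ.≤ z ℕ.* z) b≡l E²m≤b²
        correlation≤′ : ∀ a → lookup D a ≡ false → ι (N ℕ.^ p) * correlation A u v a ≤ (ι K + ι K) * ι l
        correlation≤′ a a∉ = subst (λ z → ι (N ℕ.^ p) * correlation A u v a ≤ (ι K + ι K) * ι z) b≡l (correlation≤ a a∉)
        convert : ∀ w → ι N * ∣ Σℚ (box len) (λ j → w (FiniteAbelianGroup._+_ A β (σ j))) ∣ ≤
                    (ι k * ((ι K + ι K) + (ι K + ι K)) + ι 3 * (ι K * ι K)) * ι l →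
                  ι N * ∣ Σℚ (allFin order) (λ x → if lookup B x then w x else 0ℚ) ∣ ≤ ι G * ι b
        convert w = subst₂ _≤_
          (cong (λ z → ι N * ∣ z ∣) (sym (Σ-progression A gap w)))
          (cong₂ _*_ (sym (ι-constant k K)) (cong ι (sym b≡l)))

      module _ (c : ℝ) (φ : Carrier → ℂ) (c≤K : Eventually λ n → ∣ seq c n ∣ + 1ℚ ≤ ι K) where

        private
          E = N ℕ.^ p
          instance
            E≢0 : NonZero E
            E≢0 = ℕ.m^n≢0 N p
          ε = ℤ.+ 1 / E
          u v : ℕ → Carrier → ℚ
          u n x = seq (re (φ x)) n
          v n x = seq (im (φ x)) n

        -- Each modulus is below the maximum, and the tolerance 1 in removing the square root is
        -- absorbed by K ≥ |c| + 1.
        norm-bound : ‖_‖∞ A φ ≤ℝ c →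
          Eventually λ n → ∀ x → u n x * u n x + v n x * v n x ≤ (ι K + ι K) * (ι K + ι K)
        norm-bound φ≤c = eventually-∀ λ x → eventually-map₂
          (λ {n} h c≤K → begin
            u n x * u n x + v n x * v n x      ≤⟨ h ⟩
            (seq c n + 1ℚ) * (seq c n + 1ℚ)    ≤⟨ ∣p∣≤q⇒p*p≤q*q (begin
              ∣ seq c n + 1ℚ ∣                   ≤⟨ ∣p+q∣≤∣p∣+∣q∣ (seq c n) 1ℚ ⟩
              ∣ seq c n ∣ + 1ℚ                   ≤⟨ c≤K ⟩
              ι K                                ≤⟨ p≤p+q (ι K) (0≤ι K) ⟩
              ι K + ι K                          ∎) ⟩
            (ι K + ι K) * (ι K + ι K)          ∎)
          (√≤⇒≤² {re (φ x) *ℝ re (φ x) +ℝ im (φ x) *ℝ im (φ x)} {c} (≤-transℝ {y = ‖_‖∞ A φ} (pointwise⇒≤ (always (seq≤seq-max (λ x → ∣ φ x ∣ℂ) x))) φ≤c) (positive⁻¹ 1ℚ))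
          c≤K
          where open ≤-Reasoning

        -- This is E√m ≤ b. It holds at every index without error, since approximate roots never
        -- exceed the true one.
        √order≤ : ∀ n → ι E * seq (√ fromℕ order) n ≤ ι b
        √order≤ n = p*p≤q*q⇒p≤q (0≤ι b) (begin
          (ι E * r) * (ι E * r)           ≡⟨ solve 2 (λ e r → (e :* r) :* (e :* r) := e :* e :* (r :* (r :* con 1ℚ))) refl (ι E) r ⟩
          ι E * ι E * (r * (r * 1ℚ))      ≤⟨ *-monoˡ (ι E * ι E) (0≤p*p (ι E)) (approxRoot-lower 2 n _) ⟩
          ι E * ι E * (seq (fromℕ order) n ⊔ 0ℚ)
            ≡⟨ cong (ι E * ι E *_) (trans (p≥q⇒p⊔q≡p (0≤fromℕ order n)) (fromℕ-ι order n)) ⟩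
          ι E * ι E * ι order             ≡⟨ trans (ι-* (E ℕ.* E) order) (cong (_* ι order) (ι-* E E)) ⟨
          ι (E ℕ.* E ℕ.* order)           ≤⟨ ι-mono E²m≤b² ⟩
          ι (b ℕ.* b)                     ≡⟨ ι-* b b ⟩
          ι b * ι b                       ∎)
          where
          open ≤-Reasoning
          open +-*-Solver
          r = seq (√ fromℕ order) n

        -- The real part is bounded by the modulus. After multiplication by E, the term c√m
        -- contributes at most Kb, and the tolerance ε = 1/E contributes 1 ≤ Kb; together they make
        -- the factor 2K.
        correlation-bound : 1 ℕ.≤ b → (∀ a → a ∉ D → ∣ 𝒞 A φ a ∣ℂ ≤ℝ c *ℝ √ fromℕ order) →
          Eventually λ n → ∀ a → lookup D a ≡ false →
            ι E * correlation A (u n) (v n) a ≤ (ι K + ι K) * ι b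
        correlation-bound 1≤b h = eventually-∀ off-D
          where
          open ≤-Reasoning
          bound : ∀ a n → let z = 𝒞 A φ a ; y = seq c n * seq (√ fromℕ order) n in
            seq (re z) n * seq (re z) n + seq (im z) n * seq (im z) n ≤ (y + ε) * (y + ε) →
            ∣ seq c n ∣ + 1ℚ ≤ ι K → ι E * correlation A (u n) (v n) a ≤ (ι K + ι K) * ι b
          bound a n ∣z∣²≤ c≤K = begin
            ι E * correlation A (u n) (v n) a
              ≡⟨ cong (ι E *_) (seq-re-𝒞 A φ a n) ⟨
            ι E * x
              ≤⟨ *-monoˡ (ι E) (0≤ι E) (p*p≤q*q⇒p≤q (0≤∣p∣ (y + ε)) (begin
                   x * x                        ≤⟨ p≤p+q (x * x) (0≤p*p (seq (im z) n)) ⟩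
                   _                            ≤⟨ ∣z∣²≤ ⟩
                   (y + ε) * (y + ε)            ≡⟨ ∣p∣*∣p∣≡p*p (y + ε) ⟨
                   ∣ y + ε ∣ * ∣ y + ε ∣        ∎)) ⟩
            ι E * ∣ y + ε ∣
              ≤⟨ *-monoˡ (ι E) (0≤ι E) (∣p+q∣≤∣p∣+∣q∣ y ε) ⟩
            ι E * (∣ y ∣ + ∣ ε ∣)
              ≡⟨ cong₂ (λ s t → ι E * (s + t)) (trans (∣p*q∣≡∣p∣*∣q∣ (seq c n) r) (cong (∣ seq c n ∣ *_) (0≤p⇒∣p∣≡p (0≤root 2 (fromℕ order) n))))
                   (0≤p⇒∣p∣≡p (<⇒≤ (0<1/n E))) ⟩
            ι E * (∣ seq c n ∣ * r + ε)
              ≡⟨ solve 4 (λ e c r ε → e :* (c :* r :+ ε) := c :* (e :* r) :+ e :* ε) refl (ι E) ∣ seq c n ∣ r ε ⟩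
            ∣ seq c n ∣ * (ι E * r) + ι E * ε
              ≤⟨ +-mono-≤ (*-mono-≤-nonNeg (0≤p*q (0≤ι E) (0≤root 2 (fromℕ order) n)) (0≤ι K)
                   (≤-trans (p≤p+q ∣ seq c n ∣ (<⇒≤ (positive⁻¹ 1ℚ))) c≤K) (√order≤ n))
                   (begin
                     ι E * ε        ≡⟨ n*1/n≡1 E ⟩
                     1ℚ             ≡⟨ ι-1 ⟨
                     ι 1            ≤⟨ ι-mono (ℕ.*-mono-≤ 1≤K 1≤b) ⟩
                     ι (K ℕ.* b)    ≡⟨ ι-* K b ⟩
                     ι K * ι b      ∎) ⟩
            ι K * ι b + ι K * ι b
              ≡⟨ *-distribʳ-+ (ι b) (ι K) (ι K) ⟨
            (ι K + ι K) * ι b ∎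
            where
            open +-*-Solver
            z = 𝒞 A φ a
            x = seq (re z) n
            r = seq (√ fromℕ order) n
            y = seq c n * r
          -- Non-membership is a premise inside the eventual statement, so every a of the finite
          -- group can be treated: for a in D it is vacuous.
          off-D : ∀ a → Eventually λ n → lookup D a ≡ false →
            ι E * correlation A (u n) (v n) a ≤ (ι K + ι K) * ι b
          off-D a with lookup D a in eq
          ... | true  = always λ _ ()
          ... | false = eventually-map₂ (λ {n} p q _ → bound a n p q)
            (√≤⇒≤² (h a λ a∈D → contradict (trans (sym ([]=⇒lookup a∈D)) eq)) (0<1/n E)) c≤K
            where
            contradict : ∀ {P : Set} → true ≡ false → P
            contradict ()

        sum-bound : 1 ℕ.≤ b → ‖_‖∞ A φ ≤ℝ c →
          (∀ a → a ∉ D → ∣ 𝒞 A φ a ∣ℂ ≤ℝ c *ℝ √ fromℕ order) →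
          Eventually λ n → ι N * seq ∣ ∑[ B ] φ ∣ℂ n ≤ ι (2 ℕ.* G) * ι b
        sum-bound 1≤b φ≤c h = eventually-map₂ bound (norm-bound φ≤c) (correlation-bound 1≤b h)
          where
          open ≤-Reasoning
          open +-*-Solver
          z = ∑[ B ] φ
          bound : ∀ {n} →
            (∀ x → u n x * u n x + v n x * v n x ≤ (ι K + ι K) * (ι K + ι K)) →
            (∀ a → lookup D a ≡ false → ι E * correlation A (u n) (v n) a ≤ (ι K + ι K) * ι b) →
            ι N * seq ∣ z ∣ℂ n ≤ ι (2 ℕ.* G) * ι b
          bound {n} norm≤ correlation≤ = p*p≤q*q⇒p≤q (0≤p*q (0≤ι (2 ℕ.* G)) (0≤ι b)) (begin
            (ι N * r) * (ι N * r)
              ≡⟨ solve 2 (λ e r → (e :* r) :* (e :* r) := e :* e :* (r :* (r :* con 1ℚ))) refl (ι N) r ⟩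
            ι N * ι N * (r * (r * 1ℚ))
              ≤⟨ *-monoˡ (ι N * ι N) (0≤p*p (ι N)) (approxRoot-lower 2 n _) ⟩
            ι N * ι N * ((x * x + y * y) ⊔ 0ℚ)
              ≡⟨ cong (ι N * ι N *_) (p≥q⇒p⊔q≡p (+-mono-≤ (0≤p*p x) (0≤p*p y))) ⟩
            ι N * ι N * (x * x + y * y)
              ≡⟨ solve 3 (λ n x y → n :* n :* (x :* x :+ y :* y) := (n :* x) :* (n :* x) :+ (n :* y) :* (n :* y)) refl (ι N) x y ⟩
            (ι N * x) * (ι N * x) + (ι N * y) * (ι N * y)
              ≤⟨ +-mono-≤ (square x x≤) (square y y≤) ⟩
            Gb * Gb + Gb * Gb
              -- The two components give 2(Gb)², enlarged to 4(Gb)² so that its root 2Gb stays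
              -- integral.
              ≤⟨ p≤p+q _ (+-mono-≤ (0≤p*p Gb) (0≤p*p Gb)) ⟩
            Gb * Gb + Gb * Gb + (Gb * Gb + Gb * Gb)
              ≡⟨ solve 2 (λ g b → let gb = g :* b in gb :* gb :+ gb :* gb :+ (gb :* gb :+ gb :* gb) :=
                   ((con 1ℚ :+ con 1ℚ) :* g :* b) :* ((con 1ℚ :+ con 1ℚ) :* g :* b)) refl (ι G) (ι b) ⟩
            ((1ℚ + 1ℚ) * ι G * ι b) * ((1ℚ + 1ℚ) * ι G * ι b)
              ≡⟨ cong (λ t → (t * ι b) * (t * ι b)) (trans (ι-* 2 G) (cong (_* ι G) (trans (ι-suc 1) (cong (1ℚ +_) ι-1)))) ⟨
            (ι (2 ℕ.* G) * ι b) * (ι (2 ℕ.* G) * ι b) ∎)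
            where
            r = seq ∣ z ∣ℂ n
            x = seq (re z) n
            y = seq (im z) n
            Gb = ι G * ι b
            bounds = progression-bound (u n) (v n) norm≤ correlation≤
            x≤ : ι N * ∣ x ∣ ≤ Gb
            x≤ = subst (λ t → ι N * ∣ t ∣ ≤ Gb) (sym (seq-re-∑ B φ n)) (proj₁ bounds)
            y≤ : ι N * ∣ y ∣ ≤ Gb
            y≤ = subst (λ t → ι N * ∣ t ∣ ≤ Gb) (sym (seq-im-∑ B φ n)) (proj₂ bounds)
            square : ∀ t → ι N * ∣ t ∣ ≤ Gb → (ι N * t) * (ι N * t) ≤ Gb * Gb
            square t h = ∣p∣≤q⇒p*p≤q*q (subst (_≤ Gb)
              (sym (trans (∣p*q∣≡∣p∣*∣q∣ (ι N) t) (cong (_* ∣ t ∣) (0≤p⇒∣p∣≡p (0≤ι N))))) h)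

-- The constant and the final estimate.

open import Defs
open import Data.Fin.Base using (Fin)
open import Data.Fin.Subset using (Subset; ∣_∣)
open import Data.Nat.Base using (ℕ; NonZero; _≤_; _+_; _*_)
open import Data.Product.Base using (∃; _×_)

open import Data.Nat.Base using (_^_; s≤s; z≤n; >-nonZero; >-nonZero⁻¹)
import Data.Nat.Properties as ℕ
open import Data.Product.Base using (_,_)
import Data.Rational.Base as ℚ
import Data.Rational.Properties as ℚ
open import Relation.Binary.PropositionalEquality using (sym; subst; subst₂)

open Rationals using (ι; ι-/; ι-1; ι-mono; ι-cancel-≤)
open Reals
open RootBounds
open IncompleteSums

module _ (k : ℕ) (c : ℝ) (K : ℕ) (1≤K : 1 ≤ K)
         (c≤K : Eventually λ n → ℚ.∣ seq c n ∣ ℚ.+ ℚ.1ℚ ℚ.≤ ι K) where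

  private
    G = 2 * constant k K

    instance
      G≢0 : NonZero G
      G≢0 = >-nonZero (ℕ.≤-trans (ℕ.*-mono-≤ {1} {3} (s≤s z≤n) (ℕ.*-mono-≤ 1≤K 1≤K))
        (ℕ.≤-trans (ℕ.m≤n+m (3 * (K * K)) (k * ((K + K) + (K + K)))) (ℕ.m≤n*m (constant k K) 2)))

  0<2G : 0ℝ <ℝ fromℕ (2 * G)
  0<2G = mk< ℚ.1ℚ (ℚ.positive⁻¹ ℚ.1ℚ) (always λ n →
    subst (ℚ._≤ seq (fromℕ (2 * G)) n) (sym (ℚ.+-identityˡ ℚ.1ℚ))
      (subst₂ ℚ._≤_ ι-1 (ι-/ (2 * G)) (ι-mono (ℕ.≤-trans (>-nonZero⁻¹ G) (ℕ.m≤n*m G 2)))))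

  ∣∑∣≤ : (m : ℕ) .{{_ : NonZero m}} (B : Subset m) .{{_ : NonZero ∣ B ∣}} →
    ProperGAP (ℤ/ m ℤ) k B → √ fromℕ m ≤ℝ fromℕ ∣ B ∣ →
    (φ : Fin m → ℂ) → ConditionH (ℤ/ m ℤ) c φ →
    ∣ ∑[ B ] φ ∣ℂ ≤ℝ fromℕ (2 * G) *ℝ fromℕ ∣ B ∣ *ℝ (√ fromℕ m /ℝ ∣ B ∣) ^[ 1 / 2 + k ]
  ∣∑∣≤ m B gap √m≤∣B∣ φ H =
    let N , 1≤N , N≤ , ≤2N = scale (2 + k) m ∣ B ∣ (√m≤b⇒m≤b² m ∣ B ∣ √m≤∣B∣)
        instance N≢0 = >-nonZero 1≤N
    in eventual-bound⇒≤ k ∣ B ∣ m N G (∣ ∑[ B ] φ ∣ℂ) ≤2N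
         (sum-bound (ℤ/ m ℤ) gap K 1≤K N N≤ D ∣D∣≤K c φ c≤K (>-nonZero⁻¹ ∣ B ∣) bounded correlation)
    where
    open ConditionH H
    ∣D∣≤K : ∣ D ∣ ≤ K
    -- At a large index |D| ≤ c + 1 ≤ K; both ends are constant in the index, so a single index
    -- decides.
    ∣D∣≤K = ι-cancel-≤ (eventually-const (eventually-map₂
      (λ {n} d≤c+1 c+1≤K → subst (ℚ._≤ ι K) (fromℕ-ι ∣ D ∣ n) (ℚ.≤-trans d≤c+1
        (ℚ.≤-trans (ℚ.+-monoˡ-≤ ℚ.1ℚ (p≤∣p∣ (seq c n))) c+1≤K)))
      (_≤ℝ_.eventually ∣D∣≤c ℚ.1ℚ (ℚ.positive⁻¹ ℚ.1ℚ)) c≤K))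

theorem4p1 :
  (k : ℕ) → 1 ≤ k → (c : ℝ) → 1ℝ ≤ℝ c →
  ∃ λ (C : ℝ) → 0ℝ <ℝ C ×
    ((m : ℕ) .{{_ : NonZero m}} (B : Subset m) (gap : ProperGAP (ℤ/ m ℤ) k B) →
     √ fromℕ m ≤ℝ fromℕ ∣ B ∣ →
     (φ : Fin m → ℂ) → ConditionH (ℤ/ m ℤ) c φ →
     let instance ∣B∣-nonZero = ProperGAP.∣B∣≢0 gap
         bound₁ = C *ℝ fromℕ ∣ B ∣ ^[ 1 + k / 2 + k ] *ℝ fromℕ m ^[ 1 / 2 * (2 + k) ]
         bound₂ = C *ℝ fromℕ ∣ B ∣ *ℝ (√ fromℕ m /ℝ ∣ B ∣) ^[ 1 / 2 + k ]
     in  ∣ ∑[ B ] φ ∣ℂ ≤ℝ bound₁ × bound₁ ≃ℝ bound₂)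
theorem4p1 k _ c _ =
  let K , 1≤K , c≤K = integral-bound c
      -- The inner doubling joins the real and imaginary parts; the outer one pays for N being known
      -- up to a factor 2. Since K is read off from c alone, C depends only on k and c.
      C = fromℕ (2 * (2 * constant k K))
  in C , 0<2G k c K 1≤K c≤K , λ m B gap √m≤∣B∣ φ H →
    let instance ∣B∣-nonZero = ProperGAP.∣B∣≢0 gap
        agree = bounds-agree k ∣ B ∣ m C
    in ≤-transℝ (∣∑∣≤ k c K 1≤K c≤K m B gap √m≤∣B∣ φ H) (≃⇒≤ (≃-symℝ agree)) , agree
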